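{- Let $t(n)$ denote the number of partitions $\lambda$ of $n$ such that $\mathcal{O}(\lambda)\equiv\mathcal{O}(\lambda')\pmod 4$, let $p(n)$ be the number of partitions of $n$, and let $u(n)=p(n)-t(n)$. Put \[ V(q)=\frac{(q^2;q^2)^2_{\infty}(q^8;q^8)^2_{\infty}}{(q;q)^5_{\infty}(q^4;q^4)_{\infty}}. \] Then \begin{align*} \sum_{n=0}^{\infty}u(4n)q^{n}&=2q^2(q^{16};q^{16})_{\infty}(-q;q^{16})_{\infty}(-q^{15};q^{16})_{\infty}V(q),\\ \sum_{n=0}^{\infty}u(4n+1)q^{n}&=2q(q^{16};q^{16})_{\infty}(-q^3;q^{16})_{\infty}(-q^{13};q^{16})_{\infty}V(q),\\ \sum_{n=0}^{\infty}u(4n+2)q^{n}&=2(q^{16};q^{16})_{\infty}(-q^{7};q^{16})_{\infty}(-q^{9};q^{16})_{\infty}V(q),\\ \sum_{n=0}^{\infty}u(4n+3)q^{n}&=2(q^{16};q^{16})_{\infty}(-q^{5};q^{16})_{\infty}(-q^{11};q^{16})_{\infty}V(q). \end{align*}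
   Context: For a partition $\lambda$, $\lambda'$ denotes its conjugate partition and $\mathcal{O}(\lambda)$ denotes the number of odd parts of $\lambda$. For $|q|<1$, $(a;q)_\infty=\prod_{k\ge 0}(1-aq^k)$. -}

module Defs where

open import Data.Nat as ℕ using (ℕ; zero; suc; _∸_; _≤?_; _⊔_; _≟_)
open import Data.Nat.DivMod using (_%_)
open import Data.Integer as ℤ using (ℤ; +_; -_)
open import Data.List using (List; []; _∷_; map; concatMap; filter; length; upTo; foldr)
open import Relation.Nullary using (yes; no)
open import Relation.Nullary.Decidable using (⌊_⌋)
open import Data.Bool using (if_then_else_)

-- Partitions (as weakly decreasing lists of positive parts)

range1 : ℕ → List ℕ
range1 m = map suc (upTo m)

-- partsB fuel n m : all partitions of n into parts ≤ m, written in
-- weakly decreasing order (fuel ≥ n guarantees completeness).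
partsB : ℕ → ℕ → ℕ → List (List ℕ)
partsB _        zero    m = [] ∷ []
partsB zero     (suc n) m = []
partsB (suc f)  (suc n) m =
  concatMap (λ k → map (k ∷_) (partsB f (suc n ∸ k) k)) (range1 (m ℕ.⊓ suc n))

partitions : ℕ → List (List ℕ)
partitions n = partsB n n n

largest : List ℕ → ℕ
largest = foldr _⊔_ 0

conjugate : List ℕ → List ℕ
conjugate λs = map (λ j → length (filter (λ x → j ≤? x) λs)) (range1 (largest λs))

oddParts : List ℕ → ℕ
oddParts λs = length (filter (λ x → x % 2 ≟ 1) λs)

p : ℕ → ℕ
p n = length (partitions n)

t : ℕ → ℕ
t n = length (filter (λ λs → oddParts λs % 4 ≟ oddParts (conjugate λs) % 4) (partitions n))

u : ℕ → ℤ
u n = + p n ℤ.- + t n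

FPS : Set
FPS = ℕ → ℤ

sumTo : ℕ → (ℕ → ℤ) → ℤ
sumTo zero    h = h 0
sumTo (suc n) h = sumTo n h ℤ.+ h (suc n)

one : FPS
one zero    = + 1
one (suc _) = + 0

const : ℤ → FPS
const c zero    = c
const c (suc _) = + 0

_⊗_ : FPS → FPS → FPS
(f ⊗ g) n = sumTo n (λ i → f i ℤ.* g (n ∸ i))
infixl 7 _⊗_

mono : ℤ → ℕ → FPS
mono c k n = if ⌊ n ≟ k ⌋ then c else + 0

pow : FPS → ℕ → FPS
pow f zero    = one
pow f (suc k) = f ⊗ pow f k

pochFin : ℤ → ℕ → ℕ → ℕ → FPS
pochFin c s d zero    = one
pochFin c s d (suc N) = pochFin c s d N ⊗ (λ n → one n ℤ.- mono c (s ℕ.+ d ℕ.* N) n)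

-- (c q^s ; q^(suc d'))_∞ = ∏_{k≥0} (1 - c q^{s + (suc d') k}).
-- Since the step is ≥ 1, the factors with k > n do not affect the
-- coefficient of q^n, so that coefficient is the one of the finite
-- product over k ≤ n.
poch : ℤ → ℕ → ℕ → FPS
poch c s zero     n = + 0 -- step 0 is never used (ill-defined product)
poch c s (suc d') n = pochFin c s (suc d') (suc n) n

-- multiplicative inverse of a series with constant term 1:
-- g 0 = 1, g n = - Σ_{i=1}^{n} f i * g (n - i).
invAux : FPS → ℕ → FPS
invAux f zero    = one
invAux f (suc n) m with m ≤? n
... | yes _ = invAux f n m
... | no  _ = ℤ.- sumTo n (λ i → f (suc i) ℤ.* invAux f n (n ∸ i))

inv : FPS → FPS
inv f n = invAux f n n

qq : ℕ → FPS
qq k = poch (+ 1) k k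

V : FPS
V = pow (qq 2) 2 ⊗ pow (qq 8) 2 ⊗ inv (pow (qq 1) 5 ⊗ qq 4)

rhs : ℕ → ℕ → ℕ → FPS
rhs e a b = mono (+ 2) e ⊗ qq 16 ⊗ poch (- + 1) a 16 ⊗ poch (- + 1) b 16 ⊗ V

{-# OPTIONS --safe #-}
module Submission where

-- Write E_k = (q^k;q^k), O_s = (q^s;q^2s), M_s = (-q^s;q^2s) (infinite products).
-- The number of odd columns of a partition is the alternating sum of its parts, so the sign
-- (-1)^((O(λ)-O(λ'))/2) can be computed part by part; it is +1 exactly on the partitions
-- counted by t.  Hence 2u = p - f with f the signed count.  For the signed series F of all
-- partitions (Stanley, Andrews, Boulet) F E_4 M_2² = M_1, while P E_4 O_2² = M_1 by Euler.
-- By the Jacobi triple product E_4 M_2² = φ(q²) and E_4 O_2² = φ(-q²), and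
-- φ(q²) - φ(-q²) = 4q²ψ(q^16); it follows that Σ u(n) q^n = 2q² ψ(q) V(q^4), and splitting
-- ψ(q) = Σ q^(k(k+1)/2) according to k mod 8 gives the four series: each receives two residue
-- classes of k, the two halves of a theta series to which the triple product applies again.

open import Defs
open import Algebra.Bundles using (CommutativeRing)
open import Algebra.Solver.Ring.AlmostCommutativeRing using (AlmostCommutativeRing; fromCommutativeRing; _-Raw-AlmostCommutative⟶_)
import Algebra.Solver.Ring
open import Data.Bool using (if_then_else_)
open import Data.Integer as ℤ using (ℤ; +_)
import Data.Integer.Properties as ℤₚ
import Data.Integer.Tactic.RingSolver as ℤ-Solver
open import Algebra.Properties.AbelianGroup ℤₚ.+-0-abelianGroup using () renaming (∙-cancelˡ to +-cancelˡ)
open import Data.List using (List; []; _∷_; _++_; map; concatMap; filter; length; upTo; [_])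
import Data.List.Properties as Listₚ
open import Data.List.Relation.Unary.All as All using (All; []; _∷_)
import Data.List.Relation.Unary.All.Properties as Allₚ
open import Data.Maybe using (Maybe; just; nothing)
open import Data.Nat using (ℕ; zero; suc; _+_; _*_; _∸_; _≤_; _<_; z≤n; s≤s; _≤?_; _<?_; _≟_; ≤′-reflexive; ≤′-step; _⊓_; _⊔_; ⌊_/2⌋)
open import Data.Nat.DivMod using (_%_; _/_; [m+kn]%n≡m%n; m≡m%n+[m/n]*n; m%n<n)
open import Data.Nat.ListAction using (sum)
open import Data.Nat.ListAction.Properties using (sum-++)
import Data.Nat.Properties as ℕₚ
import Data.Nat.Tactic.RingSolver as ℕ-Solver
open import Data.Product using (_×_; _,_; ∃-syntax)
open import Data.Sum using (inj₁; inj₂; _⊎_)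
open import Function using (id)
open import Level using (0ℓ)
open import Relation.Binary.Bundles using (Setoid)
open import Relation.Binary.PropositionalEquality using (_≡_; _≢_; refl; sym; trans; cong; cong₂; subst; module ≡-Reasoning)
open import Relation.Nullary using (yes; no; contradiction; ¬_; Dec)
open import Relation.Nullary.Decidable using (isYes≗does)
open import Relation.Unary using (Pred; Decidable)

-- The sign is not multiplicative over the parts: putting `k` in front of `μ` contributes
-- (-1)^(⌊k/2⌋ + |μ|), and the factor (-1)^|μ| replaces q by -q in the generating function of what
-- remains. Every recurrence in the largest part therefore couples F(q) with F(-q), and no product
-- can be read off part by part. For odd parts the coupling is undone by applying the recurrence
-- twice, at the price of factors 1 + q^(4i+2); this accounts for one of the two factors M_2. The
-- other one, together with E_4 and M_1, comes from a q-difference equation in an auxiliary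
-- variable. An infinite product is accessible only through its truncations, so identities between
-- limits are proved modulo q^N for every N, and quotients are compared after clearing denominators
-- with constant term 1. The dissection is possible because V occurs at q^4: a series in q^4 passes
-- unchanged through the extraction of a residue class of exponents modulo 4, so that only 2q²ψ(q)
-- has to be split.

private variable
  f f′ f″ g g′ : FPS

-- The ring of power series

sumTo-cong : ∀ n {f g : FPS} → (∀ i → i ≤ n → f i ≡ g i) → sumTo n f ≡ sumTo n g
sumTo-cong zero    e = e 0 z≤n
sumTo-cong (suc n) e =
  cong₂ ℤ._+_ (sumTo-cong n (λ i i≤n → e i (ℕₚ.m≤n⇒m≤1+n i≤n))) (e (suc n) ℕₚ.≤-refl)

sumTo-+ : ∀ n (f g : FPS) → sumTo n (λ i → f i ℤ.+ g i) ≡ sumTo n f ℤ.+ sumTo n g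
sumTo-+ zero    f g = refl
sumTo-+ (suc n) f g rewrite sumTo-+ n f g = interchange (sumTo n f) (sumTo n g) (f (suc n)) (g (suc n))
  where
  interchange : ∀ a b c d → (a ℤ.+ b) ℤ.+ (c ℤ.+ d) ≡ (a ℤ.+ c) ℤ.+ (b ℤ.+ d)
  interchange = ℤ-Solver.solve-∀

sumTo-* : ∀ n c (f : FPS) → sumTo n (λ i → c ℤ.* f i) ≡ c ℤ.* sumTo n f
sumTo-* zero    c f = refl
sumTo-* (suc n) c f rewrite sumTo-* n c f = sym (ℤₚ.*-distribˡ-+ c (sumTo n f) (f (suc n)))

sumTo-0 : ∀ n {f : FPS} → (∀ i → i ≤ n → f i ≡ + 0) → sumTo n f ≡ + 0
sumTo-0 zero    e = e 0 z≤n
sumTo-0 (suc n) e =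
  cong₂ ℤ._+_ (sumTo-0 n (λ i i≤n → e i (ℕₚ.m≤n⇒m≤1+n i≤n))) (e (suc n) ℕₚ.≤-refl)

sumTo-suc : ∀ n (f : FPS) → sumTo (suc n) f ≡ f 0 ℤ.+ sumTo n (λ i → f (suc i))
sumTo-suc zero    f = refl
sumTo-suc (suc n) f = trans (cong (ℤ._+ f (suc (suc n))) (sumTo-suc n f)) (ℤₚ.+-assoc (f 0) _ _)

sumTo-reverse : ∀ n (f : FPS) → sumTo n f ≡ sumTo n (λ i → f (n ∸ i))
sumTo-reverse zero    f = refl
sumTo-reverse (suc n) f = begin
  sumTo n f ℤ.+ f (suc n)                     ≡⟨ ℤₚ.+-comm (sumTo n f) _ ⟩
  f (suc n) ℤ.+ sumTo n f                     ≡⟨ cong (ℤ._+_ (f (suc n))) (sumTo-reverse n f) ⟩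
  f (suc n) ℤ.+ sumTo n (λ i → f (n ∸ i))     ≡⟨ sym (sumTo-suc n (λ i → f (suc n ∸ i))) ⟩
  sumTo (suc n) (λ i → f (suc n ∸ i))         ∎
  where open ≡-Reasoning

-- A record, so that both series can be inferred from a proof of equality.
infix 4 _≋_
record _≋_ (f g : FPS) : Set where
  constructor pointwise
  field coeff : ∀ n → f n ≡ g n
open _≋_

infixl 6 _⊕_ _⊝_
infix 8 ⊖_

𝟎 : FPS
𝟎 _ = + 0

_⊕_ : FPS → FPS → FPS
(f ⊕ g) n = f n ℤ.+ g n

⊖_ : FPS → FPS
(⊖ f) n = ℤ.- f n

_⊝_ : FPS → FPS → FPS
f ⊝ g = f ⊕ ⊖ g

≋-refl : f ≋ f
≋-refl = pointwise λ _ → refl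

≋-sym : f ≋ g → g ≋ f
≋-sym e = pointwise λ n → sym (coeff e n)

≋-trans : f ≋ f′ → f′ ≋ f″ → f ≋ f″
≋-trans e e′ = pointwise λ n → trans (coeff e n) (coeff e′ n)

⊗-suc : ∀ (f g : FPS) n → (f ⊗ g) (suc n) ≡ f 0 ℤ.* g (suc n) ℤ.+ ((λ i → f (suc i)) ⊗ g) n
⊗-suc f g n = sumTo-suc n (λ i → f i ℤ.* g (suc n ∸ i))

⊗-cong : f ≋ f′ → g ≋ g′ → f ⊗ g ≋ f′ ⊗ g′
⊗-cong e e′ = pointwise λ n → sumTo-cong n (λ i _ → cong₂ ℤ._*_ (coeff e i) (coeff e′ (n ∸ i)))

⊗-comm : ∀ f g → f ⊗ g ≋ g ⊗ f
⊗-comm f g = pointwise λ n →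
  trans (sumTo-reverse n _) (sumTo-cong n (λ i i≤n →
    trans (ℤₚ.*-comm (f (n ∸ i)) _) (cong (λ j → g j ℤ.* f (n ∸ i)) (ℕₚ.m∸[m∸n]≡n i≤n))))

⊗-distribʳ : ∀ h f g → (f ⊕ g) ⊗ h ≋ (f ⊗ h) ⊕ (g ⊗ h)
⊗-distribʳ h f g = pointwise λ n →
  trans (sumTo-cong n (λ i _ → ℤₚ.*-distribʳ-+ (h (n ∸ i)) (f i) (g i))) (sumTo-+ n _ _)

⊗-scale : ∀ c (f g : FPS) n → ((λ i → c ℤ.* f i) ⊗ g) n ≡ c ℤ.* (f ⊗ g) n
⊗-scale c f g n = trans (sumTo-cong n (λ i _ → ℤₚ.*-assoc c (f i) _)) (sumTo-* n c _)

-- Peeling off the constant term of `f` replaces the rearrangement of a double sum by an induction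
-- on the degree. The induction ranges over all `f`, since its hypothesis is applied to the tail of
-- `f`.
⊗-assoc : ∀ f g h → (f ⊗ g) ⊗ h ≋ f ⊗ (g ⊗ h)
⊗-assoc f g h = pointwise (assoc f)
  where
  open ≡-Reasoning
  assoc : ∀ f n → ((f ⊗ g) ⊗ h) n ≡ (f ⊗ (g ⊗ h)) n
  assoc f zero    = ℤₚ.*-assoc (f 0) (g 0) (h 0)
  assoc f (suc n) = begin
    ((f ⊗ g) ⊗ h) (suc n)
      ≡⟨ ⊗-suc (f ⊗ g) h n ⟩
    f 0 ℤ.* g 0 ℤ.* h (suc n) ℤ.+ ((λ i → (f ⊗ g) (suc i)) ⊗ h) n
      ≡⟨ cong (ℤ._+_ (f 0 ℤ.* g 0 ℤ.* h (suc n))) (coeff (⊗-cong {g = h} (pointwise (⊗-suc f g)) ≋-refl) n) ⟩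
    f 0 ℤ.* g 0 ℤ.* h (suc n) ℤ.+ (((λ i → f 0 ℤ.* g (suc i)) ⊕ (tail f ⊗ g)) ⊗ h) n
      ≡⟨ cong (ℤ._+_ (f 0 ℤ.* g 0 ℤ.* h (suc n))) (coeff (⊗-distribʳ h (λ i → f 0 ℤ.* g (suc i)) (tail f ⊗ g)) n) ⟩
    f 0 ℤ.* g 0 ℤ.* h (suc n) ℤ.+ (((λ i → f 0 ℤ.* g (suc i)) ⊗ h) n ℤ.+ ((tail f ⊗ g) ⊗ h) n)
      ≡⟨ cong₂ (λ a b → f 0 ℤ.* g 0 ℤ.* h (suc n) ℤ.+ (a ℤ.+ b)) (⊗-scale (f 0) (tail g) h n) (assoc (tail f) n) ⟩
    f 0 ℤ.* g 0 ℤ.* h (suc n) ℤ.+ (f 0 ℤ.* (tail g ⊗ h) n ℤ.+ (tail f ⊗ (g ⊗ h)) n)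
      ≡⟨ regroup (f 0) (g 0) (h (suc n)) _ _ ⟩
    f 0 ℤ.* (g 0 ℤ.* h (suc n) ℤ.+ (tail g ⊗ h) n) ℤ.+ (tail f ⊗ (g ⊗ h)) n
      ≡⟨ cong (λ a → f 0 ℤ.* a ℤ.+ (tail f ⊗ (g ⊗ h)) n) (⊗-suc g h n) ⟨
    f 0 ℤ.* (g ⊗ h) (suc n) ℤ.+ (tail f ⊗ (g ⊗ h)) n
      ≡⟨ ⊗-suc f (g ⊗ h) n ⟨
    (f ⊗ (g ⊗ h)) (suc n) ∎
    where
    tail : FPS → FPS
    tail k i = k (suc i)
    regroup : ∀ a b c d e → a ℤ.* b ℤ.* c ℤ.+ (a ℤ.* d ℤ.+ e) ≡ a ℤ.* (b ℤ.* c ℤ.+ d) ℤ.+ e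
    regroup = ℤ-Solver.solve-∀

const-⊗ : ∀ c f n → (const c ⊗ f) n ≡ c ℤ.* f n
const-⊗ c f zero    = refl
const-⊗ c f (suc n) = begin
  (const c ⊗ f) (suc n)                              ≡⟨ ⊗-suc (const c) f n ⟩
  c ℤ.* f (suc n) ℤ.+ sumTo n (λ i → + 0 ℤ.* f (n ∸ i)) ≡⟨ cong (ℤ._+_ (c ℤ.* f (suc n))) (sumTo-0 n (λ i _ → ℤₚ.*-zeroˡ (f (n ∸ i)))) ⟩
  c ℤ.* f (suc n) ℤ.+ + 0                            ≡⟨ ℤₚ.+-identityʳ _ ⟩
  c ℤ.* f (suc n)                                    ∎
  where open ≡-Reasoning

one≋const : one ≋ const (+ 1)
one≋const = pointwise λ { zero → refl ; (suc _) → refl }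

⊗-identityˡ : ∀ f → one ⊗ f ≋ f
⊗-identityˡ f = ≋-trans (⊗-cong {g = f} one≋const ≋-refl) (pointwise λ n → trans (const-⊗ (+ 1) f n) (ℤₚ.*-identityˡ (f n)))

FPS-commutativeRing : CommutativeRing 0ℓ 0ℓ
FPS-commutativeRing = record
  { Carrier = FPS ; _≈_ = _≋_ ; _+_ = _⊕_ ; _*_ = _⊗_ ; -_ = ⊖_ ; 0# = 𝟎 ; 1# = one
  ; isCommutativeRing = record
    { isRing = record
      { +-isAbelianGroup = record
        { isGroup = record
          { isMonoid = record
            { isSemigroup = record
              { isMagma = record
                { isEquivalence = record { refl = ≋-refl ; sym = ≋-sym ; trans = ≋-trans }
                ; ∙-cong = λ e e′ → pointwise λ n → cong₂ ℤ._+_ (coeff e n) (coeff e′ n)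
                }
              ; assoc = λ f g h → pointwise λ n → ℤₚ.+-assoc (f n) (g n) (h n)
              }
            ; identity = (λ f → pointwise λ n → ℤₚ.+-identityˡ (f n)) , (λ f → pointwise λ n → ℤₚ.+-identityʳ (f n))
            }
          ; inverse = (λ f → pointwise λ n → ℤₚ.+-inverseˡ (f n)) , (λ f → pointwise λ n → ℤₚ.+-inverseʳ (f n))
          ; ⁻¹-cong = λ e → pointwise λ n → cong ℤ.-_ (coeff e n)
          }
        ; comm = λ f g → pointwise λ n → ℤₚ.+-comm (f n) (g n)
        }
      ; *-cong = ⊗-cong
      ; *-assoc = ⊗-assoc
      ; *-identity = ⊗-identityˡ , (λ f → ≋-trans (⊗-comm f one) (⊗-identityˡ f))
      ; distrib = (λ f g h → ≋-trans (⊗-comm f (g ⊕ h)) (≋-trans (⊗-distribʳ f g h)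
                    (pointwise λ n → cong₂ ℤ._+_ (coeff (⊗-comm g f) n) (coeff (⊗-comm h f) n))))
                , ⊗-distribʳ
      }
    ; *-comm = ⊗-comm
    }
  }

open CommutativeRing FPS-commutativeRing
  using () renaming (+-cong to ⊕-cong; -‿cong to ⊖-cong; *-identityʳ to ⊗-identityʳ; zeroʳ to ⊗-zeroʳ; setoid to FPS-setoid)

module ≋-Reasoning where
  open import Relation.Binary.Reasoning.Setoid FPS-setoid public

private
  FPS-almostCommutativeRing : AlmostCommutativeRing 0ℓ 0ℓ
  FPS-almostCommutativeRing = fromCommutativeRing FPS-commutativeRing

  -- Agrees with const, but makes the solver's literals 0 and 1 unfold to 𝟎 and one.
  embed : ℤ → FPS
  embed (+ 0) = 𝟎
  embed (+ 1) = one
  embed c     = const c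

  embed≋const : ∀ c → embed c ≋ const c
  embed≋const (+ 0)           = pointwise λ { zero → refl ; (suc _) → refl }
  embed≋const (+ 1)           = one≋const
  embed≋const (+ suc (suc _)) = ≋-refl
  embed≋const ℤ.-[1+ _ ]      = ≋-refl

  embed-homomorphism : CommutativeRing.rawRing ℤₚ.+-*-commutativeRing -Raw-AlmostCommutative⟶ FPS-almostCommutativeRing
  embed-homomorphism = record
    { ⟦_⟧ = embed
    ; +-homo = λ a b → ≋-trans (embed≋const (a ℤ.+ b)) (≋-trans (pointwise λ { zero → refl ; (suc _) → refl })
                         (⊕-cong (≋-sym (embed≋const a)) (≋-sym (embed≋const b))))
    ; *-homo = λ a b → ≋-trans (embed≋const (a ℤ.* b)) (≋-trans
                         (pointwise λ { zero → refl ; (suc n) → sym (trans (const-⊗ a (const b) (suc n)) (ℤₚ.*-zeroʳ a)) })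
                         (⊗-cong (≋-sym (embed≋const a)) (≋-sym (embed≋const b))))
    ; -‿homo = λ a → ≋-trans (embed≋const (ℤ.- a)) (≋-trans (pointwise λ { zero → refl ; (suc _) → refl })
                       (⊖-cong (≋-sym (embed≋const a))))
    ; 0-homo = ≋-refl
    ; 1-homo = ≋-refl
    }

  coefficients-equal? : ∀ a b → Maybe (embed a ≋ embed b)
  coefficients-equal? a b with a ℤ.≟ b
  ... | yes refl = just ≋-refl
  ... | no  _    = nothing

module FPS-Solver = Algebra.Solver.Ring (CommutativeRing.rawRing ℤₚ.+-*-commutativeRing)
  FPS-almostCommutativeRing embed-homomorphism coefficients-equal?

-- Monomials

mono-suc : ∀ c k n → mono c (suc k) (suc n) ≡ mono c k n
mono-suc c k n = cong (if_then c else + 0) (trans (isYes≗does (suc n ≟ suc k)) (sym (isYes≗does (n ≟ k))))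

mono-suc-⊗ : ∀ c k f n → (mono c (suc k) ⊗ f) (suc n) ≡ (mono c k ⊗ f) n
mono-suc-⊗ c k f n = trans (⊗-suc (mono c (suc k)) f n)
  (trans (cong₂ ℤ._+_ (ℤₚ.*-zeroˡ (f (suc n))) (coeff (⊗-cong {g = f} (pointwise (mono-suc c k)) ≋-refl) n)) (ℤₚ.+-identityˡ _))

mono-zero : ∀ c → mono c 0 ≋ const c
mono-zero c = pointwise λ { zero → refl ; (suc _) → refl }

mono-⊗ : ∀ c a d b → mono c a ⊗ mono d b ≋ mono (c ℤ.* d) (a + b)
mono-⊗ c a d b = pointwise (go a)
  where
  scale : ∀ b n → c ℤ.* mono d b n ≡ mono (c ℤ.* d) b n
  scale zero    zero    = refl
  scale zero    (suc n) = ℤₚ.*-zeroʳ c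
  scale (suc b) zero    = ℤₚ.*-zeroʳ c
  scale (suc b) (suc n) = trans (cong (c ℤ.*_) (mono-suc d b n)) (trans (scale b n) (sym (mono-suc (c ℤ.* d) b n)))
  go : ∀ a n → (mono c a ⊗ mono d b) n ≡ mono (c ℤ.* d) (a + b) n
  go zero    n       = trans (coeff (⊗-cong {g = mono d b} (mono-zero c) ≋-refl) n) (trans (const-⊗ c (mono d b) n) (scale b n))
  go (suc a) zero    = ℤₚ.*-zeroˡ (mono d b 0)
  go (suc a) (suc n) = trans (mono-suc-⊗ c a (mono d b) n) (trans (go a n) (sym (mono-suc (c ℤ.* d) (a + b) n)))

mono-cong : ∀ {c d k l} → c ≡ d → k ≡ l → mono c k ≋ mono d l
mono-cong refl refl = ≋-refl

⊖-mono : ∀ c k → ⊖ mono c k ≋ mono (ℤ.- c) k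
⊖-mono c k = pointwise (go k)
  where
  go : ∀ k n → ℤ.- mono c k n ≡ mono (ℤ.- c) k n
  go zero    zero    = refl
  go zero    (suc n) = refl
  go (suc k) zero    = refl
  go (suc k) (suc n) = trans (cong ℤ.-_ (mono-suc c k n)) (trans (go k n) (sym (mono-suc (ℤ.- c) k n)))

-- Stage `n` of `invAux` only adds the entry of degree `n` and passes lower degrees on to the stage
-- before, so an entry never changes once it is computed. This turns the staged definition into the
-- usual recursion `inv-suc`.
invAux-stable : ∀ f {m} n → m ≤ n → invAux f n m ≡ inv f m
invAux-stable f {m} n m≤n with ℕₚ.≤⇒≤′ m≤n
... | ≤′-reflexive refl = refl
... | ≤′-step {n = n′} m≤′n′ with m ≤? n′
...   | yes m≤n′ = invAux-stable f n′ m≤n′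
...   | no  m≰n′ = contradiction (ℕₚ.≤′⇒≤ m≤′n′) m≰n′

inv-suc : ∀ f n → inv f (suc n) ≡ ℤ.- sumTo n (λ i → f (suc i) ℤ.* inv f (n ∸ i))
inv-suc f n with suc n ≤? n
... | yes n<n = contradiction n<n (ℕₚ.<-irrefl refl)
... | no  _   = cong ℤ.-_ (sumTo-cong n (λ i _ → cong (f (suc i) ℤ.*_) (invAux-stable f n (ℕₚ.m∸n≤m n i))))

⊗-inv : ∀ f → f 0 ≡ + 1 → f ⊗ inv f ≋ one
⊗-inv f f0≡1 = pointwise λ where
    zero    → trans (cong (ℤ._* + 1) f0≡1) refl
    (suc n) → begin
      (f ⊗ inv f) (suc n)                                    ≡⟨ ⊗-suc f (inv f) n ⟩
      f 0 ℤ.* inv f (suc n) ℤ.+ rest n                       ≡⟨ cong₂ (λ a b → a ℤ.* b ℤ.+ rest n) f0≡1 (inv-suc f n) ⟩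
      + 1 ℤ.* (ℤ.- rest n) ℤ.+ rest n                        ≡⟨ cong (ℤ._+ rest n) (ℤₚ.*-identityˡ (ℤ.- rest n)) ⟩
      (ℤ.- rest n) ℤ.+ rest n                                ≡⟨ ℤₚ.+-inverseˡ (rest n) ⟩
      + 0                                                    ∎
  where
  open ≡-Reasoning
  rest : ℕ → ℤ
  rest n = sumTo n (λ i → f (suc i) ℤ.* inv f (n ∸ i))

-- Congruence modulo q^n

infix 4 _≋_mod_
-- Limits enter only in this form: an infinite product or a theta series is replaced by a finite
-- expression that agrees with it below degree `n`, and `mod⇒≋` recovers equality from all `n`
-- together.
record _≋_mod_ (f g : FPS) (n : ℕ) : Set where
  constructor below
  field coeff< : ∀ m → m < n → f m ≡ g m
open _≋_mod_

≋⇒mod : ∀ {n} → f ≋ g → f ≋ g mod n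
≋⇒mod e = below λ m _ → coeff e m

mod⇒≋ : (∀ n → f ≋ g mod n) → f ≋ g
mod⇒≋ e = pointwise λ n → coeff< (e (suc n)) n ℕₚ.≤-refl

mod-weaken : ∀ {m n} → m ≤ n → f ≋ g mod n → f ≋ g mod m
mod-weaken m≤n e = below λ i i<m → coeff< e i (ℕₚ.<-≤-trans i<m m≤n)

mod-refl : ∀ {n} → f ≋ f mod n
mod-refl = below λ _ _ → refl

mod-sym : ∀ {n} → f ≋ g mod n → g ≋ f mod n
mod-sym e = below λ m m<n → sym (coeff< e m m<n)

mod-trans : ∀ {n} → f ≋ f′ mod n → f′ ≋ f″ mod n → f ≋ f″ mod n
mod-trans e e′ = below λ m m<n → trans (coeff< e m m<n) (coeff< e′ m m<n)

mod-setoid : ℕ → Setoid 0ℓ 0ℓ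
mod-setoid n = record
  { Carrier = FPS ; _≈_ = λ f g → f ≋ g mod n
  ; isEquivalence = record { refl = mod-refl ; sym = mod-sym ; trans = mod-trans } }

module mod-Reasoning (n : ℕ) where
  open import Relation.Binary.Reasoning.Setoid (mod-setoid n) public

⊕-mod : ∀ {n} → f ≋ f′ mod n → g ≋ g′ mod n → f ⊕ g ≋ f′ ⊕ g′ mod n
⊕-mod e e′ = below λ m m<n → cong₂ ℤ._+_ (coeff< e m m<n) (coeff< e′ m m<n)

⊗-mod : ∀ {n} → f ≋ f′ mod n → g ≋ g′ mod n → f ⊗ g ≋ f′ ⊗ g′ mod n
⊗-mod e e′ = below λ m m<n → sumTo-cong m (λ i i≤m → cong₂ ℤ._*_
  (coeff< e i (ℕₚ.≤-<-trans i≤m m<n)) (coeff< e′ (m ∸ i) (ℕₚ.≤-<-trans (ℕₚ.m∸n≤m m i) m<n)))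

-- In a degree below a + b, each product of coefficients has its first index below a or its second
-- below b. Thus the precisions of two factors add up, which is what the error term of the triple
-- product requires.
⊗-𝟎-mod : ∀ {a b} → f ≋ 𝟎 mod a → g ≋ 𝟎 mod b → f ⊗ g ≋ 𝟎 mod (a + b)
⊗-𝟎-mod {f} {g} {a} {b} e e′ = below λ m m<a+b → sumTo-0 m (λ i i≤m → vanish m i m<a+b i≤m)
  where
  vanish : ∀ m i → m < a + b → i ≤ m → f i ℤ.* g (m ∸ i) ≡ + 0
  vanish m i m<a+b i≤m with i <? a
  ... | yes i<a = trans (cong (ℤ._* g (m ∸ i)) (coeff< e i i<a)) (ℤₚ.*-zeroˡ (g (m ∸ i)))
  ... | no  i≮a = trans (cong (f i ℤ.*_) (coeff< e′ (m ∸ i)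
          (ℕₚ.+-cancelˡ-< i (m ∸ i) b (ℕₚ.<-≤-trans (subst (_< a + b) (sym (ℕₚ.m+[n∸m]≡n i≤m)) m<a+b)
            (ℕₚ.+-monoˡ-≤ b (ℕₚ.≮⇒≥ i≮a)))))) (ℤₚ.*-zeroʳ (f i))

mono-𝟎-mod : ∀ {c k n} → n ≤ k → mono c k ≋ 𝟎 mod n
mono-𝟎-mod {c} {k} n≤k = below λ m m<n → go m k (ℕₚ.<-≤-trans m<n n≤k)
  where
  go : ∀ m k → m < k → mono c k m ≡ + 0
  go zero    (suc k) _         = refl
  go (suc m) (suc k) (s≤s m<k) = trans (mono-suc c k m) (go m k m<k)

⊗-cancelˡ-mod : ∀ {n} u → u 0 ≡ + 1 → u ⊗ f ≋ u ⊗ g mod n → f ≋ g mod n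
⊗-cancelˡ-mod {f} {g} {n} u u0≡1 e = begin
  f                   ≈⟨ ≋⇒mod (undo f) ⟨
  inv u ⊗ (u ⊗ f)     ≈⟨ ⊗-mod {f = inv u} mod-refl e ⟩
  inv u ⊗ (u ⊗ g)     ≈⟨ ≋⇒mod (undo g) ⟩
  g                   ∎
  where
  open mod-Reasoning n
  undo : ∀ f → inv u ⊗ (u ⊗ f) ≋ f
  undo f = ≋-trans (≋-sym (⊗-assoc (inv u) u f)) (≋-trans
    (⊗-cong {g = f} (≋-trans (⊗-comm (inv u) u) (⊗-inv u u0≡1)) ≋-refl) (⊗-identityˡ f))

⊗-cancelˡ : ∀ u → u 0 ≡ + 1 → u ⊗ f ≋ u ⊗ g → f ≋ g
⊗-cancelˡ u u0≡1 e = mod⇒≋ λ n → ⊗-cancelˡ-mod u u0≡1 (≋⇒mod e)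

-- Infinite products

infix 9 q^_
q^_ : ℕ → FPS
q^ k = mono (+ 1) k

q^-⊗ : ∀ a b → q^ a ⊗ q^ b ≋ q^ (a + b)
q^-⊗ a b = mono-⊗ (+ 1) a (+ 1) b

q^-cong : ∀ {a b} → a ≡ b → q^ a ≋ q^ b
q^-cong refl = ≋-refl

q^0 : q^ 0 ≋ one
q^0 = pointwise λ { zero → refl ; (suc _) → refl }

-- The factor that is added is 1 - c q^(s + (d+1)N), and its exponent is at least N because the step
-- is positive.
pochFin-stable : ∀ c s d N → pochFin c s (suc d) (suc N) ≋ pochFin c s (suc d) N mod N
pochFin-stable c s d N = begin
  Π ⊗ (one ⊝ mono c (s + suc d * N)) ≈⟨ ⊗-mod {f = Π} mod-refl (⊕-mod {f = one} mod-refl (below λ m m<N →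
                                          cong ℤ.-_ (coeff< (mono-𝟎-mod {c} (ℕₚ.≤-trans (ℕₚ.m≤m*n N (suc d)) (ℕₚ.≤-trans (ℕₚ.≤-reflexive (ℕₚ.*-comm N (suc d))) (ℕₚ.m≤n+m _ s)))) m m<N))) ⟩
  Π ⊗ (one ⊝ 𝟎)                      ≈⟨ ≋⇒mod (solve 1 (λ x → x :* (con (+ 1) :- con (+ 0)) := x) ≋-refl Π) ⟩
  Π                                  ∎
  where
  open mod-Reasoning N
  open FPS-Solver
  Π = pochFin c s (suc d) N

poch-trunc : ∀ c s d N → poch c s (suc d) ≋ pochFin c s (suc d) N mod N
poch-trunc c s d N = below λ m m<N → go m N m<N
  where
  go : ∀ m N → m < N → pochFin c s (suc d) (suc m) m ≡ pochFin c s (suc d) N m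
  go m (suc N) (s≤s m≤N) with ℕₚ.m≤n⇒m<n∨m≡n m≤N
  ... | inj₁ m<N  = trans (go m N m<N) (sym (coeff< (pochFin-stable c s d N) m m<N))
  ... | inj₂ refl = refl

pochFin-split : ∀ c s d N → pochFin c s d (N + N) ≋ pochFin c s (d + d) N ⊗ pochFin c (s + d) (d + d) N
pochFin-split c s d zero    = ≋-sym (⊗-identityˡ one)
pochFin-split c s d (suc N) rewrite ℕₚ.+-suc N N = begin
  pochFin c s d (N + N) ⊗ factor (s + d * (N + N)) ⊗ factor (s + d * suc (N + N))
    ≈⟨ ⊗-cong (⊗-cong (pochFin-split c s d N) (factor-cong (even s d N))) (factor-cong (odd s d N)) ⟩
  Π₀ ⊗ Π₁ ⊗ factor (s + (d + d) * N) ⊗ factor (s + d + (d + d) * N)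
    ≈⟨ solve 4 (λ a b x y → a :* b :* x :* y := a :* x :* (b :* y)) ≋-refl Π₀ Π₁ (factor (s + (d + d) * N)) (factor (s + d + (d + d) * N)) ⟩
  Π₀ ⊗ factor (s + (d + d) * N) ⊗ (Π₁ ⊗ factor (s + d + (d + d) * N)) ∎
  where
  open ≋-Reasoning
  open FPS-Solver
  Π₀ = pochFin c s (d + d) N
  Π₁ = pochFin c (s + d) (d + d) N
  factor : ℕ → FPS
  factor e = one ⊝ mono c e
  factor-cong : ∀ {e e′} → e ≡ e′ → factor e ≋ factor e′
  factor-cong refl = ≋-refl
  even : ∀ s d N → s + d * (N + N) ≡ s + (d + d) * N
  even = ℕ-Solver.solve-∀
  odd : ∀ s d N → s + d * suc (N + N) ≡ s + d + (d + d) * N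
  odd = ℕ-Solver.solve-∀

-- Factors of even and of odd index are separated. When `s` equals the step, E_k factors into O_k
-- and E_2k; read backwards with c = -1, the two products in a ψ series merge into one M.
poch-split : ∀ c s d → poch c s (suc d) ≋ poch c s (suc d + suc d) ⊗ poch c (s + suc d) (suc d + suc d)
poch-split c s d = mod⇒≋ λ N → let open mod-Reasoning N in begin
  poch c s (suc d)
    ≈⟨ mod-weaken (ℕₚ.m≤m+n N N) (poch-trunc c s d (N + N)) ⟩
  pochFin c s (suc d) (N + N)
    ≈⟨ ≋⇒mod (pochFin-split c s (suc d) N) ⟩
  pochFin c s (suc d + suc d) N ⊗ pochFin c (s + suc d) (suc d + suc d) N
    ≈⟨ ⊗-mod (poch-trunc c s (d + suc d) N) (poch-trunc c (s + suc d) (d + suc d) N) ⟨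
  poch c s (suc d + suc d) ⊗ poch c (s + suc d) (suc d + suc d) ∎

pochFin-± : ∀ s d N → pochFin (+ 1) s d N ⊗ pochFin (ℤ.- + 1) s d N ≋ pochFin (+ 1) (s + s) (d + d) N
pochFin-± s d zero    = ⊗-identityˡ one
pochFin-± s d (suc N) = begin
  Π₊ ⊗ (one ⊝ x) ⊗ (Π₋ ⊗ (one ⊝ mono (ℤ.- + 1) e))
    ≈⟨ ⊗-cong {f = Π₊ ⊗ (one ⊝ x)} ≋-refl (⊗-cong {f = Π₋} ≋-refl (⊕-cong {one} ≋-refl (⊖-cong (≋-sym (⊖-mono (+ 1) e))))) ⟩
  Π₊ ⊗ (one ⊝ x) ⊗ (Π₋ ⊗ (one ⊝ ⊖ x))
    ≈⟨ solve 3 (λ a b x → a :* (con (+ 1) :- x) :* (b :* (con (+ 1) :- :- x)) := a :* b :* (con (+ 1) :- x :* x)) ≋-refl Π₊ Π₋ x ⟩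
  Π₊ ⊗ Π₋ ⊗ (one ⊝ x ⊗ x)
    ≈⟨ ⊗-cong (pochFin-± s d N) (⊕-cong {one} ≋-refl (⊖-cong (≋-trans (q^-⊗ e e) (q^-cong (double s d N))))) ⟩
  pochFin (+ 1) (s + s) (d + d) N ⊗ (one ⊝ q^ (s + s + (d + d) * N)) ∎
  where
  open ≋-Reasoning
  open FPS-Solver
  e = s + d * N
  x = q^ e
  Π₊ = pochFin (+ 1) s d N
  Π₋ = pochFin (ℤ.- + 1) s d N
  double : ∀ s d N → (s + d * N) + (s + d * N) ≡ s + s + (d + d) * N
  double = ℕ-Solver.solve-∀

-- Factorwise (1 - x)(1 + x) = 1 - x². With step 2s it becomes O_s M_s = O_2s, the relation behind
-- all later simplifications of products.
poch-± : ∀ s d → poch (+ 1) s (suc d) ⊗ poch (ℤ.- + 1) s (suc d) ≋ poch (+ 1) (s + s) (suc d + suc d)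
poch-± s d = mod⇒≋ λ N → let open mod-Reasoning N in begin
  poch (+ 1) s (suc d) ⊗ poch (ℤ.- + 1) s (suc d)
    ≈⟨ ⊗-mod (poch-trunc (+ 1) s d N) (poch-trunc (ℤ.- + 1) s d N) ⟩
  pochFin (+ 1) s (suc d) N ⊗ pochFin (ℤ.- + 1) s (suc d) N
    ≈⟨ ≋⇒mod (pochFin-± s (suc d) N) ⟩
  pochFin (+ 1) (s + s) (suc d + suc d) N
    ≈⟨ poch-trunc (+ 1) (s + s) (d + suc d) N ⟨
  poch (+ 1) (s + s) (suc d + suc d) ∎

-- The Jacobi triple product

∑ : ℕ → (ℕ → FPS) → FPS
∑ zero    F = 𝟎
∑ (suc n) F = ∑ n F ⊕ F n

∑-cong-mod : ∀ {m} n {F G : ℕ → FPS} → (∀ i → i < n → F i ≋ G i mod m) → ∑ n F ≋ ∑ n G mod m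
∑-cong-mod zero    e = mod-refl
∑-cong-mod (suc n) e = ⊕-mod (∑-cong-mod n (λ i i<n → e i (ℕₚ.m<n⇒m<1+n i<n))) (e n ℕₚ.≤-refl)

∑-cong : ∀ n {F G : ℕ → FPS} → (∀ i → F i ≋ G i) → ∑ n F ≋ ∑ n G
∑-cong n e = mod⇒≋ λ m → ∑-cong-mod n (λ i _ → ≋⇒mod (e i))

∑-⊕ : ∀ n F G → ∑ n (λ i → F i ⊕ G i) ≋ ∑ n F ⊕ ∑ n G
∑-⊕ zero    F G = pointwise λ _ → refl
∑-⊕ (suc n) F G = ≋-trans (⊕-cong {∑ n (λ i → F i ⊕ G i)} {∑ n F ⊕ ∑ n G} {F n ⊕ G n} (∑-⊕ n F G) ≋-refl)
  (solve 4 (λ a b x y → a :+ b :+ (x :+ y) := a :+ x :+ (b :+ y)) ≋-refl (∑ n F) (∑ n G) (F n) (G n))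
  where open FPS-Solver

∑-⊗ : ∀ n f F → f ⊗ ∑ n F ≋ ∑ n (λ i → f ⊗ F i)
∑-⊗ zero    f F = ⊗-zeroʳ f
∑-⊗ (suc n) f F = ≋-trans (solve 3 (λ a b x → a :* (b :+ x) := a :* b :+ a :* x) ≋-refl f (∑ n F) (F n))
  (⊕-cong {f ⊗ ∑ n F} {∑ n (λ i → f ⊗ F i)} {f ⊗ F n} (∑-⊗ n f F) ≋-refl)
  where open FPS-Solver

∑-suc : ∀ n F → ∑ (suc n) F ≋ F 0 ⊕ ∑ n (λ i → F (suc i))
∑-suc zero    F = solve 1 (λ x → con (+ 0) :+ x := x :+ con (+ 0)) ≋-refl (F 0)
  where open FPS-Solver
∑-suc (suc n) F = ≋-trans (⊕-cong {∑ (suc n) F} {F 0 ⊕ ∑ n (λ i → F (suc i))} {F (suc n)} (∑-suc n F) ≋-refl)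
  (solve 3 (λ a b x → a :+ b :+ x := a :+ (b :+ x)) ≋-refl (F 0) (∑ n (λ i → F (suc i))) (F (suc n)))
  where open FPS-Solver

∑-𝟎 : ∀ n {F : ℕ → FPS} → (∀ i → F i ≋ 𝟎) → ∑ n F ≋ 𝟎
∑-𝟎 zero    e = ≋-refl
∑-𝟎 (suc n) e = ⊕-cong (∑-𝟎 n e) (e n)

-- This is s j + d j(j-1)/2, written recursively to avoid the division by 2.
exponent : ℕ → ℕ → ℕ → ℕ
exponent d s zero    = 0
exponent d s (suc j) = exponent d s j + (s + d * j)

j≤exponent : ∀ d s j → j ≤ exponent d (suc s) j
j≤exponent d s zero    = z≤n
j≤exponent d s (suc j) = subst (_≤ exponent d (suc s) j + (suc s + d * j)) (ℕₚ.+-comm j 1) (ℕₚ.+-mono-≤ (j≤exponent d s j) (s≤s z≤n))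

sign : ℤ → ℕ → ℤ
sign σ zero    = + 1
sign σ (suc j) = sign σ j ℤ.* σ

-- The route is the finite form of the identity: a product of 2N factors equals a sum over -N ≤ j ≤
-- N of Gaussian binomials times monomials, and the binomials converge to 1/(q^d;q^d) as N grows. As
-- c is its own inverse, the terms of index j and -j carry the same sign, so the sum over the
-- integers folds into one over j ≥ 0.
module JacobiTripleProduct (c : ℤ) (c*c≡1 : c ℤ.* c ≡ + 1) (r₁ r₂ : ℕ) where

  s₁ s₂ d : ℕ
  s₁ = suc r₁
  s₂ = suc r₂
  d  = s₁ + s₂

  Q : ℕ → FPS
  Q n = q^ (d * n)

  Q-⊗ : ∀ a b → Q a ⊗ Q b ≋ Q (a + b)
  Q-⊗ a b = ≋-trans (q^-⊗ (d * a) (d * b)) (q^-cong (sym (ℕₚ.*-distribˡ-+ d a b)))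

  Q-cong : ∀ {a b} → a ≡ b → Q a ≋ Q b
  Q-cong refl = ≋-refl

  Q0 : Q 0 ≋ one
  Q0 = ≋-trans (q^-cong (ℕₚ.*-zeroʳ d)) q^0

  E : ℕ → FPS
  E n = pochFin (+ 1) d d n

  E-cong : ∀ {m n} → m ≡ n → E m ≋ E n
  E-cong refl = ≋-refl

  E-suc : ∀ n → E (suc n) ≋ E n ⊗ (one ⊝ Q (suc n))
  E-suc n = ⊗-cong {E n} ≋-refl (⊕-cong {one} ≋-refl (⊖-cong (q^-cong (sym (ℕₚ.*-suc d n)))))

  -- b N j is the Gaussian binomial [2N; N+j] in base q^d.
  b : ℕ → ℕ → FPS
  b zero    zero    = one
  b zero    (suc j) = 𝟎
  b (suc N) zero    = (one ⊕ Q (suc (N + N))) ⊗ b N 0 ⊕ (Q (suc N) ⊗ b N 1 ⊕ Q (suc N) ⊗ b N 1)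
  b (suc N) (suc j) = (one ⊕ Q (suc (N + N))) ⊗ b N (suc j) ⊕ (Q (N ∸ j) ⊗ b N j ⊕ Q (suc (suc (N + j))) ⊗ b N (suc (suc j)))

  -- Besides bounding the range of summation, this makes the truncated subtraction in the recurrence
  -- for `b` harmless: `N ∸ j` differs from N - j only where it multiplies a zero binomial.
  b-vanishes : ∀ N j → N < j → b N j ≋ 𝟎
  b-vanishes zero    (suc j) _         = ≋-refl
  b-vanishes (suc N) (suc j) (s≤s N<j) = ≋-trans
    (⊕-cong {x = x ⊗ b N (suc j)} (⊗-cong {x} ≋-refl (b-vanishes N (suc j) (ℕₚ.m<n⇒m<1+n N<j)))
      (⊕-cong {x = y ⊗ b N j} (⊗-cong {y} ≋-refl (b-vanishes N j N<j))
        (⊗-cong {z} ≋-refl (b-vanishes N (suc (suc j)) (ℕₚ.m<n⇒m<1+n (ℕₚ.m<n⇒m<1+n N<j))))))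
    (solve 3 (λ x y z → x :* con (+ 0) :+ (y :* con (+ 0) :+ z :* con (+ 0)) := con (+ 0)) ≋-refl x y z)
    where
    open FPS-Solver
    x = one ⊕ Q (suc (N + N))
    y = Q (N ∸ j)
    z = Q (suc (suc (N + j)))

  private
    E-step₂ : ∀ n {u} → Q (suc n) ≋ u → E (suc (suc n)) ≋ E n ⊗ (one ⊝ u) ⊗ (one ⊝ Q 1 ⊗ u)
    E-step₂ n {u} e = ≋-trans (E-suc (suc n)) (⊗-cong
      (≋-trans (E-suc n) (⊗-cong {E n} ≋-refl (⊕-cong {one} ≋-refl (⊖-cong e))))
      (⊕-cong {one} ≋-refl (⊖-cong (≋-trans (≋-sym (Q-⊗ 1 (suc n))) (⊗-cong {Q 1} ≋-refl e)))))

    Q-suc : ∀ n → Q (suc n) ≋ Q 1 ⊗ Q n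
    Q-suc n = ≋-sym (Q-⊗ 1 n)

  -- The quotient of q-factorials for [2N; N+j], with its denominators cleared. The recurrence for
  -- `b` is Pascal's rule applied twice, as the upper index grows by two, and in it `b N 1` also
  -- stands for the index -1. The induction step involves the neighbours at j+1 and j+2, which the
  -- two companions below bring to the common factor `E m`.
  b-formula  : ∀ N j m → j + m ≡ N → b N j ⊗ E (N + j) ⊗ E m ≋ E (N + N)
  -- The factor that belongs to index j+1 is `E` at m-1. Moving the missing 1 - Q m to the right
  -- keeps the formula valid at m = 0, where both sides vanish.
  b-formula′ : ∀ N j m → j + m ≡ N → b N (suc j) ⊗ E (suc (N + j)) ⊗ E m ≋ E (N + N) ⊗ (one ⊝ Q m)
  -- Here a factor 1 - Q (m-1) would appear. Multiplying by `Q 1` turns it into Q 1 - Q m, so that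
  -- no predecessor of m occurs and m = 0 needs no separate statement.
  b-formula″ : ∀ N j m → j + m ≡ N →
    Q 1 ⊗ (b N (suc (suc j)) ⊗ E (suc (suc (N + j))) ⊗ E m) ≋ E (N + N) ⊗ (one ⊝ Q m) ⊗ (Q 1 ⊝ Q m)

  b-formula′ N j zero e rewrite trans (sym e) (ℕₚ.+-identityʳ j) = begin
    b j (suc j) ⊗ x ⊗ one        ≈⟨ ⊗-cong (⊗-cong (b-vanishes j (suc j) ℕₚ.≤-refl) (≋-refl {x})) (≋-refl {one}) ⟩
    𝟎 ⊗ x ⊗ one                  ≈⟨ solve 2 (λ x y → con (+ 0) :* x :* con (+ 1) := y :* (con (+ 1) :- con (+ 1))) ≋-refl x (E (j + j)) ⟩
    E (j + j) ⊗ (one ⊝ one)      ≈⟨ ⊗-cong (≋-refl {E (j + j)}) (⊕-cong (≋-refl {one}) (⊖-cong (≋-sym Q0))) ⟩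
    E (j + j) ⊗ (one ⊝ Q 0)      ∎
    where
    open ≋-Reasoning
    open FPS-Solver
    x = E (suc (j + j))
  b-formula′ N j (suc m) e = begin
    β ⊗ E (suc (N + j)) ⊗ E (suc m)           ≈⟨ ⊗-cong (⊗-cong (≋-refl {β}) (E-cong (sym (ℕₚ.+-suc N j)))) (E-suc m) ⟩
    β ⊗ x ⊗ (E m ⊗ y)                         ≈⟨ solve 4 (λ a b c d → a :* b :* (c :* d) := a :* b :* c :* d) ≋-refl β x (E m) y ⟩
    β ⊗ x ⊗ E m ⊗ y                           ≈⟨ ⊗-cong (b-formula N (suc j) m (trans (sym (ℕₚ.+-suc j m)) e)) (≋-refl {y}) ⟩
    E (N + N) ⊗ y                             ∎
    where
    open ≋-Reasoning
    open FPS-Solver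
    β = b N (suc j)
    x = E (N + suc j)
    y = one ⊝ Q (suc m)

  b-formula″ N j zero e rewrite trans (sym e) (ℕₚ.+-identityʳ j) = begin
    X ⊗ (b j (suc (suc j)) ⊗ x ⊗ one)
      ≈⟨ ⊗-cong (≋-refl {X}) (⊗-cong (⊗-cong (b-vanishes j (suc (suc j)) (ℕₚ.m≤n⇒m≤1+n ℕₚ.≤-refl)) (≋-refl {x})) (≋-refl {one})) ⟩
    X ⊗ (𝟎 ⊗ x ⊗ one)
      ≈⟨ solve 3 (λ x y X → X :* (con (+ 0) :* x :* con (+ 1)) := y :* (con (+ 1) :- con (+ 1)) :* (X :- con (+ 1))) ≋-refl x (E (j + j)) X ⟩
    E (j + j) ⊗ (one ⊝ one) ⊗ (X ⊝ one)
      ≈⟨ ⊗-cong (⊗-cong (≋-refl {E (j + j)}) (⊕-cong (≋-refl {one}) (⊖-cong Q0))) (⊕-cong (≋-refl {X}) (⊖-cong Q0)) ⟨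
    E (j + j) ⊗ (one ⊝ Q 0) ⊗ (X ⊝ Q 0) ∎
    where
    open ≋-Reasoning
    open FPS-Solver
    X = Q 1
    x = E (suc (suc (j + j)))
  b-formula″ N j (suc m) e = begin
    X ⊗ (β ⊗ E (suc (suc (N + j))) ⊗ E (suc m))
      ≈⟨ ⊗-cong (≋-refl {X}) (⊗-cong (⊗-cong (≋-refl {β}) (E-cong (cong suc (sym (ℕₚ.+-suc N j))))) (E-suc m)) ⟩
    X ⊗ (β ⊗ x ⊗ (E m ⊗ y))
      ≈⟨ solve 5 (λ X a b c d → X :* (a :* b :* (c :* d)) := X :* (a :* b :* c :* d)) ≋-refl X β x (E m) y ⟩
    X ⊗ (β ⊗ x ⊗ E m ⊗ y)
      ≈⟨ ⊗-cong (≋-refl {X}) (⊗-cong (b-formula′ N (suc j) m (trans (sym (ℕₚ.+-suc j m)) e)) (≋-refl {y})) ⟩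
    X ⊗ (E (N + N) ⊗ (one ⊝ Q m) ⊗ y)
      ≈⟨ solve 4 (λ X ε w y → X :* (ε :* (con (+ 1) :- w) :* y) := ε :* y :* (X :- X :* w)) ≋-refl X (E (N + N)) (Q m) y ⟩
    E (N + N) ⊗ y ⊗ (X ⊝ X ⊗ Q m)
      ≈⟨ ⊗-cong (≋-refl {E (N + N) ⊗ y}) (⊕-cong (≋-refl {X}) (⊖-cong (Q-⊗ 1 m))) ⟩
    E (N + N) ⊗ y ⊗ (X ⊝ Q (suc m)) ∎
    where
    open ≋-Reasoning
    open FPS-Solver
    X = Q 1
    β = b N (suc (suc j))
    x = E (suc (N + suc j))
    y = one ⊝ Q (suc m)

  b-formula zero    zero    zero    refl = solve 0 (con (+ 1) :* con (+ 1) :* con (+ 1) := con (+ 1)) ≋-refl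
    where open FPS-Solver
  b-formula (suc N) zero    (suc .N) refl = begin
    b (suc N) 0 ⊗ E (suc N + 0) ⊗ E (suc N)
      ≈⟨ ⊗-cong (⊗-cong (⊕-cong (⊗-cong (⊕-cong (≋-refl {one}) Q-2N+1) (≋-refl {β₀}))
           (⊕-cong (⊗-cong (Q-suc N) (≋-refl {β₁})) (⊗-cong (Q-suc N) (≋-refl {β₁}))))
           (≋-trans (E-cong (ℕₚ.+-identityʳ (suc N))) e₁)) e₁ ⟩
    ((one ⊕ X ⊗ z ⊗ z) ⊗ β₀ ⊕ (X ⊗ z ⊗ β₁ ⊕ X ⊗ z ⊗ β₁)) ⊗ (e ⊗ (one ⊝ X ⊗ z)) ⊗ (e ⊗ (one ⊝ X ⊗ z))
      ≈⟨ solve 5 (λ X z β₀ β₁ e →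
           ((con (+ 1) :+ X :* z :* z) :* β₀ :+ (X :* z :* β₁ :+ X :* z :* β₁)) :* (e :* (con (+ 1) :- X :* z)) :* (e :* (con (+ 1) :- X :* z))
           := (con (+ 1) :+ X :* z :* z) :* (con (+ 1) :- X :* z) :* (con (+ 1) :- X :* z) :* (β₀ :* e :* e)
              :+ con (+ 2) :* X :* z :* (con (+ 1) :- X :* z) :* (β₁ :* (e :* (con (+ 1) :- X :* z)) :* e)) ≋-refl X z β₀ β₁ e ⟩
    (one ⊕ X ⊗ z ⊗ z) ⊗ (one ⊝ X ⊗ z) ⊗ (one ⊝ X ⊗ z) ⊗ (β₀ ⊗ e ⊗ e) ⊕ const (+ 2) ⊗ X ⊗ z ⊗ (one ⊝ X ⊗ z) ⊗ (β₁ ⊗ (e ⊗ (one ⊝ X ⊗ z)) ⊗ e)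
      ≈⟨ ⊕-cong (⊗-cong (≋-refl {(one ⊕ X ⊗ z ⊗ z) ⊗ (one ⊝ X ⊗ z) ⊗ (one ⊝ X ⊗ z)}) h₀) (⊗-cong (≋-refl {const (+ 2) ⊗ X ⊗ z ⊗ (one ⊝ X ⊗ z)}) h₁) ⟩
    (one ⊕ X ⊗ z ⊗ z) ⊗ (one ⊝ X ⊗ z) ⊗ (one ⊝ X ⊗ z) ⊗ ε ⊕ const (+ 2) ⊗ X ⊗ z ⊗ (one ⊝ X ⊗ z) ⊗ (ε ⊗ (one ⊝ z))
      ≈⟨ solve 3 (λ X z ε →
           (con (+ 1) :+ X :* z :* z) :* (con (+ 1) :- X :* z) :* (con (+ 1) :- X :* z) :* ε
              :+ con (+ 2) :* X :* z :* (con (+ 1) :- X :* z) :* (ε :* (con (+ 1) :- z))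
           := ε :* (con (+ 1) :- X :* z :* z) :* (con (+ 1) :- X :* (X :* z :* z))) ≋-refl X z ε ⟩
    ε ⊗ (one ⊝ X ⊗ z ⊗ z) ⊗ (one ⊝ X ⊗ (X ⊗ z ⊗ z))
      ≈⟨ E-step₂ (N + N) Q-2N+1 ⟨
    E (suc (suc (N + N)))
      ≈⟨ E-cong (cong suc (sym (ℕₚ.+-suc N N))) ⟩
    E (suc N + suc N) ∎
    where
    open ≋-Reasoning
    open FPS-Solver
    X = Q 1
    z = Q N
    e = E N
    ε = E (N + N)
    β₀ = b N 0
    β₁ = b N 1
    Q-2N+1 : Q (suc (N + N)) ≋ X ⊗ z ⊗ z
    Q-2N+1 = ≋-sym (≋-trans (⊗-cong (Q-⊗ 1 N) (≋-refl {z})) (Q-⊗ (suc N) N))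
    e₁ : E (suc N) ≋ e ⊗ (one ⊝ X ⊗ z)
    e₁ = ≋-trans (E-suc N) (⊗-cong (≋-refl {e}) (⊕-cong (≋-refl {one}) (⊖-cong (Q-suc N))))
    h₀ : β₀ ⊗ e ⊗ e ≋ ε
    h₀ = ≋-trans (⊗-cong (⊗-cong (≋-refl {β₀}) (E-cong (sym (ℕₚ.+-identityʳ N)))) (≋-refl {e})) (b-formula N 0 N refl)
    h₁ : β₁ ⊗ (e ⊗ (one ⊝ X ⊗ z)) ⊗ e ≋ ε ⊗ (one ⊝ z)
    h₁ = ≋-trans (⊗-cong (⊗-cong (≋-refl {β₁}) (≋-trans (≋-sym e₁) (E-cong (cong suc (sym (ℕₚ.+-identityʳ N)))))) (≋-refl {e})) (b-formula′ N 0 N refl)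
  b-formula (suc N) (suc j) m 1+j+m≡1+N = begin
    b (suc N) (suc j) ⊗ E (suc N + suc j) ⊗ E m
      ≈⟨ ⊗-cong (⊗-cong (⊕-cong (⊗-cong (⊕-cong (≋-refl {one}) Q-2N+1) (≋-refl {β₁}))
           (⊕-cong (⊗-cong (Q-cong N∸j≡m) (≋-refl {β₀})) (⊗-cong (Q-suc (suc (N + j))) (≋-refl {β₂}))))
           (≋-trans (E-cong (cong suc (ℕₚ.+-suc N j))) e₂)) (≋-refl {μ}) ⟩
    ((one ⊕ w ⊗ v) ⊗ β₁ ⊕ (w ⊗ β₀ ⊕ X ⊗ v ⊗ β₂)) ⊗ (e ⊗ (one ⊝ v) ⊗ (one ⊝ X ⊗ v)) ⊗ μ
      ≈⟨ solve 8 (λ X v w β₀ β₁ β₂ e μ →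
           ((con (+ 1) :+ w :* v) :* β₁ :+ (w :* β₀ :+ X :* v :* β₂)) :* (e :* (con (+ 1) :- v) :* (con (+ 1) :- X :* v)) :* μ
           := w :* (con (+ 1) :- v) :* (con (+ 1) :- X :* v) :* (β₀ :* e :* μ)
              :+ (con (+ 1) :+ w :* v) :* (con (+ 1) :- X :* v) :* (β₁ :* (e :* (con (+ 1) :- v)) :* μ)
              :+ v :* (X :* (β₂ :* (e :* (con (+ 1) :- v) :* (con (+ 1) :- X :* v)) :* μ))) ≋-refl X v w β₀ β₁ β₂ e μ ⟩
    w ⊗ (one ⊝ v) ⊗ (one ⊝ X ⊗ v) ⊗ (β₀ ⊗ e ⊗ μ) ⊕ (one ⊕ w ⊗ v) ⊗ (one ⊝ X ⊗ v) ⊗ (β₁ ⊗ (e ⊗ (one ⊝ v)) ⊗ μ)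
      ⊕ v ⊗ (X ⊗ (β₂ ⊗ (e ⊗ (one ⊝ v) ⊗ (one ⊝ X ⊗ v)) ⊗ μ))
      ≈⟨ ⊕-cong (⊕-cong (⊗-cong (≋-refl {w ⊗ (one ⊝ v) ⊗ (one ⊝ X ⊗ v)}) (b-formula N j m j+m≡N))
                        (⊗-cong (≋-refl {(one ⊕ w ⊗ v) ⊗ (one ⊝ X ⊗ v)}) h₁))
                (⊗-cong (≋-refl {v}) h₂) ⟩
    w ⊗ (one ⊝ v) ⊗ (one ⊝ X ⊗ v) ⊗ ε ⊕ (one ⊕ w ⊗ v) ⊗ (one ⊝ X ⊗ v) ⊗ (ε ⊗ (one ⊝ w))
      ⊕ v ⊗ (ε ⊗ (one ⊝ w) ⊗ (X ⊝ w))
      ≈⟨ solve 4 (λ X v w ε →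
           w :* (con (+ 1) :- v) :* (con (+ 1) :- X :* v) :* ε :+ (con (+ 1) :+ w :* v) :* (con (+ 1) :- X :* v) :* (ε :* (con (+ 1) :- w))
             :+ v :* (ε :* (con (+ 1) :- w) :* (X :- w))
           := ε :* (con (+ 1) :- w :* v) :* (con (+ 1) :- X :* (w :* v))) ≋-refl X v w ε ⟩
    ε ⊗ (one ⊝ w ⊗ v) ⊗ (one ⊝ X ⊗ (w ⊗ v))
      ≈⟨ E-step₂ (N + N) Q-2N+1 ⟨
    E (suc (suc (N + N)))
      ≈⟨ E-cong (cong suc (sym (ℕₚ.+-suc N N))) ⟩
    E (suc N + suc N) ∎
    where
    open ≋-Reasoning
    open FPS-Solver
    j+m≡N : j + m ≡ N
    j+m≡N = ℕₚ.suc-injective 1+j+m≡1+N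
    N∸j≡m : N ∸ j ≡ m
    N∸j≡m = trans (cong (_∸ j) (sym j+m≡N)) (ℕₚ.m+n∸m≡n j m)
    X = Q 1
    v = Q (suc (N + j))
    w = Q m
    e = E (N + j)
    μ = E m
    ε = E (N + N)
    β₀ = b N j
    β₁ = b N (suc j)
    β₂ = b N (suc (suc j))
    rearrange : ∀ m N j → m + suc (N + j) ≡ suc (N + (j + m))
    rearrange = ℕ-Solver.solve-∀
    Q-2N+1 : Q (suc (N + N)) ≋ w ⊗ v
    Q-2N+1 = ≋-sym (≋-trans (Q-⊗ m (suc (N + j))) (Q-cong (trans (rearrange m N j) (cong (λ i → suc (N + i)) j+m≡N))))
    e₂ : E (suc (suc (N + j))) ≋ e ⊗ (one ⊝ v) ⊗ (one ⊝ X ⊗ v)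
    e₂ = E-step₂ (N + j) ≋-refl
    h₁ : β₁ ⊗ (e ⊗ (one ⊝ v)) ⊗ μ ≋ ε ⊗ (one ⊝ w)
    h₁ = ≋-trans (⊗-cong (⊗-cong (≋-refl {β₁}) (≋-sym (E-suc (N + j)))) (≋-refl {μ})) (b-formula′ N j m j+m≡N)
    h₂ : X ⊗ (β₂ ⊗ (e ⊗ (one ⊝ v) ⊗ (one ⊝ X ⊗ v)) ⊗ μ) ≋ ε ⊗ (one ⊝ w) ⊗ (X ⊝ w)
    h₂ = ≋-trans (⊗-cong (≋-refl {X}) (⊗-cong (⊗-cong (≋-refl {β₂}) (≋-sym e₂)) (≋-refl {μ}))) (b-formula″ N j m j+m≡N)

  σ : ℤ
  σ = ℤ.- c

  σ*σ≡1 : σ ℤ.* σ ≡ + 1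
  σ*σ≡1 = trans (ℤ-neg*neg c) c*c≡1
    where
    ℤ-neg*neg : ∀ c → (ℤ.- c) ℤ.* (ℤ.- c) ≡ c ℤ.* c
    ℤ-neg*neg = ℤ-Solver.solve-∀

  -- τ s j = σ^j q^(s j + d j(j-1)/2)
  τ : ℕ → ℕ → FPS
  τ s zero    = one
  τ s (suc j) = τ s j ⊗ mono σ (s + d * j)

  w : ℕ → FPS
  w j = τ s₁ j ⊕ τ s₂ j

  τ-up : ∀ s {N j} → j ≤ N → mono σ (s + d * N) ⊗ τ s j ≋ Q (N ∸ j) ⊗ τ s (suc j)
  τ-up s {N} {j} j≤N = ≋-trans
    (⊗-cong (≋-sym (≋-trans (mono-⊗ (+ 1) (d * (N ∸ j)) σ (s + d * j)) (mono-cong (ℤₚ.*-identityˡ σ) shifted))) (≋-refl {τ s j}))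
    (solve 3 (λ a b c → a :* b :* c := a :* (c :* b)) ≋-refl (Q (N ∸ j)) (mono σ (s + d * j)) (τ s j))
    where
    open FPS-Solver
    regroup : ∀ d m s j → d * m + (s + d * j) ≡ s + d * (m + j)
    regroup = ℕ-Solver.solve-∀
    shifted : d * (N ∸ j) + (s + d * j) ≡ s + d * N
    shifted = trans (regroup d (N ∸ j) s j) (cong (λ n → s + d * n) (ℕₚ.m∸n+n≡m j≤N))

  mono-σ-⊗ : ∀ s s′ N j → s + s′ ≡ d → mono σ (s′ + d * N) ⊗ mono σ (s + d * j) ≋ Q (suc (N + j))
  mono-σ-⊗ s s′ N j s+s′≡d = ≋-trans (mono-⊗ σ (s′ + d * N) σ (s + d * j)) (mono-cong σ*σ≡1
    (trans (regroup s s′ d N j) (trans (cong (λ x → x + d * (N + j)) s+s′≡d) (sym (ℕₚ.*-suc d (N + j))))))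
    where
    regroup : ∀ s s′ d N j → s′ + d * N + (s + d * j) ≡ s + s′ + d * (N + j)
    regroup = ℕ-Solver.solve-∀

  -- The last factor of τ s (j+1) meets a factor of the other progression: the signs cancel and s +
  -- s′ fills a whole period, which leaves a power of q^d. A factor of the same progression raises j
  -- instead, as in `τ-up`.
  τ-down : ∀ s s′ N j → s + s′ ≡ d → mono σ (s′ + d * N) ⊗ τ s (suc j) ≋ Q (suc (N + j)) ⊗ τ s j
  τ-down s s′ N j s+s′≡d = ≋-trans
    (solve 3 (λ a b c → a :* (c :* b) := a :* b :* c) ≋-refl (mono σ (s′ + d * N)) (mono σ (s + d * j)) (τ s j))
    (⊗-cong (mono-σ-⊗ s s′ N j s+s′≡d) (≋-refl {τ s j}))
    where open FPS-Solver

  w-step : ∀ {N j} → suc j ≤ N → (mono σ (s₁ + d * N) ⊕ mono σ (s₂ + d * N)) ⊗ w (suc j)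
           ≋ Q (N ∸ suc j) ⊗ w (suc (suc j)) ⊕ Q (suc (N + j)) ⊗ w j
  w-step {N} {j} j<N = begin
    (x ⊕ y) ⊗ (τ s₁ (suc j) ⊕ τ s₂ (suc j))
      ≈⟨ solve 4 (λ x y a b → (x :+ y) :* (a :+ b) := x :* a :+ x :* b :+ (y :* a :+ y :* b)) ≋-refl x y (τ s₁ (suc j)) (τ s₂ (suc j)) ⟩
    x ⊗ τ s₁ (suc j) ⊕ x ⊗ τ s₂ (suc j) ⊕ (y ⊗ τ s₁ (suc j) ⊕ y ⊗ τ s₂ (suc j))
      ≈⟨ ⊕-cong (⊕-cong (τ-up s₁ j<N) (τ-down s₂ s₁ N j (ℕₚ.+-comm s₂ s₁))) (⊕-cong (τ-down s₁ s₂ N j refl) (τ-up s₂ j<N)) ⟩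
    A ⊗ τ s₁ (suc (suc j)) ⊕ B ⊗ τ s₂ j ⊕ (B ⊗ τ s₁ j ⊕ A ⊗ τ s₂ (suc (suc j)))
      ≈⟨ solve 6 (λ A B a b c d → A :* a :+ B :* b :+ (B :* c :+ A :* d) := A :* (a :+ d) :+ B :* (c :+ b)) ≋-refl
           A B (τ s₁ (suc (suc j))) (τ s₂ j) (τ s₁ j) (τ s₂ (suc (suc j))) ⟩
    A ⊗ w (suc (suc j)) ⊕ B ⊗ w j ∎
    where
    open ≋-Reasoning
    open FPS-Solver
    x = mono σ (s₁ + d * N)
    y = mono σ (s₂ + d * N)
    A = Q (N ∸ suc j)
    B = Q (suc (N + j))

  -- The sum has a length `L` independent of `N`, so that the induction on `N` compares sums over
  -- the same range; the surplus terms contain vanishing binomials.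
  finite : ∀ L N → N ≤ L → pochFin c s₁ d N ⊗ pochFin c s₂ d N ≋ b N 0 ⊕ ∑ L (λ j → w (suc j) ⊗ b N (suc j))
  finite L zero    _   = begin
    one ⊗ one                               ≈⟨ solve 0 (con (+ 1) :* con (+ 1) := con (+ 1) :+ con (+ 0)) ≋-refl ⟩
    one ⊕ 𝟎                                 ≈⟨ ⊕-cong (≋-refl {one}) (∑-𝟎 L (λ j → ⊗-zeroʳ (w (suc j)))) ⟨
    one ⊕ ∑ L (λ j → w (suc j) ⊗ 𝟎)         ∎
    where
    open ≋-Reasoning
    open FPS-Solver
  finite L (suc N) N<L = begin
    P₁ ⊗ (one ⊝ mono c (s₁ + d * N)) ⊗ (P₂ ⊗ (one ⊝ mono c (s₂ + d * N)))
      ≈⟨ ⊗-cong (⊗-cong (≋-refl {P₁}) (⊕-cong (≋-refl {one}) (⊖-mono c (s₁ + d * N))))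
                (⊗-cong (≋-refl {P₂}) (⊕-cong (≋-refl {one}) (⊖-mono c (s₂ + d * N)))) ⟩
    P₁ ⊗ (one ⊕ x) ⊗ (P₂ ⊗ (one ⊕ y))
      ≈⟨ solve 4 (λ P₁ P₂ x y → P₁ :* (con (+ 1) :+ x) :* (P₂ :* (con (+ 1) :+ y))
           := P₁ :* P₂ :* (con (+ 1) :+ y :* x :+ (x :+ y))) ≋-refl P₁ P₂ x y ⟩
    P₁ ⊗ P₂ ⊗ (one ⊕ y ⊗ x ⊕ (x ⊕ y))
      ≈⟨ ⊗-cong (finite L N (ℕₚ.<⇒≤ N<L)) (⊕-cong (⊕-cong (≋-refl {one}) (mono-σ-⊗ s₁ s₂ N N refl)) (≋-refl {x ⊕ y})) ⟩
    (b N 0 ⊕ S) ⊗ (one ⊕ z ⊕ (x ⊕ y))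
      ≈⟨ solve 5 (λ β S z x y → (β :+ S) :* (con (+ 1) :+ z :+ (x :+ y))
           := (con (+ 1) :+ z) :* β :+ (con (+ 1) :+ z) :* S :+ ((x :+ y) :* β :+ (x :+ y) :* S)) ≋-refl (b N 0) S z x y ⟩
    (one ⊕ z) ⊗ b N 0 ⊕ (one ⊕ z) ⊗ S ⊕ ((x ⊕ y) ⊗ b N 0 ⊕ (x ⊕ y) ⊗ S)
      ≈⟨ ⊕-cong (≋-refl {(one ⊕ z) ⊗ b N 0 ⊕ (one ⊕ z) ⊗ S}) (⊕-cong first cross) ⟩
    (one ⊕ z) ⊗ b N 0 ⊕ (one ⊕ z) ⊗ S ⊕ (A 0 ⊕ (∑ L (λ j → A (suc j)) ⊕ ∑ L B))
      ≈⟨ solve 5 (λ a b c d e → a :+ b :+ (c :+ (d :+ e)) := a :+ b :+ ((c :+ d) :+ e)) ≋-refl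
           ((one ⊕ z) ⊗ b N 0) ((one ⊕ z) ⊗ S) (A 0) (∑ L (λ j → A (suc j))) (∑ L B) ⟩
    (one ⊕ z) ⊗ b N 0 ⊕ (one ⊕ z) ⊗ S ⊕ ((A 0 ⊕ ∑ L (λ j → A (suc j))) ⊕ ∑ L B)
      ≈⟨ ⊕-cong (≋-refl {(one ⊕ z) ⊗ b N 0 ⊕ (one ⊕ z) ⊗ S}) (⊕-cong (≋-sym shift-A) shift-B) ⟩
    (one ⊕ z) ⊗ b N 0 ⊕ (one ⊕ z) ⊗ S ⊕ (∑ L A ⊕ (B 0 ⊕ ∑ L (λ j → B (suc j))))
      ≈⟨ solve 5 (λ a b c d e → a :+ b :+ (c :+ (d :+ e)) := a :+ d :+ (b :+ (c :+ e))) ≋-refl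
           ((one ⊕ z) ⊗ b N 0) ((one ⊕ z) ⊗ S) (∑ L A) (B 0) (∑ L (λ j → B (suc j))) ⟩
    (one ⊕ z) ⊗ b N 0 ⊕ B 0 ⊕ ((one ⊕ z) ⊗ S ⊕ (∑ L A ⊕ ∑ L (λ j → B (suc j))))
      ≈⟨ ⊕-cong (⊕-cong (≋-refl {(one ⊕ z) ⊗ b N 0}) last₀) (≋-sym recombine) ⟩
    b (suc N) 0 ⊕ ∑ L (λ j → w (suc j) ⊗ b (suc N) (suc j)) ∎
    where
    open ≋-Reasoning
    open FPS-Solver
    P₁ = pochFin c s₁ d N
    P₂ = pochFin c s₂ d N
    x = mono σ (s₁ + d * N)
    y = mono σ (s₂ + d * N)
    z = Q (suc (N + N))
    S = ∑ L (λ j → w (suc j) ⊗ b N (suc j))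
    -- `A j` is a term raised from index j to j+1, and `B j` is one lowered from j+1 to j.
    -- Reindexing both so that they multiply the same `w` reproduces the three terms of the
    -- recurrence for `b`.
    A B : ℕ → FPS
    A j = Q (N ∸ j) ⊗ w (suc j) ⊗ b N j
    B j = Q (suc (N + j)) ⊗ w j ⊗ b N (suc j)
    first : (x ⊕ y) ⊗ b N 0 ≋ A 0
    first = ⊗-cong {g = b N 0} (≋-trans (solve 2 (λ x y → x :+ y := x :* con (+ 1) :+ y :* con (+ 1)) ≋-refl x y)
      (≋-trans (⊕-cong (τ-up s₁ {N} z≤n) (τ-up s₂ {N} z≤n))
        (solve 3 (λ a b c → a :* b :+ a :* c := a :* (b :+ c)) ≋-refl (Q N) (τ s₁ 1) (τ s₂ 1)))) ≋-refl
    term : ∀ j → (x ⊕ y) ⊗ (w (suc j) ⊗ b N (suc j)) ≋ A (suc j) ⊕ B j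
    term j with suc j ≤? N
    ... | yes j<N = ≋-trans (≋-sym (⊗-assoc (x ⊕ y) (w (suc j)) (b N (suc j)))) (≋-trans
            (⊗-cong (w-step j<N) (≋-refl {b N (suc j)}))
            (solve 3 (λ a b c → (a :+ b) :* c := a :* c :+ b :* c) ≋-refl
              (Q (N ∸ suc j) ⊗ w (suc (suc j))) (Q (suc (N + j)) ⊗ w j) (b N (suc j))))
    ... | no  j≮N = ≋-trans (⊗-cong (≋-refl {x ⊕ y}) (⊗-cong (≋-refl {w (suc j)}) b≋0)) (≋-trans
            (solve 4 (λ a b c d → a :* (b :* con (+ 0)) := c :* con (+ 0) :+ d :* con (+ 0)) ≋-refl
              (x ⊕ y) (w (suc j)) (Q (N ∸ suc j) ⊗ w (suc (suc j))) (Q (suc (N + j)) ⊗ w j))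
            (⊕-cong (⊗-cong (≋-refl {Q (N ∸ suc j) ⊗ w (suc (suc j))}) (≋-sym b≋0)) (⊗-cong (≋-refl {Q (suc (N + j)) ⊗ w j}) (≋-sym b≋0))))
      where b≋0 = b-vanishes N (suc j) (ℕₚ.≰⇒> j≮N)
    cross : (x ⊕ y) ⊗ S ≋ ∑ L (λ j → A (suc j)) ⊕ ∑ L B
    cross = ≋-trans (∑-⊗ L (x ⊕ y) (λ j → w (suc j) ⊗ b N (suc j))) (≋-trans (∑-cong L term) (∑-⊕ L (λ j → A (suc j)) B))
    shift-A : ∑ L A ≋ A 0 ⊕ ∑ L (λ j → A (suc j))
    shift-A = ≋-trans (≋-trans (solve 2 (λ a b → a := a :+ b :* con (+ 0)) ≋-refl (∑ L A) (Q (N ∸ L) ⊗ w (suc L)))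
      (⊕-cong (≋-refl {∑ L A}) (⊗-cong (≋-refl {Q (N ∸ L) ⊗ w (suc L)}) (≋-sym (b-vanishes N L N<L))))) (∑-suc L A)
    shift-B : ∑ L B ≋ B 0 ⊕ ∑ L (λ j → B (suc j))
    shift-B = ≋-trans (≋-trans (solve 2 (λ a b → a := a :+ b :* con (+ 0)) ≋-refl (∑ L B) (Q (suc (N + L)) ⊗ w L))
      (⊕-cong (≋-refl {∑ L B}) (⊗-cong (≋-refl {Q (suc (N + L)) ⊗ w L}) (≋-sym (b-vanishes N (suc L) (ℕₚ.m<n⇒m<1+n N<L)))))) (∑-suc L B)
    -- The two halves of `w 0` coincide, so it equals 2; this supplies the doubled term in
    -- `b (suc N) 0`.
    last₀ : B 0 ≋ Q (suc N) ⊗ b N 1 ⊕ Q (suc N) ⊗ b N 1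
    last₀ = ≋-trans (⊗-cong (⊗-cong (Q-cong (cong suc (ℕₚ.+-identityʳ N))) (≋-refl {w 0})) (≋-refl {b N 1}))
      (solve 2 (λ a b → a :* (con (+ 1) :+ con (+ 1)) :* b := a :* b :+ a :* b) ≋-refl (Q (suc N)) (b N 1))
    recombine : ∑ L (λ j → w (suc j) ⊗ b (suc N) (suc j)) ≋ (one ⊕ z) ⊗ S ⊕ (∑ L A ⊕ ∑ L (λ j → B (suc j)))
    recombine = ≋-trans (∑-cong L (λ j → ≋-trans
        (⊗-cong (≋-refl {w (suc j)}) (⊕-cong (≋-refl {(one ⊕ z) ⊗ b N (suc j)}) (⊕-cong (≋-refl {Q (N ∸ j) ⊗ b N j})
          (⊗-cong (Q-cong (cong suc (sym (ℕₚ.+-suc N j)))) (≋-refl {b N (suc (suc j))})))))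
        (solve 7 (λ w z β₁ a β₀ c β₂ → w :* ((con (+ 1) :+ z) :* β₁ :+ (a :* β₀ :+ c :* β₂))
          := (con (+ 1) :+ z) :* (w :* β₁) :+ (a :* w :* β₀ :+ c :* w :* β₂)) ≋-refl
          (w (suc j)) z (b N (suc j)) (Q (N ∸ j)) (b N j) (Q (suc (N + suc j))) (b N (suc (suc j))))))
      (≋-trans (∑-⊕ L (λ j → (one ⊕ z) ⊗ (w (suc j) ⊗ b N (suc j))) (λ j → A j ⊕ B (suc j)))
        (⊕-cong (≋-sym (∑-⊗ L (one ⊕ z) (λ j → w (suc j) ⊗ b N (suc j)))) (∑-⊕ L A (λ j → B (suc j)))))

  -- The binomial tends to the inverse of `qq d`: each `E` in `b-formula` agrees with `qq d` below
  -- degree m, and one of the three factors cancels.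
  qq-⊗-b : ∀ N j m → j + m ≡ N → qq d ⊗ b N j ≋ one mod m
  qq-⊗-b N j m j+m≡N = ⊗-cancelˡ-mod (qq d) refl (begin
    qq d ⊗ (qq d ⊗ b N j)        ≈⟨ ≋⇒mod (solve 2 (λ e β → e :* (e :* β) := β :* e :* e) ≋-refl (qq d) (b N j)) ⟩
    b N j ⊗ qq d ⊗ qq d          ≈⟨ ⊗-mod (⊗-mod (mod-refl {b N j}) (mod-weaken (ℕₚ.≤-trans m≤N (ℕₚ.m≤m+n N j)) (poch-trunc (+ 1) d (r₁ + s₂) (N + j))))
                                          (poch-trunc (+ 1) d (r₁ + s₂) m) ⟩
    b N j ⊗ E (N + j) ⊗ E m      ≈⟨ ≋⇒mod (b-formula N j m j+m≡N) ⟩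
    E (N + N)                    ≈⟨ mod-weaken (ℕₚ.≤-trans m≤N (ℕₚ.m≤m+n N N)) (poch-trunc (+ 1) d (r₁ + s₂) (N + N)) ⟨
    qq d                         ≈⟨ ≋⇒mod (⊗-identityʳ (qq d)) ⟨
    qq d ⊗ one                   ∎)
    where
    open mod-Reasoning m
    open FPS-Solver
    m≤N : m ≤ N
    m≤N = subst (m ≤_) j+m≡N (ℕₚ.m≤n+m m j)

  τ≋mono : ∀ s j → τ s j ≋ mono (sign σ j) (exponent d s j)
  τ≋mono s zero    = ≋-sym q^0
  τ≋mono s (suc j) = ≋-trans (⊗-cong (τ≋mono s j) (≋-refl {mono σ (s + d * j)})) (mono-⊗ (sign σ j) (exponent d s j) σ (s + d * j))

  w-𝟎-mod : ∀ j → w j ≋ 𝟎 mod j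
  w-𝟎-mod j = mod-trans (⊕-mod (≋⇒mod (τ≋mono s₁ j)) (≋⇒mod (τ≋mono s₂ j)))
    (⊕-mod (mono-𝟎-mod (j≤exponent d r₁ j)) (mono-𝟎-mod (j≤exponent d r₂ j)))

  jacobi : ∀ N → qq d ⊗ poch c s₁ d ⊗ poch c s₂ d
           ≋ one ⊕ ∑ N (λ j → mono (sign σ (suc j)) (exponent d s₁ (suc j)) ⊕ mono (sign σ (suc j)) (exponent d s₂ (suc j))) mod N
  jacobi N = begin
    qq d ⊗ poch c s₁ d ⊗ poch c s₂ d
      ≈⟨ ⊗-mod (⊗-mod (mod-refl {qq d}) (poch-trunc c s₁ (r₁ + s₂) N)) (poch-trunc c s₂ (r₁ + s₂) N) ⟩
    qq d ⊗ pochFin c s₁ d N ⊗ pochFin c s₂ d N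
      ≈⟨ ≋⇒mod (≋-trans (⊗-assoc (qq d) (pochFin c s₁ d N) (pochFin c s₂ d N)) (⊗-cong (≋-refl {qq d}) (finite N N ℕₚ.≤-refl))) ⟩
    qq d ⊗ (b N 0 ⊕ ∑ N (λ j → w (suc j) ⊗ b N (suc j)))
      ≈⟨ ≋⇒mod (≋-trans (solve 3 (λ a b c → a :* (b :+ c) := a :* b :+ a :* c) ≋-refl (qq d) (b N 0) (∑ N (λ j → w (suc j) ⊗ b N (suc j))))
           (⊕-cong (≋-refl {qq d ⊗ b N 0}) (∑-⊗ N (qq d) (λ j → w (suc j) ⊗ b N (suc j))))) ⟩
    qq d ⊗ b N 0 ⊕ ∑ N (λ j → qq d ⊗ (w (suc j) ⊗ b N (suc j)))
      ≈⟨ ⊕-mod (qq-⊗-b N 0 N refl) (∑-cong-mod N term) ⟩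
    one ⊕ ∑ N (λ j → mono (sign σ (suc j)) (exponent d s₁ (suc j)) ⊕ mono (sign σ (suc j)) (exponent d s₂ (suc j))) ∎
    where
    open mod-Reasoning N
    open FPS-Solver
    term : ∀ j → j < N → qq d ⊗ (w (suc j) ⊗ b N (suc j))
           ≋ mono (sign σ (suc j)) (exponent d s₁ (suc j)) ⊕ mono (sign σ (suc j)) (exponent d s₂ (suc j)) mod N
    term j j<N = begin
      qq d ⊗ (w (suc j) ⊗ b N (suc j))
        ≈⟨ ≋⇒mod (solve 3 (λ e w β → e :* (w :* β) := w :* (e :* β :- con (+ 1)) :+ w) ≋-refl (qq d) (w (suc j)) (b N (suc j))) ⟩
      w (suc j) ⊗ (qq d ⊗ b N (suc j) ⊝ one) ⊕ w (suc j)
        -- `w (suc j)` is divisible by q^(j+1) and the error of the binomial by q^(N-j-1), which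
        -- together give exactly the precision N.
        ≈⟨ ⊕-mod (subst (w (suc j) ⊗ (qq d ⊗ b N (suc j) ⊝ one) ≋ 𝟎 mod_) (ℕₚ.m+[n∸m]≡n j<N)
             (⊗-𝟎-mod (w-𝟎-mod (suc j)) error)) (mod-refl {w (suc j)}) ⟩
      𝟎 ⊕ w (suc j)
        ≈⟨ ≋⇒mod (≋-trans (solve 1 (λ x → con (+ 0) :+ x := x) ≋-refl (w (suc j))) (⊕-cong (τ≋mono s₁ (suc j)) (τ≋mono s₂ (suc j)))) ⟩
      mono (sign σ (suc j)) (exponent d s₁ (suc j)) ⊕ mono (sign σ (suc j)) (exponent d s₂ (suc j)) ∎
      where
      error : qq d ⊗ b N (suc j) ⊝ one ≋ 𝟎 mod (N ∸ suc j)
      error = mod-trans (⊕-mod (qq-⊗-b N (suc j) (N ∸ suc j) (ℕₚ.m+[n∸m]≡n j<N)) (mod-refl {⊖ one}))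
        (≋⇒mod (solve 0 (con (+ 1) :- con (+ 1) := con (+ 0)) ≋-refl))

-- Signed enumeration of partitions

mono-⊗-coeff : ∀ c k f n → (mono c k ⊗ f) (k + n) ≡ c ℤ.* f n
mono-⊗-coeff c zero    f n = trans (coeff (⊗-cong (mono-zero c) (≋-refl {f})) n) (const-⊗ c f n)
mono-⊗-coeff c (suc k) f n = trans (mono-suc-⊗ c k f (k + n)) (mono-⊗-coeff c k f n)

ε : ℕ → ℤ
ε zero    = + 1
ε (suc n) = ℤ.- ε n

ε-+ : ∀ m n → ε (m + n) ≡ ε m ℤ.* ε n
ε-+ zero    n = sym (ℤₚ.*-identityˡ (ε n))
ε-+ (suc m) n = trans (cong ℤ.-_ (ε-+ m n)) (ℤₚ.neg-distribˡ-* (ε m) (ε n))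

ε-n+n : ∀ n → ε (n + n) ≡ + 1
ε-n+n zero    = refl
ε-n+n (suc n) = trans (cong (λ m → ℤ.- ε m) (ℕₚ.+-suc n n)) (trans (ℤₚ.neg-involutive (ε (n + n))) (ε-n+n n))

range1-suc : ∀ m → range1 (suc m) ≡ range1 m ++ [ suc m ]
range1-suc m = trans (cong (map suc) (sym (Listₚ.upTo-∷ʳ m))) (Listₚ.map-++ suc (upTo m) [ m ])

module _ {a} {A : Set a} where

  sumBy : (A → ℤ) → List A → ℤ
  sumBy w []       = + 0
  sumBy w (x ∷ xs) = w x ℤ.+ sumBy w xs

  sumBy-++ : ∀ w xs ys → sumBy w (xs ++ ys) ≡ sumBy w xs ℤ.+ sumBy w ys
  sumBy-++ w []       ys = sym (ℤₚ.+-identityˡ _)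
  sumBy-++ w (x ∷ xs) ys = trans (cong (ℤ._+_ (w x)) (sumBy-++ w xs ys)) (sym (ℤₚ.+-assoc (w x) _ _))

  sumBy-scale : ∀ c {v w} {xs : List A} → All (λ x → v x ≡ c ℤ.* w x) xs → sumBy v xs ≡ c ℤ.* sumBy w xs
  sumBy-scale c []                     = sym (ℤₚ.*-zeroʳ c)
  sumBy-scale c {w = w} (_∷_ {x} {xs} e es) = trans (cong₂ ℤ._+_ e (sumBy-scale c es)) (sym (ℤₚ.*-distribˡ-+ c (w x) (sumBy w xs)))

module _ {a b} {A : Set a} {B : Set b} where

  sumBy-map : ∀ w (f : A → B) xs → sumBy w (map f xs) ≡ sumBy (λ x → w (f x)) xs
  sumBy-map w f []       = refl
  sumBy-map w f (x ∷ xs) = cong (ℤ._+_ (w (f x))) (sumBy-map w f xs)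

  sumBy-concatMap : ∀ w (f : A → List B) xs → sumBy w (concatMap f xs) ≡ sumBy (λ x → sumBy w (f x)) xs
  sumBy-concatMap w f []       = refl
  sumBy-concatMap w f (x ∷ xs) = trans (sumBy-++ w (f x) (concatMap f xs)) (cong (ℤ._+_ (sumBy w (f x))) (sumBy-concatMap w f xs))

data Bounded : ℕ → List ℕ → Set where
  []   : ∀ {m} → Bounded m []
  cons : ∀ {m k μ} → k ≤ m → Bounded k μ → Bounded m (k ∷ μ)

partsB-valid : ∀ f n m → All (λ μ → sum μ ≡ n × Bounded m μ) (partsB f n m)
partsB-valid _       zero    m = (refl , []) ∷ []
partsB-valid zero    (suc n) m = []
partsB-valid (suc f) (suc n) m = Allₚ.concat⁺ (Allₚ.map⁺ (Allₚ.map⁺ (Allₚ.applyUpTo⁺₁ id (m ⊓ suc n) λ {i} i<M →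
  Allₚ.map⁺ (All.map (λ {μ} (sum≡ , bounded) →
      trans (cong (λ s → suc i + s) sum≡) (cong suc (ℕₚ.m+[n∸m]≡n (ℕₚ.≤-pred (ℕₚ.≤-trans i<M (ℕₚ.m⊓n≤n m (suc n))))))
    , cons (ℕₚ.≤-trans i<M (ℕₚ.m⊓n≤m m (suc n))) bounded)
    (partsB-valid f (n ∸ i) (suc i))))))

partsB-fuel : ∀ f f′ n m → n ≤ f → n ≤ f′ → partsB f n m ≡ partsB f′ n m
partsB-fuel f       f′       zero    m _         _          = refl
partsB-fuel (suc f) (suc f′) (suc n) m (s≤s n≤f) (s≤s n≤f′) =
  trans (Listₚ.concatMap-map (λ k → map (k ∷_) (partsB f (suc n ∸ k) k)) suc (upTo (m ⊓ suc n)))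
    (trans (Listₚ.concatMap-cong (λ i → cong (map (suc i ∷_))
             (partsB-fuel f f′ (n ∸ i) (suc i) (ℕₚ.≤-trans (ℕₚ.m∸n≤m n i) n≤f) (ℕₚ.≤-trans (ℕₚ.m∸n≤m n i) n≤f′))) (upTo (m ⊓ suc n)))
      (sym (Listₚ.concatMap-map (λ k → map (k ∷_) (partsB f′ (suc n ∸ k) k)) suc (upTo (m ⊓ suc n)))))

-- A part contributes one factor depending on its length and one depending on the total size of the
-- parts after it. The sign under study has this shape, and constant weights give p(n), so both
-- generating functions obey one recurrence.
module WeightedPartitions (A B : ℕ → ℤ) where

  weight : List ℕ → ℤ
  weight []      = + 1
  weight (k ∷ μ) = A k ℤ.* B (sum μ) ℤ.* weight μ

  partsUpTo : ℕ → FPS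
  partsUpTo m n = sumBy weight (partsB n n m)

  all : FPS
  all n = sumBy weight (partitions n)

  private
    firstPart : ℕ → ℕ → ℤ
    firstPart n k = sumBy weight (map (k ∷_) (partsB n (suc n ∸ k) k))

    firstPart-suc : ∀ n i → firstPart n (suc i) ≡ A (suc i) ℤ.* (B (n ∸ i) ℤ.* partsUpTo (suc i) (n ∸ i))
    firstPart-suc n i = begin
      sumBy weight (map (suc i ∷_) (partsB n (n ∸ i) (suc i)))
        ≡⟨ sumBy-map weight (suc i ∷_) (partsB n (n ∸ i) (suc i)) ⟩
      sumBy (λ μ → weight (suc i ∷ μ)) (partsB n (n ∸ i) (suc i))
        ≡⟨ sumBy-scale (A (suc i) ℤ.* B (n ∸ i)) (All.map (λ {μ} (sum≡ , _) → cong (λ s → A (suc i) ℤ.* B s ℤ.* weight μ) sum≡) (partsB-valid n (n ∸ i) (suc i))) ⟩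
      A (suc i) ℤ.* B (n ∸ i) ℤ.* sumBy weight (partsB n (n ∸ i) (suc i))
        ≡⟨ cong (λ ps → A (suc i) ℤ.* B (n ∸ i) ℤ.* sumBy weight ps) (partsB-fuel n (n ∸ i) (n ∸ i) (suc i) (ℕₚ.m∸n≤m n i) ℕₚ.≤-refl) ⟩
      A (suc i) ℤ.* B (n ∸ i) ℤ.* partsUpTo (suc i) (n ∸ i)
        ≡⟨ ℤₚ.*-assoc (A (suc i)) (B (n ∸ i)) (partsUpTo (suc i) (n ∸ i)) ⟩
      A (suc i) ℤ.* (B (n ∸ i) ℤ.* partsUpTo (suc i) (n ∸ i)) ∎
      where open ≡-Reasoning

    partsUpTo-firstPart : ∀ m n {M} → m ⊓ suc n ≡ M → partsUpTo m (suc n) ≡ sumBy (firstPart n) (range1 M)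
    partsUpTo-firstPart m n refl = sumBy-concatMap weight (λ k → map (k ∷_) (partsB n (suc n ∸ k) k)) (range1 (m ⊓ suc n))

  partsUpTo-below : ∀ m n → n ≤ m → partsUpTo (suc m) n ≡ partsUpTo m n
  partsUpTo-below m zero    _   = refl
  partsUpTo-below m (suc n) n<m = trans (partsUpTo-firstPart (suc m) n (ℕₚ.m≥n⇒m⊓n≡n (ℕₚ.m≤n⇒m≤1+n n<m)))
    (sym (partsUpTo-firstPart m n (ℕₚ.m≥n⇒m⊓n≡n n<m)))

  partsUpTo-above : ∀ m n → partsUpTo (suc m) (suc m + n) ≡ partsUpTo m (suc m + n) ℤ.+ A (suc m) ℤ.* (B n ℤ.* partsUpTo (suc m) n)
  partsUpTo-above m n = begin
    partsUpTo (suc m) (suc m + n)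
      ≡⟨ partsUpTo-firstPart (suc m) (m + n) (ℕₚ.m≤n⇒m⊓n≡m (ℕₚ.m≤m+n (suc m) n)) ⟩
    sumBy (firstPart (m + n)) (range1 (suc m))
      ≡⟨ cong (sumBy (firstPart (m + n))) (range1-suc m) ⟩
    sumBy (firstPart (m + n)) (range1 m ++ [ suc m ])
      ≡⟨ sumBy-++ (firstPart (m + n)) (range1 m) [ suc m ] ⟩
    sumBy (firstPart (m + n)) (range1 m) ℤ.+ (firstPart (m + n) (suc m) ℤ.+ + 0)
      ≡⟨ cong₂ ℤ._+_ (sym (partsUpTo-firstPart m (m + n) (ℕₚ.m≤n⇒m⊓n≡m (ℕₚ.m≤n⇒m≤1+n (ℕₚ.m≤m+n m n))))) (ℤₚ.+-identityʳ _) ⟩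
    partsUpTo m (suc m + n) ℤ.+ firstPart (m + n) (suc m)
      ≡⟨ cong (ℤ._+_ (partsUpTo m (suc m + n))) (trans (firstPart-suc (m + n) m) (cong (λ i → A (suc m) ℤ.* (B i ℤ.* partsUpTo (suc m) i)) (ℕₚ.m+n∸m≡n m n))) ⟩
    partsUpTo m (suc m + n) ℤ.+ A (suc m) ℤ.* (B n ℤ.* partsUpTo (suc m) n) ∎
    where open ≡-Reasoning

  -- A partition that uses the part m+1 begins with it, and removing this one copy leaves parts that
  -- are still at most m+1; hence the series itself recurs on the right, weighted by size. For `B` =
  -- `ε` that weighted series is the original one at -q.
  partsUpTo-suc : ∀ m → partsUpTo (suc m) ≋ partsUpTo m ⊕ mono (A (suc m)) (suc m) ⊗ (λ n → B n ℤ.* partsUpTo (suc m) n)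
  partsUpTo-suc m = pointwise λ n → go n (suc m ≤? n)
    where
    tail = λ n → B n ℤ.* partsUpTo (suc m) n
    go : ∀ n → Dec (suc m ≤ n) → partsUpTo (suc m) n ≡ partsUpTo m n ℤ.+ (mono (A (suc m)) (suc m) ⊗ tail) n
    go n (no  m≮n) = trans (partsUpTo-below m n (ℕₚ.≤-pred (ℕₚ.≰⇒> m≮n))) (sym (trans
      (cong (ℤ._+_ (partsUpTo m n)) (coeff< (⊗-𝟎-mod {b = 0} (mono-𝟎-mod {A (suc m)} ℕₚ.≤-refl) (below {tail} λ _ ())) n
        (subst (n <_) (sym (ℕₚ.+-identityʳ (suc m))) (ℕₚ.≰⇒> m≮n))))
      (ℤₚ.+-identityʳ _)))
    go n (yes m<n) = subst (λ n → partsUpTo (suc m) n ≡ partsUpTo m n ℤ.+ (mono (A (suc m)) (suc m) ⊗ tail) n) (ℕₚ.m+[n∸m]≡n m<n)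
      (trans (partsUpTo-above m (n ∸ suc m)) (cong (ℤ._+_ (partsUpTo m (suc m + (n ∸ suc m)))) (sym (mono-⊗-coeff (A (suc m)) (suc m) tail (n ∸ suc m)))))

  partsUpTo-zero : partsUpTo 0 ≋ one
  partsUpTo-zero = pointwise λ { zero → refl ; (suc n) → refl }

  all-trunc : ∀ m → all ≋ partsUpTo m mod m
  all-trunc m = below λ n n<m → go m n (ℕₚ.<⇒≤ n<m)
    where
    go : ∀ m n → n ≤ m → partsUpTo n n ≡ partsUpTo m n
    go zero    zero z≤n = refl
    go (suc m) n n≤1+m with ℕₚ.m≤n⇒m<n∨m≡n n≤1+m
    ... | inj₁ (s≤s n≤m) = trans (go m n n≤m) (sym (partsUpTo-below m n n≤m))
    ... | inj₂ refl      = refl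

-- Odd columns and the sign

count≥ : List ℕ → ℕ → ℕ
count≥ μ j = length (filter (λ x → j ≤? x) μ)

-- The bound on the columns is a parameter instead of the largest part, so that a partition with and
-- without its first part can be compared over the same columns.
oddColumns : ℕ → List ℕ → ℕ
oddColumns zero    μ = 0
oddColumns (suc K) μ = oddColumns K μ + count≥ μ (suc K) % 2

private
  length-filter-odd : ∀ xs → oddParts xs ≡ sum (map (_% 2) xs)
  length-filter-odd []       = refl
  length-filter-odd (x ∷ xs) with x % 2 | %2-cases x
    where
    %2-cases : ∀ x → x % 2 ≡ 0 ⊎ x % 2 ≡ 1
    %2-cases zero          = inj₁ refl
    %2-cases (suc zero)    = inj₂ refl
    %2-cases (suc (suc x)) = %2-cases x
  ... | .0 | inj₁ refl = length-filter-odd xs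
  ... | .1 | inj₂ refl = cong suc (length-filter-odd xs)

  suc%2+%2 : ∀ n → suc n % 2 + n % 2 ≡ 1
  suc%2+%2 zero          = refl
  suc%2+%2 (suc zero)    = refl
  suc%2+%2 (suc (suc n)) = suc%2+%2 n

oddParts-conjugate : ∀ μ → oddParts (conjugate μ) ≡ oddColumns (largest μ) μ
oddParts-conjugate μ = trans (length-filter-odd (conjugate μ)) (go (largest μ))
  where
  open ≡-Reasoning
  total : List ℕ → ℕ
  total js = sum (map (_% 2) (map (count≥ μ) js))
  go : ∀ K → total (range1 K) ≡ oddColumns K μ
  go zero    = refl
  go (suc K) = begin
    total (range1 (suc K))                      ≡⟨ cong total (range1-suc K) ⟩
    total (range1 K ++ [ suc K ])               ≡⟨ cong (λ xs → sum (map (_% 2) xs)) (Listₚ.map-++ (count≥ μ) (range1 K) [ suc K ]) ⟩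
    sum (map (_% 2) (map (count≥ μ) (range1 K) ++ [ count≥ μ (suc K) ]))
      ≡⟨ cong sum (Listₚ.map-++ (_% 2) (map (count≥ μ) (range1 K)) [ count≥ μ (suc K) ]) ⟩
    sum (map (_% 2) (map (count≥ μ) (range1 K)) ++ [ count≥ μ (suc K) % 2 ])
      ≡⟨ sum-++ (map (_% 2) (map (count≥ μ) (range1 K))) [ count≥ μ (suc K) % 2 ] ⟩
    total (range1 K) + (count≥ μ (suc K) % 2 + 0) ≡⟨ cong₂ _+_ (go K) (ℕₚ.+-identityʳ (count≥ μ (suc K) % 2)) ⟩
    oddColumns (suc K) μ                        ∎

-- A new row of length k makes each of the first k columns longer by one, so each of them is odd in
-- exactly one of the two partitions.
oddColumns-∷ : ∀ {k} μ K → K ≤ k → oddColumns K (k ∷ μ) + oddColumns K μ ≡ K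
oddColumns-∷ μ zero    _   = refl
oddColumns-∷ {k} μ (suc K) K<k
  rewrite Listₚ.filter-accept (λ x → suc K ≤? x) {xs = μ} K<k = begin
    oddColumns K (k ∷ μ) + suc c % 2 + (oddColumns K μ + c % 2)     ≡⟨ interchange (oddColumns K (k ∷ μ)) (suc c % 2) (oddColumns K μ) (c % 2) ⟩
    (oddColumns K (k ∷ μ) + oddColumns K μ) + (suc c % 2 + c % 2)   ≡⟨ cong₂ _+_ (oddColumns-∷ μ K (ℕₚ.<⇒≤ K<k)) (suc%2+%2 c) ⟩
    K + 1                                                           ≡⟨ ℕₚ.+-comm K 1 ⟩
    suc K                                                           ∎
  where
  open ≡-Reasoning
  c = count≥ μ (suc K)
  interchange : ∀ a b c d → a + b + (c + d) ≡ (a + c) + (b + d)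
  interchange = ℕ-Solver.solve-∀

largest-bounded : ∀ {m μ} → Bounded m μ → largest μ ≤ m
largest-bounded []           = z≤n
largest-bounded (cons k≤m b) = ℕₚ.⊔-lub k≤m (ℕₚ.≤-trans (largest-bounded b) k≤m)

oddColumns-stable : ∀ μ K → largest μ ≤ K → oddColumns K μ ≡ oddColumns (largest μ) μ
oddColumns-stable μ K ≤K with ℕₚ.m≤n⇒m<n∨m≡n ≤K
oddColumns-stable μ K       _ | inj₂ refl      = refl
oddColumns-stable μ (suc K) _ | inj₁ (s≤s ≤K) =
  trans (cong₂ _+_ (oddColumns-stable μ K ≤K) (cong (_% 2) (cong length (none μ ≤K)))) (ℕₚ.+-identityʳ _)
  where
  none : ∀ μ → largest μ ≤ K → filter (λ x → suc K ≤? x) μ ≡ []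
  none μ ≤K = Listₚ.filter-none (λ x → suc K ≤? x) (go μ ≤K)
    where
    go : ∀ μ → largest μ ≤ K → All (λ x → ¬ suc K ≤ x) μ
    go []      _  = []
    go (x ∷ μ) ≤K = ℕₚ.≤⇒≯ (ℕₚ.≤-trans (ℕₚ.m≤m⊔n x (largest μ)) ≤K) ∷ go μ (ℕₚ.≤-trans (ℕₚ.m≤n⊔m x (largest μ)) ≤K)

oddParts-conjugate-∷ : ∀ {k μ} → Bounded k μ → oddParts (conjugate (k ∷ μ)) + oddParts (conjugate μ) ≡ k
oddParts-conjugate-∷ {k} {μ} bounded = begin
  oddParts (conjugate (k ∷ μ)) + oddParts (conjugate μ)
    ≡⟨ cong₂ _+_ (oddParts-conjugate (k ∷ μ)) (oddParts-conjugate μ) ⟩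
  oddColumns (k ⊔ largest μ) (k ∷ μ) + oddColumns (largest μ) μ
    ≡⟨ cong₂ _+_ (cong (λ K → oddColumns K (k ∷ μ)) (ℕₚ.m≥n⇒m⊔n≡m largest≤k)) (sym (oddColumns-stable μ k largest≤k)) ⟩
  oddColumns k (k ∷ μ) + oddColumns k μ
    ≡⟨ oddColumns-∷ μ k ℕₚ.≤-refl ⟩
  k ∎
  where
  open ≡-Reasoning
  largest≤k = largest-bounded bounded

oddParts-∷ : ∀ k μ → oddParts (k ∷ μ) ≡ k % 2 + oddParts μ
oddParts-∷ k μ = trans (length-filter-odd (k ∷ μ)) (cong (λ s → k % 2 + s) (sym (length-filter-odd μ)))

module Signed = WeightedPartitions (λ k → ε ⌊ k /2⌋) ε
module Unsigned = WeightedPartitions (λ _ → + 1) (λ _ → + 1)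

-- The congruence modulo 4 in `rows≡` cannot be carried along alone: its induction step produces
-- twice the number of odd columns, which the congruence modulo 2 in `columns≡` trades for twice the
-- size. The quotients `y` and `z` are kept as data, so that each step is a linear identity over the
-- integers.
record SignData (μ : List ℕ) : Set where
  field
    e        : ℕ
    y z      : ℤ
    sign≡    : Signed.weight μ ≡ ε e
    columns≡ : + oddParts (conjugate μ) ≡ + sum μ ℤ.+ + 2 ℤ.* y
    rows≡    : + oddParts μ ≡ + oddParts (conjugate μ) ℤ.+ + 2 ℤ.* + e ℤ.+ + 4 ℤ.* z

signData : ∀ {m μ} → Bounded m μ → SignData μ
signData []                           = record { e = 0 ; y = + 0 ; z = + 0 ; sign≡ = refl ; columns≡ = refl ; rows≡ = refl }
signData (cons {k = k} {μ} _ bounded) = record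
  -- With b′ = k - b and k = r + 2h, the excess of odd rows over odd columns changes by 2b - 2h,
  -- which is congruent to 2n + 2h modulo 4.
  { e = h + n + e
  ; y = ℤ.- + n ℤ.- y
  ; z = y ℤ.- + h ℤ.+ z
  ; sign≡ = trans (cong (λ s → ε h ℤ.* ε n ℤ.* s) sign≡) (sym (trans (ε-+ (h + n) e) (cong (ℤ._* ε e) (ε-+ h n))))
  ; columns≡ = begin
      + b′                                                     ≡⟨ b′≡k-b ⟩
      + k ℤ.- + b                                              ≡⟨ cong (λ x → + k ℤ.- x) columns≡ ⟩
      + k ℤ.- (+ n ℤ.+ + 2 ℤ.* y)                              ≡⟨ columns-lemma (+ k) (+ n) y ⟩
      + k ℤ.+ + n ℤ.+ + 2 ℤ.* (ℤ.- + n ℤ.- y)                  ≡⟨⟩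
      + sum (k ∷ μ) ℤ.+ + 2 ℤ.* (ℤ.- + n ℤ.- y)                ∎
  ; rows≡ = begin
      + oddParts (k ∷ μ)                                       ≡⟨ cong +_ (oddParts-∷ k μ) ⟩
      + r ℤ.+ + oddParts μ                                     ≡⟨ cong (ℤ._+_ (+ r)) rows≡ ⟩
      + r ℤ.+ (+ b ℤ.+ + 2 ℤ.* + e ℤ.+ + 4 ℤ.* z)              ≡⟨ rows-lemma₁ (+ r) (+ b) (+ e) z ⟩
      + r ℤ.- + b ℤ.+ + 2 ℤ.* + b ℤ.+ + 2 ℤ.* + e ℤ.+ + 4 ℤ.* z
        ≡⟨ cong (λ x → + r ℤ.- + b ℤ.+ + 2 ℤ.* x ℤ.+ + 2 ℤ.* + e ℤ.+ + 4 ℤ.* z) columns≡ ⟩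
      + r ℤ.- + b ℤ.+ + 2 ℤ.* (+ n ℤ.+ + 2 ℤ.* y) ℤ.+ + 2 ℤ.* + e ℤ.+ + 4 ℤ.* z
        ≡⟨ rows-lemma₂ (+ r) (+ b) (+ n) y (+ e) z (+ h) ⟩
      (+ r ℤ.+ (+ h ℤ.+ + h) ℤ.- + b) ℤ.+ + 2 ℤ.* (+ h ℤ.+ + n ℤ.+ + e) ℤ.+ + 4 ℤ.* (y ℤ.- + h ℤ.+ z)
        ≡⟨ cong (λ x → (x ℤ.- + b) ℤ.+ + 2 ℤ.* (+ h ℤ.+ + n ℤ.+ + e) ℤ.+ + 4 ℤ.* (y ℤ.- + h ℤ.+ z)) (cong +_ (sym (k≡r+h+h k))) ⟩
      (+ k ℤ.- + b) ℤ.+ + 2 ℤ.* (+ h ℤ.+ + n ℤ.+ + e) ℤ.+ + 4 ℤ.* (y ℤ.- + h ℤ.+ z)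
        ≡⟨ cong (λ x → x ℤ.+ + 2 ℤ.* (+ h ℤ.+ + n ℤ.+ + e) ℤ.+ + 4 ℤ.* (y ℤ.- + h ℤ.+ z)) (sym b′≡k-b) ⟩
      + b′ ℤ.+ + 2 ℤ.* + (h + n + e) ℤ.+ + 4 ℤ.* (y ℤ.- + h ℤ.+ z) ∎
  }
  where
  open ≡-Reasoning
  open SignData (signData bounded)
  h = ⌊ k /2⌋
  r = k % 2
  n = sum μ
  b = oddParts (conjugate μ)
  b′ = oddParts (conjugate (k ∷ μ))
  k≡r+h+h : ∀ k → k ≡ k % 2 + (⌊ k /2⌋ + ⌊ k /2⌋)
  k≡r+h+h zero          = refl
  k≡r+h+h (suc zero)    = refl
  k≡r+h+h (suc (suc k)) = trans (cong (λ k → suc (suc k)) (k≡r+h+h k)) (regroup (k % 2) ⌊ k /2⌋)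
    where
    regroup : ∀ r h → suc (suc (r + (h + h))) ≡ r + (suc h + suc h)
    regroup = ℕ-Solver.solve-∀
  subtract : ∀ a b c → a ℤ.+ b ≡ c → a ≡ c ℤ.- b
  subtract a b c refl = cancel a b
    where
    cancel : ∀ a b → a ≡ a ℤ.+ b ℤ.- b
    cancel = ℤ-Solver.solve-∀
  b′≡k-b : + b′ ≡ + k ℤ.- + b
  b′≡k-b = subtract (+ b′) (+ b) (+ k) (cong +_ (oddParts-conjugate-∷ bounded))
  columns-lemma : ∀ k n y → k ℤ.- (n ℤ.+ + 2 ℤ.* y) ≡ k ℤ.+ n ℤ.+ + 2 ℤ.* (ℤ.- n ℤ.- y)
  columns-lemma = ℤ-Solver.solve-∀
  rows-lemma₁ : ∀ r b e z → r ℤ.+ (b ℤ.+ + 2 ℤ.* e ℤ.+ + 4 ℤ.* z) ≡ r ℤ.- b ℤ.+ + 2 ℤ.* b ℤ.+ + 2 ℤ.* e ℤ.+ + 4 ℤ.* z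
  rows-lemma₁ = ℤ-Solver.solve-∀
  rows-lemma₂ : ∀ r b n y e z h → r ℤ.- b ℤ.+ + 2 ℤ.* (n ℤ.+ + 2 ℤ.* y) ℤ.+ + 2 ℤ.* e ℤ.+ + 4 ℤ.* z
    ≡ (r ℤ.+ (h ℤ.+ h) ℤ.- b) ℤ.+ + 2 ℤ.* (h ℤ.+ n ℤ.+ e) ℤ.+ + 4 ℤ.* (y ℤ.- h ℤ.+ z)
  rows-lemma₂ = ℤ-Solver.solve-∀

private
  %4-sound : ∀ a b z → + a ≡ + b ℤ.+ + 4 ℤ.* z → a % 4 ≡ b % 4
  %4-sound a b (+ m)      e = trans (cong (_% 4) a≡b+m*4) ([m+kn]%n≡m%n b m 4)
    where
    a≡b+m*4 : a ≡ b + m * 4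
    a≡b+m*4 = ℤₚ.+-injective (trans e (cong (ℤ._+_ (+ b)) (trans (ℤₚ.*-comm (+ 4) (+ m)) (sym (ℤₚ.pos-* m 4)))))
  %4-sound a b ℤ.-[1+ m ] e = sym (%4-sound b a (+ suc m) (trans (move (+ b) (+ suc m)) (cong (λ x → x ℤ.+ + 4 ℤ.* + suc m) (sym e))))
    where
    move : ∀ b m → b ≡ b ℤ.+ + 4 ℤ.* (ℤ.- m) ℤ.+ + 4 ℤ.* m
    move = ℤ-Solver.solve-∀

  %4-complete : ∀ a b → a % 4 ≡ b % 4 → ∃[ z ] + a ≡ + b ℤ.+ + 4 ℤ.* z
  %4-complete a b e = + (a / 4) ℤ.- + (b / 4) , (begin
    + a                                                            ≡⟨ expand a ⟩
    + (a % 4) ℤ.+ + (a / 4) ℤ.* + 4                                ≡⟨ cong (λ r → + r ℤ.+ + (a / 4) ℤ.* + 4) e ⟩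
    + (b % 4) ℤ.+ + (a / 4) ℤ.* + 4                                ≡⟨ regroup (+ (b % 4)) (+ (a / 4)) (+ (b / 4)) ⟩
    (+ (b % 4) ℤ.+ + (b / 4) ℤ.* + 4) ℤ.+ + 4 ℤ.* (+ (a / 4) ℤ.- + (b / 4)) ≡⟨ cong (λ x → x ℤ.+ + 4 ℤ.* (+ (a / 4) ℤ.- + (b / 4))) (sym (expand b)) ⟩
    + b ℤ.+ + 4 ℤ.* (+ (a / 4) ℤ.- + (b / 4))                      ∎)
    where
    open ≡-Reasoning
    expand : ∀ a → + a ≡ + (a % 4) ℤ.+ + (a / 4) ℤ.* + 4
    expand a = trans (cong +_ (m≡m%n+[m/n]*n a 4)) (cong (ℤ._+_ (+ (a % 4))) (ℤₚ.pos-* (a / 4) 4))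
    regroup : ∀ r x y → r ℤ.+ x ℤ.* + 4 ≡ (r ℤ.+ y ℤ.* + 4) ℤ.+ + 4 ℤ.* (x ℤ.- y)
    regroup = ℤ-Solver.solve-∀

  parity : ∀ e → ∃[ g ] (e ≡ g + g ⊎ e ≡ suc (g + g))
  parity zero    = 0 , inj₁ refl
  parity (suc e) with parity e
  ... | g , inj₁ refl = g , inj₂ refl
  ... | g , inj₂ refl = suc g , inj₁ (cong suc (sym (ℕₚ.+-suc g g)))

  4∤2 : ∀ z → + 2 ≢ + 4 ℤ.* z
  4∤2 (+ zero)        ()
  4∤2 (+ suc m)       e = contradiction (ℤₚ.+-injective (trans e (trans (ℤₚ.*-comm (+ 4) (+ suc m)) (sym (ℤₚ.pos-* (suc m) 4))))) λ ()
  4∤2 ℤ.-[1+ m ]      ()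

Balanced : List ℕ → Set
Balanced μ = oddParts μ % 4 ≡ oddParts (conjugate μ) % 4

weight-cases : ∀ {m μ} → Bounded m μ → (Balanced μ × Signed.weight μ ≡ + 1) ⊎ (¬ Balanced μ × Signed.weight μ ≡ ℤ.- + 1)
weight-cases {μ = μ} bounded with signData bounded
... | record { e = e ; z = z ; sign≡ = sign≡ ; rows≡ = rows≡ } with parity e
...   | g , inj₁ refl = inj₁ (%4-sound (oddParts μ) b (+ g ℤ.+ z) (trans rows≡ (regroup (+ b) (+ g) z)) , trans sign≡ (ε-n+n g))
  where
  b = oddParts (conjugate μ)
  regroup : ∀ b g z → b ℤ.+ + 2 ℤ.* (g ℤ.+ g) ℤ.+ + 4 ℤ.* z ≡ b ℤ.+ + 4 ℤ.* (g ℤ.+ z)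
  regroup = ℤ-Solver.solve-∀
...   | g , inj₂ refl = inj₂ (unbalanced , trans sign≡ (cong ℤ.-_ (ε-n+n g)))
  where
  b = oddParts (conjugate μ)
  regroup : ∀ b g z → b ℤ.+ + 2 ℤ.* (+ 1 ℤ.+ (g ℤ.+ g)) ℤ.+ + 4 ℤ.* z ≡ b ℤ.+ (+ 2 ℤ.+ + 4 ℤ.* (g ℤ.+ z))
  regroup = ℤ-Solver.solve-∀
  isolate : ∀ g z z′ → + 2 ℤ.+ + 4 ℤ.* (g ℤ.+ z) ≡ + 4 ℤ.* z′ → + 2 ≡ + 4 ℤ.* (z′ ℤ.- g ℤ.- z)
  isolate g z z′ e = trans (add g z) (trans (cong (λ x → x ℤ.- + 4 ℤ.* (g ℤ.+ z)) e) (factor g z z′))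
    where
    add : ∀ g z → + 2 ≡ + 2 ℤ.+ + 4 ℤ.* (g ℤ.+ z) ℤ.- + 4 ℤ.* (g ℤ.+ z)
    add = ℤ-Solver.solve-∀
    factor : ∀ g z z′ → + 4 ℤ.* z′ ℤ.- + 4 ℤ.* (g ℤ.+ z) ≡ + 4 ℤ.* (z′ ℤ.- g ℤ.- z)
    factor = ℤ-Solver.solve-∀
  unbalanced : ¬ Balanced μ
  unbalanced balanced with %4-complete (oddParts μ) b balanced
  ... | z′ , e = 4∤2 (z′ ℤ.- + g ℤ.- z) (isolate (+ g) z z′ (+-cancelˡ (+ b) _ _ (trans (sym (regroup (+ b) (+ g) z)) (trans (sym rows≡) e))))

-- An element satisfying P contributes 0 to either side, and any other contributes 2.
signed-count : ∀ {a ℓ} {A : Set a} {P : Pred A ℓ} (P? : Decidable P) (v w : A → ℤ) {xs} →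
  All (λ x → v x ≡ + 1 × ((P x × w x ≡ + 1) ⊎ (¬ P x × w x ≡ ℤ.- + 1))) xs →
  + 2 ℤ.* (+ length xs ℤ.- + length (filter P? xs)) ≡ sumBy v xs ℤ.- sumBy w xs
signed-count P? v w [] = refl
signed-count P? v w (_∷_ {x} {xs} (v≡1 , inj₁ (Px , w≡1)) rest) = begin
  + 2 ℤ.* (+ length (x ∷ xs) ℤ.- + length (filter P? (x ∷ xs)))
    ≡⟨ cong (λ ys → + 2 ℤ.* (+ length (x ∷ xs) ℤ.- + length ys)) (Listₚ.filter-accept P? Px) ⟩
  + 2 ℤ.* ((+ 1 ℤ.+ + length xs) ℤ.- (+ 1 ℤ.+ + length (filter P? xs)))
    ≡⟨ shift (+ length xs) (+ length (filter P? xs)) ⟩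
  + 2 ℤ.* (+ length xs ℤ.- + length (filter P? xs))
    ≡⟨ signed-count P? v w rest ⟩
  sumBy v xs ℤ.- sumBy w xs
    ≡⟨ shift′ (sumBy v xs) (sumBy w xs) ⟩
  (+ 1 ℤ.+ sumBy v xs) ℤ.- (+ 1 ℤ.+ sumBy w xs)
    ≡⟨ cong₂ (λ a b → (a ℤ.+ sumBy v xs) ℤ.- (b ℤ.+ sumBy w xs)) (sym v≡1) (sym w≡1) ⟩
  sumBy v (x ∷ xs) ℤ.- sumBy w (x ∷ xs) ∎
  where
  open ≡-Reasoning
  shift : ∀ p t → + 2 ℤ.* ((+ 1 ℤ.+ p) ℤ.- (+ 1 ℤ.+ t)) ≡ + 2 ℤ.* (p ℤ.- t)
  shift = ℤ-Solver.solve-∀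
  shift′ : ∀ x y → x ℤ.- y ≡ (+ 1 ℤ.+ x) ℤ.- (+ 1 ℤ.+ y)
  shift′ = ℤ-Solver.solve-∀
signed-count P? v w (_∷_ {x} {xs} (v≡1 , inj₂ (¬Px , w≡-1)) rest) = begin
  + 2 ℤ.* (+ length (x ∷ xs) ℤ.- + length (filter P? (x ∷ xs)))
    ≡⟨ cong (λ ys → + 2 ℤ.* (+ length (x ∷ xs) ℤ.- + length ys)) (Listₚ.filter-reject P? ¬Px) ⟩
  + 2 ℤ.* ((+ 1 ℤ.+ + length xs) ℤ.- + length (filter P? xs))
    ≡⟨ shift (+ length xs) (+ length (filter P? xs)) ⟩
  + 2 ℤ.+ + 2 ℤ.* (+ length xs ℤ.- + length (filter P? xs))
    ≡⟨ cong (ℤ._+_ (+ 2)) (signed-count P? v w rest) ⟩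
  + 2 ℤ.+ (sumBy v xs ℤ.- sumBy w xs)
    ≡⟨ shift′ (sumBy v xs) (sumBy w xs) ⟩
  (+ 1 ℤ.+ sumBy v xs) ℤ.- (ℤ.- + 1 ℤ.+ sumBy w xs)
    ≡⟨ cong₂ (λ a b → (a ℤ.+ sumBy v xs) ℤ.- (b ℤ.+ sumBy w xs)) (sym v≡1) (sym w≡-1) ⟩
  sumBy v (x ∷ xs) ℤ.- sumBy w (x ∷ xs) ∎
  where
  open ≡-Reasoning
  shift : ∀ p t → + 2 ℤ.* ((+ 1 ℤ.+ p) ℤ.- t) ≡ + 2 ℤ.+ + 2 ℤ.* (p ℤ.- t)
  shift = ℤ-Solver.solve-∀
  shift′ : ∀ x y → + 2 ℤ.+ (x ℤ.- y) ≡ (+ 1 ℤ.+ x) ℤ.- (ℤ.- + 1 ℤ.+ y)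
  shift′ = ℤ-Solver.solve-∀

u-formula : ∀ n → + 2 ℤ.* u n ≡ Unsigned.all n ℤ.- Signed.all n
u-formula n = signed-count (λ μ → oddParts μ % 4 ≟ oddParts (conjugate μ) % 4) Unsigned.weight Signed.weight
  (All.map (λ {μ} (_ , bounded) → unsigned μ , weight-cases bounded) (partsB-valid n n n))
  where
  unsigned : ∀ μ → Unsigned.weight μ ≡ + 1
  unsigned []      = refl
  unsigned (k ∷ μ) = trans (ℤₚ.*-identityˡ _) (unsigned μ)

-- Product formulas for the two enumerations

-- With trivial weights the recurrence reads (1 - q^(m+1)) P_(m+1) = P_m, so Euler's product appears
-- one factor at a time.
Unsigned-⊗-pochFin : ∀ m → Unsigned.partsUpTo m ⊗ pochFin (+ 1) 1 1 m ≋ one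
Unsigned-⊗-pochFin zero    = ≋-trans (⊗-cong Unsigned.partsUpTo-zero (≋-refl {one})) (⊗-identityʳ one)
Unsigned-⊗-pochFin (suc m) = begin
  P₁ ⊗ (Π ⊗ (one ⊝ mono (+ 1) (1 + 1 * m)))
    ≈⟨ ⊗-cong (≋-refl {P₁}) (⊗-cong (≋-refl {Π}) (⊕-cong (≋-refl {one}) (⊖-cong (q^-cong (cong suc (ℕₚ.*-identityˡ m)))))) ⟩
  P₁ ⊗ (Π ⊗ (one ⊝ x))
    ≈⟨ solve 3 (λ P Π x → P :* (Π :* (con (+ 1) :- x)) := (P :- x :* P) :* Π) ≋-refl P₁ Π x ⟩
  (P₁ ⊝ x ⊗ P₁) ⊗ Π
    ≈⟨ ⊗-cong (⊕-cong step (≋-refl {⊖ (x ⊗ P₁)})) (≋-refl {Π}) ⟩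
  (P₀ ⊕ x ⊗ P₁ ⊝ x ⊗ P₁) ⊗ Π
    ≈⟨ solve 3 (λ P y Π → (P :+ y :- y) :* Π := P :* Π) ≋-refl P₀ (x ⊗ P₁) Π ⟩
  P₀ ⊗ Π
    ≈⟨ Unsigned-⊗-pochFin m ⟩
  one ∎
  where
  open ≋-Reasoning
  open FPS-Solver
  P₀ = Unsigned.partsUpTo m
  P₁ = Unsigned.partsUpTo (suc m)
  Π = pochFin (+ 1) 1 1 m
  x = q^ (suc m)
  step : P₁ ≋ P₀ ⊕ x ⊗ P₁
  step = ≋-trans (Unsigned.partsUpTo-suc m) (⊕-cong (≋-refl {P₀}) (⊗-cong (≋-refl {x}) (pointwise λ n → ℤₚ.*-identityˡ (P₁ n))))

Unsigned-⊗-qq : Unsigned.all ⊗ qq 1 ≋ one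
Unsigned-⊗-qq = mod⇒≋ λ N → mod-trans (⊗-mod (Unsigned.all-trunc N) (poch-trunc (+ 1) 1 0 N)) (≋⇒mod (Unsigned-⊗-pochFin N))

-- The substitution of -q for q

bar : FPS → FPS
bar f n = ε n ℤ.* f n

bar-cong : f ≋ g → bar f ≋ bar g
bar-cong e = pointwise λ n → cong (ε n ℤ.*_) (coeff e n)

bar-⊕ : ∀ f g → bar (f ⊕ g) ≋ bar f ⊕ bar g
bar-⊕ f g = pointwise λ n → ℤₚ.*-distribˡ-+ (ε n) (f n) (g n)

bar-bar : ∀ f → bar (bar f) ≋ f
bar-bar f = pointwise λ n → trans (sym (ℤₚ.*-assoc (ε n) (ε n) (f n)))
  (trans (cong (ℤ._* f n) (trans (sym (ε-+ n n)) (ε-n+n n))) (ℤₚ.*-identityˡ (f n)))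

bar-⊗ : ∀ f g → bar (f ⊗ g) ≋ bar f ⊗ bar g
bar-⊗ f g = pointwise λ n → trans (sym (sumTo-* n (ε n) _)) (sumTo-cong n (λ i i≤n →
  trans (cong (ℤ._* (f i ℤ.* g (n ∸ i))) (trans (cong ε (sym (ℕₚ.m+[n∸m]≡n i≤n))) (ε-+ i (n ∸ i))))
    (interchange (ε i) (ε (n ∸ i)) (f i) (g (n ∸ i)))))
  where
  interchange : ∀ a b c d → a ℤ.* b ℤ.* (c ℤ.* d) ≡ a ℤ.* c ℤ.* (b ℤ.* d)
  interchange = ℤ-Solver.solve-∀

bar-mono : ∀ c k → bar (mono c k) ≋ mono (ε k ℤ.* c) k
bar-mono c k = pointwise (go k)
  where
  negate : ∀ a b c → a ℤ.* b ≡ c → ℤ.- a ℤ.* b ≡ ℤ.- c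
  negate a b c e = trans (sym (ℤₚ.neg-distribˡ-* a b)) (cong ℤ.-_ e)
  go : ∀ k n → ε n ℤ.* mono c k n ≡ mono (ε k ℤ.* c) k n
  go zero    zero    = refl
  go zero    (suc n) = ℤₚ.*-zeroʳ (ε (suc n))
  go (suc k) zero    = refl
  go (suc k) (suc n) = begin
    ε (suc n) ℤ.* mono c (suc k) (suc n)  ≡⟨ cong (ε (suc n) ℤ.*_) (mono-suc c k n) ⟩
    ε (suc n) ℤ.* mono c k n              ≡⟨ negate (ε n) (mono c k n) _ (go k n) ⟩
    ℤ.- mono (ε k ℤ.* c) k n              ≡⟨ coeff (⊖-mono (ε k ℤ.* c) k) n ⟩
    mono (ℤ.- (ε k ℤ.* c)) k n            ≡⟨ coeff (mono-cong {k = k} (ℤₚ.neg-distribˡ-* (ε k) c) refl) n ⟩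
    mono (ε (suc k) ℤ.* c) k n            ≡⟨ mono-suc (ε (suc k) ℤ.* c) k n ⟨
    mono (ε (suc k) ℤ.* c) (suc k) (suc n) ∎
    where open ≡-Reasoning

bar-one : bar one ≋ one
bar-one = pointwise λ { zero → refl ; (suc n) → ℤₚ.*-zeroʳ (ε (suc n)) }

-- Unlike n + n, this unfolds to two successors, matching recurrences that advance two part sizes at
-- a time.
double : ℕ → ℕ
double zero    = zero
double (suc n) = suc (suc (double n))

double≡+ : ∀ n → double n ≡ n + n
double≡+ zero    = refl
double≡+ (suc n) = cong suc (trans (cong suc (double≡+ n)) (sym (ℕₚ.+-suc n n)))

n≤double : ∀ n → n ≤ double n
n≤double n = subst (n ≤_) (sym (double≡+ n)) (ℕₚ.m≤m+n n n)

ε-double : ∀ n → ε (double n) ≡ + 1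
ε-double n = trans (cong ε (double≡+ n)) (ε-n+n n)

⌊double/2⌋ : ∀ n → ⌊ double n /2⌋ ≡ n
⌊double/2⌋ zero    = refl
⌊double/2⌋ (suc n) = cong suc (⌊double/2⌋ n)

⌊1+double/2⌋ : ∀ n → ⌊ suc (double n) /2⌋ ≡ n
⌊1+double/2⌋ zero    = refl
⌊1+double/2⌋ (suc n) = cong suc (⌊1+double/2⌋ n)

module SignedProduct where

  y : ℕ → FPS
  y k = mono (ε k) (double k)

  bar-y : ∀ k → bar (y k) ≋ y k
  bar-y k = ≋-trans (bar-mono (ε k) (double k)) (mono-cong (trans (cong (ℤ._* ε k) (ε-double k)) (ℤₚ.*-identityˡ (ε k))) refl)

  Π₂ : ℕ → FPS
  Π₂ N = pochFin (ℤ.- + 1) 2 4 N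

  Π₂-suc : ∀ N → Π₂ (suc N) ≋ Π₂ N ⊗ (one ⊕ q^ (suc (double N) + suc (double N)))
  Π₂-suc N = ⊗-cong (≋-refl {Π₂ N}) (⊕-cong (≋-refl {one}) (≋-trans (⊖-mono (ℤ.- + 1) (2 + 4 * N)) (q^-cong
    (trans (regroup N) (cong (λ n → suc n + suc n) (sym (double≡+ N)))))))
    where
    regroup : ∀ N → 2 + 4 * N ≡ suc (N + N) + suc (N + N)
    regroup = ℕ-Solver.solve-∀

  bar-Π₂ : ∀ N → bar (Π₂ N) ≋ Π₂ N
  bar-Π₂ zero    = bar-one
  bar-Π₂ (suc N) = begin
    bar (Π₂ (suc N))                      ≈⟨ bar-cong (Π₂-suc N) ⟩
    bar (Π₂ N ⊗ (one ⊕ q^ (m + m)))       ≈⟨ bar-⊗ (Π₂ N) (one ⊕ q^ (m + m)) ⟩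
    bar (Π₂ N) ⊗ bar (one ⊕ q^ (m + m))   ≈⟨ ⊗-cong (bar-Π₂ N) (≋-trans (bar-⊕ one (q^ (m + m))) (⊕-cong bar-one
                                               (≋-trans (bar-mono (+ 1) (m + m)) (mono-cong (cong (ℤ._* + 1) (ε-n+n m)) refl)))) ⟩
    Π₂ N ⊗ (one ⊕ q^ (m + m))             ≈⟨ Π₂-suc N ⟨
    Π₂ (suc N)                            ∎
    where
    open ≋-Reasoning
    m = suc (double N)

  -- C N enumerates, with signs, the partitions into parts ≤ 2N without repeated odd parts:
  -- two copies of the part 2i-1 may be removed at the cost of the factor -q^(4i-2).
  C : ℕ → FPS
  C N = Π₂ N ⊗ Signed.partsUpTo (double N)

  C-zero : C 0 ≋ one
  C-zero = ≋-trans (⊗-identityˡ _) Signed.partsUpTo-zero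

  -- For x = (-1)^N q^(2N+1) the recurrence is F₁ = F₀ + x bar F₁. As x is odd in q, substituting
  -- the barred recurrence gives F₁ = F₀ + x bar F₀ - x² F₁, from which the unknown at -q has
  -- disappeared.
  Signed-odd-step : ∀ N → (one ⊕ q^ (suc (double N) + suc (double N))) ⊗ Signed.partsUpTo (suc (double N))
    ≋ Signed.partsUpTo (double N) ⊕ q^ 1 ⊗ y N ⊗ bar (Signed.partsUpTo (double N))
  Signed-odd-step N = begin
    (one ⊕ q^ (m + m)) ⊗ F₁
      ≈⟨ ⊗-cong (⊕-cong (≋-refl {one}) (≋-sym x⊗x)) (≋-refl {F₁}) ⟩
    (one ⊕ x ⊗ x) ⊗ F₁
      ≈⟨ solve 2 (λ x F → (con (+ 1) :+ x :* x) :* F := F :+ x :* x :* F) ≋-refl x F₁ ⟩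
    F₁ ⊕ x ⊗ x ⊗ F₁
      ≈⟨ ⊕-cong step₂ (≋-refl {x ⊗ x ⊗ F₁}) ⟩
    F₀ ⊕ x ⊗ (bar F₀ ⊕ ⊖ x ⊗ F₁) ⊕ x ⊗ x ⊗ F₁
      ≈⟨ solve 4 (λ F₀ B x F₁ → F₀ :+ x :* (B :+ (:- x) :* F₁) :+ x :* x :* F₁ := F₀ :+ x :* B) ≋-refl F₀ (bar F₀) x F₁ ⟩
    F₀ ⊕ x ⊗ bar F₀
      ≈⟨ ⊕-cong (≋-refl {F₀}) (⊗-cong x≋ (≋-refl {bar F₀})) ⟩
    F₀ ⊕ q^ 1 ⊗ y N ⊗ bar F₀ ∎
    where
    open ≋-Reasoning
    open FPS-Solver
    m = suc (double N)
    F₀ = Signed.partsUpTo (double N)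
    F₁ = Signed.partsUpTo m
    x = mono (ε N) m
    x≋ : x ≋ q^ 1 ⊗ y N
    x≋ = ≋-sym (≋-trans (mono-⊗ (+ 1) 1 (ε N) (double N)) (mono-cong (ℤₚ.*-identityˡ (ε N)) refl))
    x⊗x : x ⊗ x ≋ q^ (m + m)
    x⊗x = ≋-trans (mono-⊗ (ε N) m (ε N) m) (mono-cong (trans (sym (ε-+ N N)) (ε-n+n N)) refl)
    bar-x : bar x ≋ ⊖ x
    bar-x = ≋-trans (bar-mono (ε N) m) (≋-trans (mono-cong (trans (cong (λ s → ℤ.- s ℤ.* ε N) (ε-double N)) (ℤₚ.-1*i≡-i (ε N))) refl) (≋-sym (⊖-mono (ε N) m)))
    step : F₁ ≋ F₀ ⊕ x ⊗ bar F₁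
    step = ≋-trans (Signed.partsUpTo-suc (double N)) (⊕-cong (≋-refl {F₀}) (⊗-cong (mono-cong {k = m} (cong ε (⌊1+double/2⌋ N)) refl) (≋-refl {bar F₁})))
    step₂ : F₁ ≋ F₀ ⊕ x ⊗ (bar F₀ ⊕ ⊖ x ⊗ F₁)
    step₂ = ≋-trans step (⊕-cong (≋-refl {F₀}) (⊗-cong (≋-refl {x}) (≋-trans (bar-cong step) (≋-trans (bar-⊕ F₀ (x ⊗ bar F₁))
      (⊕-cong (≋-refl {bar F₀}) (≋-trans (bar-⊗ x (bar F₁)) (⊗-cong bar-x (bar-bar F₁))))))))

  -- `Π₂` is even in q and passes through `bar`; its new factor is the one that `Signed-odd-step`
  -- requires. The coefficients that remain are geometric in N, which permits a q-difference
  -- equation.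
  C-suc : ∀ N → C (suc N) ≋ C N ⊕ q^ 1 ⊗ y N ⊗ bar (C N) ⊕ y (suc N) ⊗ bar (C (suc N))
  C-suc N = begin
    Π₁ ⊗ F₂
      ≈⟨ ⊗-cong (≋-refl {Π₁}) step ⟩
    Π₁ ⊗ (F₁ ⊕ y (suc N) ⊗ bar F₂)
      ≈⟨ solve 4 (λ Π F y B → Π :* (F :+ y :* B) := Π :* F :+ y :* (Π :* B)) ≋-refl Π₁ F₁ (y (suc N)) (bar F₂) ⟩
    Π₁ ⊗ F₁ ⊕ y (suc N) ⊗ (Π₁ ⊗ bar F₂)
      ≈⟨ ⊕-cong odd (⊗-cong (≋-refl {y (suc N)}) (≋-sym (bar-C (suc N)))) ⟩
    C N ⊕ q^ 1 ⊗ y N ⊗ bar (C N) ⊕ y (suc N) ⊗ bar (C (suc N)) ∎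
    where
    open ≋-Reasoning
    open FPS-Solver
    m = suc (double N)
    Π₀ = Π₂ N
    Π₁ = Π₂ (suc N)
    F₀ = Signed.partsUpTo (double N)
    F₁ = Signed.partsUpTo m
    F₂ = Signed.partsUpTo (suc m)
    step : F₂ ≋ F₁ ⊕ y (suc N) ⊗ bar F₂
    step = ≋-trans (Signed.partsUpTo-suc m) (⊕-cong (≋-refl {F₁}) (⊗-cong (mono-cong {k = suc m} (cong ε (⌊double/2⌋ (suc N))) refl) (≋-refl {bar F₂})))
    bar-C : ∀ N → bar (C N) ≋ Π₂ N ⊗ bar (Signed.partsUpTo (double N))
    bar-C N = ≋-trans (bar-⊗ (Π₂ N) (Signed.partsUpTo (double N))) (⊗-cong (bar-Π₂ N) (≋-refl {bar (Signed.partsUpTo (double N))}))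
    odd : Π₁ ⊗ F₁ ≋ C N ⊕ q^ 1 ⊗ y N ⊗ bar (C N)
    odd = begin
      Π₁ ⊗ F₁                                        ≈⟨ ⊗-cong (Π₂-suc N) (≋-refl {F₁}) ⟩
      Π₀ ⊗ (one ⊕ q^ (m + m)) ⊗ F₁                   ≈⟨ ⊗-assoc Π₀ (one ⊕ q^ (m + m)) F₁ ⟩
      Π₀ ⊗ ((one ⊕ q^ (m + m)) ⊗ F₁)                 ≈⟨ ⊗-cong (≋-refl {Π₀}) (Signed-odd-step N) ⟩
      Π₀ ⊗ (F₀ ⊕ q^ 1 ⊗ y N ⊗ bar F₀)                ≈⟨ solve 4 (λ Π F x B → Π :* (F :+ x :* B) := Π :* F :+ x :* (Π :* B)) ≋-refl Π₀ F₀ (q^ 1 ⊗ y N) (bar F₀) ⟩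
      Π₀ ⊗ F₀ ⊕ q^ 1 ⊗ y N ⊗ (Π₀ ⊗ bar F₀)           ≈⟨ ⊕-cong (≋-refl {C N}) (⊗-cong (≋-refl {q^ 1 ⊗ y N}) (≋-sym (bar-C N))) ⟩
      C N ⊕ q^ 1 ⊗ y N ⊗ bar (C N)                   ∎

  bars : ℕ → FPS → FPS
  bars zero    f = f
  bars (suc k) f = bar (bars k f)

  bars-one : ∀ k → f ≋ one → bars k f ≋ one
  bars-one zero    e = e
  bars-one (suc k) e = ≋-trans (bar-cong (bars-one k e)) bar-one

  bars-C-suc : ∀ k N → bars k (C (suc N)) ≋ bars k (C N) ⊕ mono (ε k) 1 ⊗ y N ⊗ bars (suc k) (C N) ⊕ y (suc N) ⊗ bars (suc k) (C (suc N))
  bars-C-suc zero    N = C-suc N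
  bars-C-suc (suc k) N = begin
    bar (bars k (C (suc N)))
      ≈⟨ bar-cong (bars-C-suc k N) ⟩
    bar (c₀ ⊕ x ⊗ y N ⊗ d₀ ⊕ y (suc N) ⊗ d₁)
      ≈⟨ ≋-trans (bar-⊕ (c₀ ⊕ x ⊗ y N ⊗ d₀) (y (suc N) ⊗ d₁)) (⊕-cong (bar-⊕ c₀ (x ⊗ y N ⊗ d₀)) (bar-⊗ (y (suc N)) d₁)) ⟩
    bar c₀ ⊕ bar (x ⊗ y N ⊗ d₀) ⊕ bar (y (suc N)) ⊗ bar d₁
      ≈⟨ ⊕-cong (⊕-cong (≋-refl {bar c₀}) (≋-trans (bar-⊗ (x ⊗ y N) d₀) (⊗-cong (≋-trans (bar-⊗ x (y N)) (⊗-cong bar-x (bar-y N))) (≋-refl {bar d₀}))))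
           (⊗-cong (bar-y (suc N)) (≋-refl {bar d₁})) ⟩
    bar c₀ ⊕ mono (ε (suc k)) 1 ⊗ y N ⊗ bar d₀ ⊕ y (suc N) ⊗ bar d₁ ∎
    where
    open ≋-Reasoning
    x = mono (ε k) 1
    c₀ = bars k (C N)
    d₀ = bars (suc k) (C N)
    d₁ = bars (suc k) (C (suc N))
    bar-x : bar x ≋ mono (ε (suc k)) 1
    bar-x = ≋-trans (bar-mono (ε k) 1) (mono-cong (ℤₚ.-1*i≡-i (ε k)) refl)

  Y : ℕ → ℕ → FPS
  Y k zero    = one
  Y k (suc N) = y k ⊗ Y k N

  y-suc : ∀ k → y (suc k) ≋ y k ⊗ mono (ℤ.- + 1) 2
  y-suc k = ≋-sym (≋-trans (mono-⊗ (ε k) (double k) (ℤ.- + 1) 2)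
    (mono-cong (trans (ℤₚ.*-comm (ε k) (ℤ.- + 1)) (ℤₚ.-1*i≡-i (ε k))) (ℕₚ.+-comm (double k) 2)))

  -- `y N` is the N-th power of `y 1`, and `y k` times `y 1` is `y (suc k)`. A coefficient depending
  -- on N is thereby absorbed into a shift of the point of evaluation.
  Y-⊗-y : ∀ k N → Y k N ⊗ y N ≋ Y (suc k) N
  Y-⊗-y k zero    = ≋-trans (⊗-identityˡ (y 0)) q^0
  Y-⊗-y k (suc N) = begin
    y k ⊗ Y k N ⊗ y (suc N)              ≈⟨ ⊗-cong (≋-refl {y k ⊗ Y k N}) (y-suc N) ⟩
    y k ⊗ Y k N ⊗ (y N ⊗ m)              ≈⟨ solve 4 (λ a b c d → a :* b :* (c :* d) := a :* d :* (b :* c)) ≋-refl (y k) (Y k N) (y N) m ⟩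
    y k ⊗ m ⊗ (Y k N ⊗ y N)              ≈⟨ ⊗-cong (≋-sym (y-suc k)) (Y-⊗-y k N) ⟩
    y (suc k) ⊗ Y (suc k) N              ∎
    where
    open ≋-Reasoning
    open FPS-Solver
    m = mono (ℤ.- + 1) 2

  -- If C(x) = Σ x^N C_N, then G k N is the x^N-term of C at x = (-1)^k q^2k with q replaced
  -- by (-1)^k q.  The recurrence C-suc turns into one for these values whose sum over N
  -- telescopes, so that the limit of C_N is peeled off factor by factor.
  G : ℕ → ℕ → FPS
  G k N = Y k N ⊗ bars k (C N)

  z : ℕ → FPS
  z k = q^ (suc (double k))

  G-zero : ∀ k → G k 0 ≋ one
  G-zero k = ≋-trans (⊗-identityˡ _) (bars-one k C-zero)

  G-suc : ∀ k N → G k (suc N) ≋ y k ⊗ G k N ⊕ z k ⊗ G (suc k) N ⊕ G (suc k) (suc N)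
  G-suc k N = begin
    y k ⊗ Y k N ⊗ bars k (C (suc N))
      ≈⟨ ⊗-cong (≋-refl {y k ⊗ Y k N}) (bars-C-suc k N) ⟩
    y k ⊗ Y k N ⊗ (c₀ ⊕ x ⊗ y N ⊗ d₀ ⊕ y (suc N) ⊗ d₁)
      ≈⟨ solve 8 (λ a b c₀ x n d₀ n₁ d₁ → a :* b :* (c₀ :+ x :* n :* d₀ :+ n₁ :* d₁)
           := a :* (b :* c₀) :+ a :* x :* (b :* n :* d₀) :+ a :* b :* n₁ :* d₁) ≋-refl (y k) (Y k N) c₀ x (y N) d₀ (y (suc N)) d₁ ⟩
    y k ⊗ G k N ⊕ y k ⊗ x ⊗ (Y k N ⊗ y N ⊗ d₀) ⊕ Y k (suc N) ⊗ y (suc N) ⊗ d₁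
      ≈⟨ ⊕-cong (⊕-cong (≋-refl {y k ⊗ G k N}) (⊗-cong z≋ (⊗-cong (Y-⊗-y k N) (≋-refl {d₀})))) (⊗-cong (Y-⊗-y k (suc N)) (≋-refl {d₁})) ⟩
    y k ⊗ G k N ⊕ z k ⊗ G (suc k) N ⊕ G (suc k) (suc N) ∎
    where
    open ≋-Reasoning
    open FPS-Solver
    x = mono (ε k) 1
    c₀ = bars k (C N)
    d₀ = bars (suc k) (C N)
    d₁ = bars (suc k) (C (suc N))
    z≋ : y k ⊗ x ≋ z k
    z≋ = ≋-trans (mono-⊗ (ε k) (double k) (ε k) 1) (mono-cong (trans (sym (ε-+ k k)) (ε-n+n k)) (ℕₚ.+-comm (double k) 1))

  G-𝟎-mod : ∀ k N → G (suc k) N ≋ 𝟎 mod N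
  G-𝟎-mod k N = subst (G (suc k) N ≋ 𝟎 mod_) (ℕₚ.+-identityʳ N) (⊗-𝟎-mod (Y-𝟎 N) (below {bars (suc k) (C N)} λ _ ()))
    where
    Y-𝟎 : ∀ N → Y (suc k) N ≋ 𝟎 mod N
    Y-𝟎 zero    = below λ _ ()
    Y-𝟎 (suc N) = ⊗-𝟎-mod (mono-𝟎-mod (s≤s z≤n)) (Y-𝟎 N)

  S : ℕ → ℕ → FPS
  S k M = ∑ M (G k)

  S-suc : ∀ k M → S k (suc M) ≋ y k ⊗ S k M ⊕ z k ⊗ S (suc k) M ⊕ S (suc k) (suc M)
  S-suc k M = begin
    ∑ (suc M) (G k)
      ≈⟨ ∑-suc M (G k) ⟩
    G k 0 ⊕ ∑ M (λ N → G k (suc N))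
      ≈⟨ ⊕-cong (≋-trans (G-zero k) (≋-sym (G-zero (suc k)))) (≋-trans (∑-cong M (G-suc k)) (≋-trans
           (∑-⊕ M (λ N → y k ⊗ G k N ⊕ z k ⊗ G (suc k) N) (λ N → G (suc k) (suc N)))
           (⊕-cong (≋-trans (∑-⊕ M (λ N → y k ⊗ G k N) (λ N → z k ⊗ G (suc k) N)) (⊕-cong (≋-sym (∑-⊗ M (y k) (G k))) (≋-sym (∑-⊗ M (z k) (G (suc k))))))
             (≋-refl {∑ M (λ N → G (suc k) (suc N))})))) ⟩
    G (suc k) 0 ⊕ (y k ⊗ S k M ⊕ z k ⊗ S (suc k) M ⊕ ∑ M (λ N → G (suc k) (suc N)))
      ≈⟨ solve 3 (λ a b c → a :+ (b :+ c) := b :+ (a :+ c)) ≋-refl (G (suc k) 0) (y k ⊗ S k M ⊕ z k ⊗ S (suc k) M) (∑ M (λ N → G (suc k) (suc N))) ⟩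
    y k ⊗ S k M ⊕ z k ⊗ S (suc k) M ⊕ (G (suc k) 0 ⊕ ∑ M (λ N → G (suc k) (suc N)))
      ≈⟨ ⊕-cong (≋-refl {y k ⊗ S k M ⊕ z k ⊗ S (suc k) M}) (≋-sym (∑-suc M (G (suc k)))) ⟩
    y k ⊗ S k M ⊕ z k ⊗ S (suc k) M ⊕ S (suc k) (suc M) ∎
    where
    open ≋-Reasoning
    open FPS-Solver

  -- At positive index the N-th term is divisible by q^N, so the partial sums converge. At index 0
  -- the terms are the `C N` themselves, which do not tend to 0.
  S-stable : ∀ k M → S (suc k) (suc M) ≋ S (suc k) M mod M
  S-stable k M = mod-trans (⊕-mod (mod-refl {S (suc k) M}) (G-𝟎-mod k M)) (≋⇒mod (solve 1 (λ a → a :+ con (+ 0) := a) ≋-refl (S (suc k) M)))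
    where open FPS-Solver

  -- In the limit the two partial sums of equal index in `S-suc` merge, leaving s₁ = y s₁ + z s₂ +
  -- s₂: each value determines the previous one up to an explicit factor.
  S-step : ∀ k M → (one ⊝ y (suc k)) ⊗ S (suc k) M ≋ (one ⊕ z (suc k)) ⊗ S (suc (suc k)) M mod M
  S-step k M = begin
    (one ⊝ y′) ⊗ S₁                ≈⟨ ≋⇒mod (solve 2 (λ a b → (con (+ 1) :- a) :* b := b :- a :* b) ≋-refl y′ S₁) ⟩
    S₁ ⊝ y′ ⊗ S₁                   ≈⟨ ⊕-mod (mod-trans (mod-sym (S-stable k M)) (≋⇒mod (S-suc (suc k) M))) (mod-refl {⊖ (y′ ⊗ S₁)}) ⟩
    y′ ⊗ S₁ ⊕ z′ ⊗ S₂ ⊕ S (suc (suc k)) (suc M) ⊝ y′ ⊗ S₁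
                                   ≈⟨ ⊕-mod (⊕-mod (mod-refl {y′ ⊗ S₁ ⊕ z′ ⊗ S₂}) (S-stable (suc k) M)) (mod-refl {⊖ (y′ ⊗ S₁)}) ⟩
    y′ ⊗ S₁ ⊕ z′ ⊗ S₂ ⊕ S₂ ⊝ y′ ⊗ S₁ ≈⟨ ≋⇒mod (solve 3 (λ a z s → a :+ z :* s :+ s :- a := (con (+ 1) :+ z) :* s) ≋-refl (y′ ⊗ S₁) z′ S₂) ⟩
    (one ⊕ z′) ⊗ S₂                ∎
    where
    open mod-Reasoning M
    open FPS-Solver
    y′ = y (suc k)
    z′ = z (suc k)
    S₁ = S (suc k) M
    S₂ = S (suc (suc k)) M

  -- This is the start of the chain, at index 0: the sum there diverges, but as `y 0` is 1 the
  -- difference of consecutive partial sums is `C M`, and it is expressed exactly by sums at index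
  -- 1.
  C≋S : ∀ M → C M ≋ z 0 ⊗ S 1 M ⊕ S 1 (suc M)
  C≋S zero    = ≋-trans C-zero (≋-trans (solve 1 (λ a → con (+ 1) := a :* con (+ 0) :+ (con (+ 0) :+ con (+ 1))) ≋-refl (z 0))
    (⊕-cong (≋-refl {z 0 ⊗ 𝟎}) (⊕-cong (≋-refl {𝟎}) (≋-sym (G-zero 1)))))
    where open FPS-Solver
  C≋S (suc M) = begin
    C (suc M)
      ≈⟨ C-suc M ⟩
    C M ⊕ z 0 ⊗ y M ⊗ bar (C M) ⊕ y (suc M) ⊗ bar (C (suc M))
      ≈⟨ ⊕-cong (⊕-cong (C≋S M) (≋-trans (⊗-assoc (z 0) (y M) (bar (C M))) (⊗-cong (≋-refl {z 0}) (⊗-cong (y≋Y M) (≋-refl {bar (C M)})))))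
           (⊗-cong (y≋Y (suc M)) (≋-refl {bar (C (suc M))})) ⟩
    z 0 ⊗ S 1 M ⊕ S 1 (suc M) ⊕ z 0 ⊗ G 1 M ⊕ G 1 (suc M)
      ≈⟨ solve 5 (λ z a b c d → z :* a :+ b :+ z :* c :+ d := z :* (a :+ c) :+ (b :+ d)) ≋-refl (z 0) (S 1 M) (S 1 (suc M)) (G 1 M) (G 1 (suc M)) ⟩
    z 0 ⊗ S 1 (suc M) ⊕ S 1 (suc (suc M)) ∎
    where
    open ≋-Reasoning
    open FPS-Solver
    Y₀≋one : ∀ N → Y 0 N ≋ one
    Y₀≋one zero    = ≋-refl
    Y₀≋one (suc N) = ≋-trans (⊗-cong q^0 (Y₀≋one N)) (⊗-identityˡ one)
    y≋Y : ∀ N → y N ≋ Y 1 N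
    y≋Y N = ≋-trans (≋-sym (⊗-identityˡ (y N))) (≋-trans (⊗-cong (≋-sym (Y₀≋one N)) (≋-refl {y N})) (Y-⊗-y 0 N))

  Z : ℕ → FPS
  Z zero    = one
  Z (suc K) = Z K ⊗ (one ⊝ y (suc K))

  Π₁ : ℕ → FPS
  Π₁ K = pochFin (ℤ.- + 1) 1 2 K

  Π₁-suc : ∀ K → Π₁ (suc K) ≋ Π₁ K ⊗ (one ⊕ z K)
  Π₁-suc K = ⊗-cong (≋-refl {Π₁ K}) (⊕-cong (≋-refl {one}) (≋-trans (⊖-mono (ℤ.- + 1) (1 + 2 * K))
    (q^-cong (cong suc (trans (cong (λ n → K + n) (ℕₚ.+-identityʳ K)) (sym (double≡+ K)))))))

  Z-⊗-C : ∀ K M → Z K ⊗ C M ≋ Π₁ (suc K) ⊗ S (suc K) M mod M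
  Z-⊗-C zero    M = begin
    one ⊗ C M                                ≈⟨ ≋⇒mod (≋-trans (⊗-identityˡ (C M)) (C≋S M)) ⟩
    z 0 ⊗ S 1 M ⊕ S 1 (suc M)                ≈⟨ ⊕-mod (mod-refl {z 0 ⊗ S 1 M}) (S-stable 0 M) ⟩
    z 0 ⊗ S 1 M ⊕ S 1 M                      ≈⟨ ≋⇒mod (solve 2 (λ z s → z :* s :+ s := con (+ 1) :* (con (+ 1) :+ z) :* s) ≋-refl (z 0) (S 1 M)) ⟩
    one ⊗ (one ⊕ z 0) ⊗ S 1 M                ≈⟨ ≋⇒mod (⊗-cong (≋-sym (Π₁-suc 0)) (≋-refl {S 1 M})) ⟩
    Π₁ 1 ⊗ S 1 M                             ∎
    where
    open mod-Reasoning M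
    open FPS-Solver
  Z-⊗-C (suc K) M = begin
    Z K ⊗ (one ⊝ y′) ⊗ C M                   ≈⟨ ≋⇒mod (solve 3 (λ a b c → a :* b :* c := b :* (a :* c)) ≋-refl (Z K) (one ⊝ y′) (C M)) ⟩
    (one ⊝ y′) ⊗ (Z K ⊗ C M)                 ≈⟨ ⊗-mod (mod-refl {one ⊝ y′}) (Z-⊗-C K M) ⟩
    (one ⊝ y′) ⊗ (Π ⊗ S (suc K) M)           ≈⟨ ≋⇒mod (solve 3 (λ a b c → b :* (a :* c) := a :* (b :* c)) ≋-refl Π (one ⊝ y′) (S (suc K) M)) ⟩
    Π ⊗ ((one ⊝ y′) ⊗ S (suc K) M)           ≈⟨ ⊗-mod (mod-refl {Π}) (S-step K M) ⟩
    Π ⊗ ((one ⊕ z (suc K)) ⊗ S′)             ≈⟨ ≋⇒mod (≋-sym (⊗-assoc Π (one ⊕ z (suc K)) S′)) ⟩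
    Π ⊗ (one ⊕ z (suc K)) ⊗ S′               ≈⟨ ≋⇒mod (⊗-cong (≋-sym (Π₁-suc (suc K))) (≋-refl {S′})) ⟩
    Π₁ (suc (suc K)) ⊗ S′                    ∎
    where
    open mod-Reasoning M
    open FPS-Solver
    y′ = y (suc K)
    Π = Π₁ (suc K)
    S′ = S (suc (suc K)) M

  -- Every term but the first contains `y k`, hence q^(2k). The chain therefore ends at 1 when k
  -- tends to infinity.
  S≋one : ∀ k M → S k (suc M) ≋ one mod k
  S≋one k M = begin
    S k (suc M)                              ≈⟨ ≋⇒mod (∑-suc M (G k)) ⟩
    G k 0 ⊕ ∑ M (λ N → G k (suc N))          ≈⟨ ⊕-mod (≋⇒mod (G-zero k)) (∑-cong-mod M (λ N _ → small N)) ⟩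
    one ⊕ ∑ M (λ _ → 𝟎)                      ≈⟨ ≋⇒mod (⊕-cong (≋-refl {one}) (∑-𝟎 M (λ _ → ≋-refl))) ⟩
    one ⊕ 𝟎                                  ≈⟨ ≋⇒mod (solve 0 (con (+ 1) :+ con (+ 0) := con (+ 1)) ≋-refl) ⟩
    one                                      ∎
    where
    open mod-Reasoning k
    open FPS-Solver
    small : ∀ N → G k (suc N) ≋ 𝟎 mod k
    small N = mod-trans (⊗-mod (⊗-mod (mono-𝟎-mod (n≤double k)) (mod-refl {Y k N})) (mod-refl {bars k (C (suc N))}))
      (≋⇒mod (solve 2 (λ a b → con (+ 0) :* a :* b := con (+ 0)) ≋-refl (Y k N) (bars k (C (suc N)))))

  -- `Z` collects the factors 1 - (-1)^k q^(2k). Odd k give 1 + q^(4i+2), the second copy of M_2,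
  -- and even k give the factors of E_4.
  Z-double : ∀ N → Z (double N) ≋ Π₂ N ⊗ pochFin (+ 1) 4 4 N
  Z-double zero    = ≋-sym (⊗-identityˡ one)
  Z-double (suc N) = begin
    Z (double N) ⊗ (one ⊝ y (suc (double N))) ⊗ (one ⊝ y (suc (suc (double N))))
      ≈⟨ ⊗-cong (⊗-cong (Z-double N) (⊕-cong (≋-refl {one}) (⊖-cong odd))) (⊕-cong (≋-refl {one}) (⊖-cong even)) ⟩
    Π₂ N ⊗ Π₄ ⊗ (one ⊝ a) ⊗ (one ⊝ b)
      ≈⟨ solve 4 (λ x y a b → x :* y :* a :* b := x :* a :* (y :* b)) ≋-refl (Π₂ N) Π₄ (one ⊝ a) (one ⊝ b) ⟩
    Π₂ N ⊗ (one ⊝ a) ⊗ (Π₄ ⊗ (one ⊝ b)) ∎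
    where
    open ≋-Reasoning
    open FPS-Solver
    Π₄ = pochFin (+ 1) 4 4 N
    a = mono (ℤ.- + 1) (2 + 4 * N)
    b = mono (+ 1) (4 + 4 * N)
    quadruple : ∀ N → double (double N) ≡ 4 * N
    quadruple N = trans (double≡+ (double N)) (trans (cong (λ m → m + m) (double≡+ N)) (regroup N))
      where
      regroup : ∀ N → N + N + (N + N) ≡ 4 * N
      regroup = ℕ-Solver.solve-∀
    odd : y (suc (double N)) ≋ a
    odd = mono-cong (cong ℤ.-_ (ε-double N)) (cong (λ n → 2 + n) (quadruple N))
    even : y (suc (suc (double N))) ≋ b
    even = mono-cong (trans (ℤₚ.neg-involutive _) (ε-double N)) (cong (λ n → 4 + n) (quadruple N))

  Signed-product : Signed.all ⊗ (poch (ℤ.- + 1) 2 4 ⊗ poch (ℤ.- + 1) 2 4 ⊗ qq 4) ≋ poch (ℤ.- + 1) 1 2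
  Signed-product = mod⇒≋ λ
    { zero       → below λ _ ()
    ; N@(suc N′) → let open mod-Reasoning N
                       open FPS-Solver
                       -- An even index lets `Z-double` apply, and since N is positive, M is a
                       -- successor, as `S≋one` demands.
                       M = double N
                       N≤M = n≤double N
                       in begin
        Signed.all ⊗ (poch (ℤ.- + 1) 2 4 ⊗ poch (ℤ.- + 1) 2 4 ⊗ qq 4)
          ≈⟨ ⊗-mod (mod-weaken (ℕₚ.≤-trans N≤M (n≤double M)) (Signed.all-trunc (double M)))
               (⊗-mod (⊗-mod (mod-weaken N≤M (poch-trunc (ℤ.- + 1) 2 3 M)) (poch-trunc (ℤ.- + 1) 2 3 N)) (poch-trunc (+ 1) 4 3 N)) ⟩
        Signed.partsUpTo (double M) ⊗ (Π₂ M ⊗ Π₂ N ⊗ pochFin (+ 1) 4 4 N)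
          ≈⟨ ≋⇒mod (solve 4 (λ a b c d → a :* (b :* c :* d) := c :* d :* (b :* a)) ≋-refl (Signed.partsUpTo (double M)) (Π₂ M) (Π₂ N) (pochFin (+ 1) 4 4 N)) ⟩
        Π₂ N ⊗ pochFin (+ 1) 4 4 N ⊗ C M
          ≈⟨ ≋⇒mod (⊗-cong (≋-sym (Z-double N)) (≋-refl {C M})) ⟩
        Z M ⊗ C M
          ≈⟨ mod-weaken N≤M (Z-⊗-C M M) ⟩
        Π₁ (suc M) ⊗ S (suc M) M
          ≈⟨ ⊗-mod (mod-sym (mod-weaken (ℕₚ.m≤n⇒m≤1+n N≤M) (poch-trunc (ℤ.- + 1) 1 1 (suc M)))) (mod-weaken (ℕₚ.m≤n⇒m≤1+n N≤M) (S≋one (suc M) (suc (double N′)))) ⟩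
        poch (ℤ.- + 1) 1 2 ⊗ one
          ≈⟨ ≋⇒mod (⊗-identityʳ (poch (ℤ.- + 1) 1 2)) ⟩
        poch (ℤ.- + 1) 1 2 ∎
    }

open SignedProduct using (Signed-product)

-- Dilation and sections modulo 4

-- The substitution of q^4 for q, computed four degrees at a time on shifted series, so that no test
-- for divisibility by 4 is involved.
dil : FPS → FPS
dil f 0                         = f 0
dil f 1                         = + 0
dil f 2                         = + 0
dil f 3                         = + 0
dil f (suc (suc (suc (suc n)))) = dil (λ i → f (suc i)) n

dil-local : ∀ n {f g} → (∀ m → m ≤ n → f m ≡ g m) → dil f n ≡ dil g n
dil-local 0 e = e 0 z≤n
dil-local 1 e = refl
dil-local 2 e = refl
dil-local 3 e = refl
dil-local (suc (suc (suc (suc n)))) e =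
  dil-local n (λ m m≤n → e (suc m) (s≤s (ℕₚ.≤-trans m≤n (ℕₚ.m≤n+m n 3))))

dil-cong : f ≋ g → dil f ≋ dil g
dil-cong e = pointwise λ n → dil-local n (λ m _ → coeff e m)

dil-mod : ∀ {N} → f ≋ g mod N → dil f ≋ dil g mod N
dil-mod e = below λ n n<N → dil-local n (λ m m≤n → coeff< e m (ℕₚ.≤-<-trans m≤n n<N))

sect : ℕ → FPS → FPS
sect r f n = f (n * 4 + r)

sect-cong : ∀ r → f ≋ g → sect r f ≋ sect r g
sect-cong r e = pointwise λ n → coeff e (n * 4 + r)

sect-mod : ∀ {r N} → r < 4 → f ≋ g mod (N * 4) → sect r f ≋ sect r g mod N
sect-mod {r = r} {N} r<4 e = below λ n n<N → coeff< e (n * 4 + r)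
  (ℕₚ.<-≤-trans (ℕₚ.+-monoʳ-< (n * 4) r<4) (ℕₚ.≤-trans (ℕₚ.≤-reflexive (ℕₚ.+-comm (n * 4) 4)) (ℕₚ.*-monoˡ-≤ 4 n<N)))

≋-by-sections : sect 0 f ≋ sect 0 g → sect 1 f ≋ sect 1 g → sect 2 f ≋ sect 2 g → sect 3 f ≋ sect 3 g → f ≋ g
≋-by-sections {f} {g} e₀ e₁ e₂ e₃ = pointwise λ n →
  subst (λ n → f n ≡ g n) (sym (trans (m≡m%n+[m/n]*n n 4) (ℕₚ.+-comm (n % 4) (n / 4 * 4)))) (residue (n % 4) (n / 4) (m%n<n n 4))
  where
  residue : ∀ r m → r < 4 → f (m * 4 + r) ≡ g (m * 4 + r)
  residue 0 m _ = coeff e₀ m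
  residue 1 m _ = coeff e₁ m
  residue 2 m _ = coeff e₂ m
  residue 3 m _ = coeff e₃ m
  residue (suc (suc (suc (suc r)))) m (s≤s (s≤s (s≤s (s≤s ()))))

sect₀-dil : ∀ f → sect 0 (dil f) ≋ f
sect₀-dil f = pointwise (go f)
  where
  go : ∀ f n → dil f (n * 4 + 0) ≡ f n
  go f zero    = refl
  go f (suc n) = go (λ i → f (suc i)) n

sect₁-dil : ∀ f → sect 1 (dil f) ≋ 𝟎
sect₁-dil f = pointwise (go f)
  where
  go : ∀ f n → dil f (n * 4 + 1) ≡ + 0
  go f zero    = refl
  go f (suc n) = go (λ i → f (suc i)) n

sect₂-dil : ∀ f → sect 2 (dil f) ≋ 𝟎
sect₂-dil f = pointwise (go f)
  where
  go : ∀ f n → dil f (n * 4 + 2) ≡ + 0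
  go f zero    = refl
  go f (suc n) = go (λ i → f (suc i)) n

sect₃-dil : ∀ f → sect 3 (dil f) ≋ 𝟎
sect₃-dil f = pointwise (go f)
  where
  go : ∀ f n → dil f (n * 4 + 3) ≡ + 0
  go f zero    = refl
  go f (suc n) = go (λ i → f (suc i)) n

-- A series in q^4 leaves residues of exponents modulo 4 unchanged. In the induction step, four uses
-- of `⊗-suc` strip off one coefficient of `g` and three zeros.
sect-dil-⊗ : ∀ {r} → r < 4 → ∀ g f → sect r (dil g ⊗ f) ≋ g ⊗ sect r f
sect-dil-⊗ {r} r<4 g f = pointwise (go g)
  where
  open ≡-Reasoning
  drop : ∀ x a → + 0 ℤ.* x ℤ.+ a ≡ a
  drop x a = trans (cong (ℤ._+ a) (ℤₚ.*-zeroˡ x)) (ℤₚ.+-identityˡ a)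
  drop-last : ∀ x a → a ℤ.+ + 0 ℤ.* x ≡ a
  drop-last x a = trans (cong (ℤ._+_ a) (ℤₚ.*-zeroˡ x)) (ℤₚ.+-identityʳ a)
  base : ∀ r → r < 4 → ∀ g → (dil g ⊗ f) r ≡ g 0 ℤ.* f r
  base 0 _ g = refl
  base 1 _ g = drop-last (f 0) _
  base 2 _ g = trans (drop-last (f 0) _) (drop-last (f 1) _)
  base 3 _ g = trans (drop-last (f 0) _) (trans (drop-last (f 1) _) (drop-last (f 2) _))
  base (suc (suc (suc (suc r)))) (s≤s (s≤s (s≤s (s≤s ()))))
  go : ∀ g n → (dil g ⊗ f) (n * 4 + r) ≡ (g ⊗ sect r f) n
  go g zero    = base r r<4 g
  go g (suc n) = begin
    (dil g ⊗ f) (suc n * 4 + r)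
      ≡⟨ ⊗-suc (dil g) f (3 + (n * 4 + r)) ⟩
    g 0 ℤ.* f (suc n * 4 + r) ℤ.+ ((λ i → dil g (1 + i)) ⊗ f) (3 + (n * 4 + r))
      ≡⟨ cong (ℤ._+_ (g 0 ℤ.* f (suc n * 4 + r))) (trans (⊗-suc (λ i → dil g (1 + i)) f (2 + (n * 4 + r))) (trans (drop (f (3 + (n * 4 + r))) _)
           (trans (⊗-suc (λ i → dil g (2 + i)) f (1 + (n * 4 + r))) (trans (drop (f (2 + (n * 4 + r))) _)
           (trans (⊗-suc (λ i → dil g (3 + i)) f (n * 4 + r)) (drop (f (1 + (n * 4 + r))) _)))))) ⟩
    g 0 ℤ.* f (suc n * 4 + r) ℤ.+ (dil (λ i → g (suc i)) ⊗ f) (n * 4 + r)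
      ≡⟨ cong (ℤ._+_ (g 0 ℤ.* f (suc n * 4 + r))) (go (λ i → g (suc i)) n) ⟩
    g 0 ℤ.* f (suc n * 4 + r) ℤ.+ ((λ i → g (suc i)) ⊗ sect r f) n
      ≡⟨ ⊗-suc g (sect r f) n ⟨
    (g ⊗ sect r f) (suc n) ∎

dil-⊗ : ∀ f g → dil (f ⊗ g) ≋ dil f ⊗ dil g
dil-⊗ f g = ≋-by-sections
  (≋-trans (sect₀-dil (f ⊗ g)) (≋-sym (≋-trans (sect-dil-⊗ (s≤s z≤n) f (dil g)) (⊗-cong (≋-refl {f}) (sect₀-dil g)))))
  (≋-trans (sect₁-dil (f ⊗ g)) (≋-sym (≋-trans (sect-dil-⊗ (s≤s (s≤s z≤n)) f (dil g)) (≋-trans (⊗-cong (≋-refl {f}) (sect₁-dil g)) (⊗-zeroʳ f)))))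
  (≋-trans (sect₂-dil (f ⊗ g)) (≋-sym (≋-trans (sect-dil-⊗ (s≤s (s≤s (s≤s z≤n))) f (dil g)) (≋-trans (⊗-cong (≋-refl {f}) (sect₂-dil g)) (⊗-zeroʳ f)))))
  (≋-trans (sect₃-dil (f ⊗ g)) (≋-sym (≋-trans (sect-dil-⊗ (s≤s (s≤s (s≤s (s≤s z≤n)))) f (dil g)) (≋-trans (⊗-cong (≋-refl {f}) (sect₃-dil g)) (⊗-zeroʳ f)))))

dil-𝟎 : dil 𝟎 ≋ 𝟎
dil-𝟎 = ≋-by-sections (sect₀-dil 𝟎) (sect₁-dil 𝟎) (sect₂-dil 𝟎) (sect₃-dil 𝟎)

dil-one-⊝ : ∀ f → dil (one ⊝ f) ≋ one ⊝ dil f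
dil-one-⊝ f = pointwise (λ { 0 → refl ; 1 → refl ; 2 → refl ; 3 → refl ; (suc (suc (suc (suc n)))) → go n (λ i → f (suc i)) })
  where
  go : ∀ n f → dil (λ i → + 0 ℤ.- f i) n ≡ + 0 ℤ.- dil f n
  go 0 f = refl
  go 1 f = refl
  go 2 f = refl
  go 3 f = refl
  go (suc (suc (suc (suc n)))) f = go n (λ i → f (suc i))

dil-one : dil one ≋ one
dil-one = pointwise λ { 0 → refl ; 1 → refl ; 2 → refl ; 3 → refl ; (suc (suc (suc (suc n)))) → coeff dil-𝟎 n }

dil-mono : ∀ c k → dil (mono c k) ≋ mono c (k * 4)
dil-mono c k = pointwise (go k)
  where
  go : ∀ k n → dil (mono c k) n ≡ mono c (k * 4) n
  go zero    0 = refl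
  go zero    1 = refl
  go zero    2 = refl
  go zero    3 = refl
  go zero    (suc (suc (suc (suc n)))) = coeff dil-𝟎 n
  go (suc k) 0 = refl
  go (suc k) 1 = refl
  go (suc k) 2 = sym (mono-suc c (3 + k * 4) 1)
  go (suc k) 3 = sym (trans (mono-suc c (3 + k * 4) 2) (mono-suc c (2 + k * 4) 1))
  go (suc k) (suc (suc (suc (suc n)))) = begin
    dil (λ i → mono c (suc k) (suc i)) n  ≡⟨ dil-local n (λ m _ → mono-suc c k m) ⟩
    dil (mono c k) n                      ≡⟨ go k n ⟩
    mono c (k * 4) n                      ≡⟨ mono-suc c (k * 4) n ⟨
    mono c (1 + k * 4) (1 + n)            ≡⟨ mono-suc c (1 + k * 4) (1 + n) ⟨
    mono c (2 + k * 4) (2 + n)            ≡⟨ mono-suc c (2 + k * 4) (2 + n) ⟨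
    mono c (3 + k * 4) (3 + n)            ≡⟨ mono-suc c (3 + k * 4) (3 + n) ⟨
    mono c (4 + k * 4) (4 + n)            ∎
    where open ≡-Reasoning

dil-pochFin : ∀ c s d N → dil (pochFin c s d N) ≋ pochFin c (s * 4) (d * 4) N
dil-pochFin c s d zero    = dil-one
dil-pochFin c s d (suc N) = ≋-trans (dil-⊗ (pochFin c s d N) (one ⊝ mono c (s + d * N))) (⊗-cong (dil-pochFin c s d N)
  (≋-trans (dil-one-⊝ (mono c (s + d * N))) (⊕-cong (≋-refl {one}) (⊖-cong (≋-trans (dil-mono c (s + d * N)) (mono-cong refl (exponent≡ s d N)))))))
  where
  exponent≡ : ∀ s d N → (s + d * N) * 4 ≡ s * 4 + d * 4 * N
  exponent≡ = ℕ-Solver.solve-∀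

dil-poch : ∀ c s d → dil (poch c s (suc d)) ≋ poch c (s * 4) (suc d * 4)
dil-poch c s d = mod⇒≋ λ N → mod-trans (dil-mod (poch-trunc c s d N)) (mod-trans (≋⇒mod (dil-pochFin c s (suc d) N))
  (mod-sym (poch-trunc c (s * 4) (3 + d * 4) N)))

dil-pow : ∀ f k → dil (pow f k) ≋ pow (dil f) k
dil-pow f zero    = dil-one
dil-pow f (suc k) = ≋-trans (dil-⊗ f (pow f k)) (⊗-cong (≋-refl {dil f}) (dil-pow f k))

pow-cong : ∀ k → f ≋ g → pow f k ≋ pow g k
pow-cong zero    e = ≋-refl
pow-cong (suc k) e = ⊗-cong e (pow-cong k e)

mono-at : ∀ c k → mono c k k ≡ c
mono-at c zero    = refl
mono-at c (suc k) = trans (mono-suc c k k) (mono-at c k)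

mono-off : ∀ c k n → n ≢ k → mono c k n ≡ + 0
mono-off c zero    zero    n≢k = contradiction refl n≢k
mono-off c zero    (suc n) n≢k = refl
mono-off c (suc k) zero    n≢k = refl
mono-off c (suc k) (suc n) n≢k = trans (mono-suc c k n) (mono-off c k n (λ n≡k → n≢k (cong suc n≡k)))

-- A record, so that the quotient and the remainder can be inferred from a proof.
record Division (k e r : ℕ) : Set where
  constructor division
  field equation : k ≡ e * 4 + r

sect-mono : ∀ c {k e r} → Division k e r → sect r (mono c k) ≋ mono c e
sect-mono c {_} {e} {r} (division refl) = pointwise go
  where
  go : ∀ n → mono c (e * 4 + r) (n * 4 + r) ≡ mono c e n
  go n with n ≟ e
  ... | yes refl = mono-at c (e * 4 + r)
  ... | no  n≢e  = mono-off c (e * 4 + r) (n * 4 + r) (λ eq → n≢e (ℕₚ.*-cancelʳ-≡ n e 4 (ℕₚ.+-cancelʳ-≡ r (n * 4) (e * 4) eq)))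

sect-mono-𝟎 : ∀ c r {k e r′} → Division k e r′ → r % 4 ≢ r′ % 4 → sect r (mono c k) ≋ 𝟎
sect-mono-𝟎 c r {_} {e} {r′} (division refl) r≢r′ = pointwise λ n → mono-off c (e * 4 + r′) (n * 4 + r) (λ eq →
  r≢r′ (trans (sym (residue n r)) (trans (cong (_% 4) eq) (residue e r′))))
  where
  residue : ∀ n r → (n * 4 + r) % 4 ≡ r % 4
  residue n r = trans (cong (_% 4) (ℕₚ.+-comm (n * 4) r)) ([m+kn]%n≡m%n r n 4)

-- Theta series

exponent-high : ∀ a t j → exponent (a + a) (a + t) j ≡ a * (j * j) + t * j
exponent-high a t zero    = sym (cong₂ _+_ (ℕₚ.*-zeroʳ a) (ℕₚ.*-zeroʳ t))
exponent-high a t (suc j) = trans (cong (λ e → e + (a + t + (a + a) * j)) (exponent-high a t j)) (step a t j)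
  where
  step : ∀ a t j → a * (j * j) + t * j + (a + t + (a + a) * j) ≡ a * (suc j * suc j) + t * suc j
  step = ℕ-Solver.solve-∀

-- For s = a - t this is a x² + t x at x = -1-j, while `exponent-high` is its value at x = j. The
-- two together run over all integers x.
exponent-low : ∀ a s j → exponent (a + a) s (suc j) ≡ a * (j * j) + (a + s) * j + s
exponent-low a s zero    = base a s
  where
  base : ∀ a s → 0 + (s + (a + a) * 0) ≡ a * 0 + (a + s) * 0 + s
  base = ℕ-Solver.solve-∀
exponent-low a s (suc j) = trans (cong (λ e → e + (s + (a + a) * suc j)) (exponent-low a s j)) (step a s j)
  where
  step : ∀ a s j → a * (j * j) + (a + s) * j + s + (s + (a + a) * suc j) ≡ a * (suc j * suc j) + (a + s) * suc j + s
  step = ℕ-Solver.solve-∀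

sign-1 : ∀ j → sign (+ 1) j ≡ + 1
sign-1 zero    = refl
sign-1 (suc j) = trans (cong (ℤ._* + 1) (sign-1 j)) refl

sign--1 : ∀ j → sign (ℤ.- + 1) j ≡ ε j
sign--1 zero    = refl
sign--1 (suc j) = trans (cong (ℤ._* (ℤ.- + 1)) (sign--1 j)) (trans (ℤₚ.*-comm (ε j) (ℤ.- + 1)) (ℤₚ.-1*i≡-i (ε j)))

-- The triple product sets the constant term apart and pairs j with -j. Moving one half by one index
-- pairs j with -1-j and absorbs the constant; the surplus term `high N` has exponent at least N.
theta : ∀ r₁ r₂ N → let d = suc r₁ + suc r₂ in
  qq d ⊗ poch (ℤ.- + 1) (suc r₁) d ⊗ poch (ℤ.- + 1) (suc r₂) d
  ≋ ∑ N (λ j → q^ (exponent d (suc r₂) j) ⊕ q^ (exponent d (suc r₁) (suc j))) mod N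
theta r₁ r₂ N = begin
  qq d ⊗ poch (ℤ.- + 1) s₁ d ⊗ poch (ℤ.- + 1) s₂ d
    ≈⟨ JacobiTripleProduct.jacobi (ℤ.- + 1) refl r₁ r₂ N ⟩
  one ⊕ ∑ N (λ j → mono (sign (+ 1) (suc j)) (exponent d s₁ (suc j)) ⊕ mono (sign (+ 1) (suc j)) (exponent d s₂ (suc j)))
    ≈⟨ ≋⇒mod (⊕-cong (≋-refl {one}) (≋-trans (∑-cong N (λ j → ⊕-cong (mono-cong {k = exponent d s₁ (suc j)} (sign-1 (suc j)) refl) (mono-cong {k = exponent d s₂ (suc j)} (sign-1 (suc j)) refl)))
         (∑-⊕ N (λ j → low j) (λ j → high (suc j))))) ⟩
  one ⊕ (∑ N low ⊕ ∑ N (λ j → high (suc j)))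
    ≈⟨ ≋⇒mod (≋-trans (⊕-cong (≋-sym q^0) (≋-refl {∑ N low ⊕ ∑ N (λ j → high (suc j))}))
         (solve 3 (λ a b c → a :+ (b :+ c) := (a :+ c) :+ b) ≋-refl (high 0) (∑ N low) (∑ N (λ j → high (suc j))))) ⟩
  (high 0 ⊕ ∑ N (λ j → high (suc j))) ⊕ ∑ N low
    ≈⟨ ≋⇒mod (⊕-cong (≋-sym (∑-suc N high)) (≋-refl {∑ N low})) ⟩
  ∑ N high ⊕ high N ⊕ ∑ N low
    ≈⟨ ⊕-mod (⊕-mod (mod-refl {∑ N high}) (mono-𝟎-mod (j≤exponent d r₂ N))) (mod-refl {∑ N low}) ⟩
  ∑ N high ⊕ 𝟎 ⊕ ∑ N low
    ≈⟨ ≋⇒mod (≋-trans (solve 2 (λ a b → a :+ con (+ 0) :+ b := a :+ b) ≋-refl (∑ N high) (∑ N low)) (≋-sym (∑-⊕ N high low))) ⟩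
  ∑ N (λ j → high j ⊕ low j) ∎
  where
  open mod-Reasoning N
  open FPS-Solver
  s₁ = suc r₁
  s₂ = suc r₂
  d = s₁ + s₂
  high low : ℕ → FPS
  high j = q^ (exponent d s₂ j)
  low j = q^ (exponent d s₁ (suc j))

tri : ℕ → ℕ
tri zero    = 0
tri (suc k) = tri k + suc k

k≤tri : ∀ k → k ≤ tri k
k≤tri zero    = z≤n
k≤tri (suc k) = ℕₚ.m≤n+m (suc k) (tri k)

tri-double : ∀ m → tri (double m) ≡ 2 * (m * m) + m
tri-double zero    = refl
tri-double (suc m) = trans (cong₂ (λ a b → a + suc b + suc (suc b)) (tri-double m) (double≡+ m)) (step m)
  where
  step : ∀ m → 2 * (m * m) + m + suc (m + m) + suc (suc (m + m)) ≡ 2 * (suc m * suc m) + suc m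
  step = ℕ-Solver.solve-∀

Psi : ℕ → ℕ → FPS
Psi s K = ∑ K (λ k → q^ (s * tri k))

∑-double : ∀ N F → ∑ (double N) F ≋ ∑ N (λ m → F (double m) ⊕ F (suc (double m)))
∑-double zero    F = ≋-refl
∑-double (suc N) F = ≋-trans (⊕-cong (⊕-cong (∑-double N F) (≋-refl {F (double N)})) (≋-refl {F (suc (double N))}))
  (solve 3 (λ a b c → a :+ b :+ c := a :+ (b :+ c)) ≋-refl (∑ N (λ m → F (double m) ⊕ F (suc (double m)))) (F (double N)) (F (suc (double N))))
  where open FPS-Solver

Psi-stable : ∀ s {M K} → M ≤ K → Psi (suc s) K ≋ Psi (suc s) M mod M
Psi-stable s {M} {K} M≤K = subst (λ K → Psi (suc s) K ≋ Psi (suc s) M mod M) (ℕₚ.m∸n+n≡m M≤K) (go (K ∸ M))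
  where
  open FPS-Solver
  go : ∀ i → Psi (suc s) (i + M) ≋ Psi (suc s) M mod M
  go zero    = mod-refl
  go (suc i) = mod-trans (⊕-mod (go i) (mono-𝟎-mod (ℕₚ.≤-trans (ℕₚ.m≤n+m M i) (ℕₚ.≤-trans (k≤tri (i + M)) (ℕₚ.m≤m+n (tri (i + M)) (s * tri (i + M)))))))
    (≋⇒mod (solve 1 (λ a → a :+ con (+ 0) := a) ≋-refl (Psi (suc s) M)))

-- The upper half of this theta series consists of the triangular numbers of even index, the lower
-- half of those of odd index, all multiplied by s.
theta-Psi : ∀ s N → ∑ N (λ j → q^ (exponent (2 * s + 2 * s) (2 * s + s) j) ⊕ q^ (exponent (2 * s + 2 * s) s (suc j))) ≋ Psi s (double N)
theta-Psi s N = ≋-sym (≋-trans (∑-double N (λ k → q^ (s * tri k))) (∑-cong N (λ m → ⊕-cong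
  (q^-cong (trans (cong (s *_) (tri-double m)) (trans (even s m) (sym (exponent-high (2 * s) s m)))))
  (q^-cong (trans (cong₂ (λ a b → s * (a + suc b)) (tri-double m) (double≡+ m)) (trans (odd s m) (sym (exponent-low (2 * s) s m))))))))
  where
  even : ∀ s m → s * (2 * (m * m) + m) ≡ 2 * s * (m * m) + s * m
  even = ℕ-Solver.solve-∀
  odd : ∀ s m → s * (2 * (m * m) + m + suc (m + m)) ≡ 2 * s * (m * m) + (2 * s + s) * m + s
  odd = ℕ-Solver.solve-∀

ψ₁ ψ₁₆ : FPS
ψ₁ = qq 4 ⊗ poch (ℤ.- + 1) 1 4 ⊗ poch (ℤ.- + 1) 3 4
ψ₁₆ = qq 64 ⊗ poch (ℤ.- + 1) 16 64 ⊗ poch (ℤ.- + 1) 48 64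

ψ₁≋Psi : ∀ {N K} → N ≤ K → ψ₁ ≋ Psi 1 K mod N
ψ₁≋Psi {N} {K} N≤K = mod-trans (theta 0 2 N) (mod-trans (≋⇒mod (theta-Psi 1 N)) (mod-trans (Psi-stable 0 (n≤double N)) (mod-sym (Psi-stable 0 N≤K))))

ψ₁₆≋Psi : ∀ N → ψ₁₆ ≋ Psi 16 N mod N
ψ₁₆≋Psi N = mod-trans (theta 15 47 N) (mod-trans (≋⇒mod (theta-Psi 16 N)) (Psi-stable 15 (n≤double N)))

φ₊ φ₋ : FPS
φ₊ = qq 4 ⊗ poch (ℤ.- + 1) 2 4 ⊗ poch (ℤ.- + 1) 2 4
φ₋ = qq 4 ⊗ poch (+ 1) 2 4 ⊗ poch (+ 1) 2 4

-- In the difference of Σ q^(2n²) and Σ (-1)^n q^(2n²) the even n cancel and the odd n double. The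
-- signs of n give another factor 2, and n = 2m+1 gives 2n² = 2 + 16 m(m+1)/2.
φ₊⊝φ₋ : φ₊ ⊝ φ₋ ≋ const (+ 4) ⊗ q^ 2 ⊗ ψ₁₆
φ₊⊝φ₋ = mod⇒≋ difference
  where
  open FPS-Solver
  x : ℕ → FPS
  x j = q^ (exponent 4 2 (suc j))
  x₋ : ℕ → FPS
  x₋ j = mono (ε (suc j)) (exponent 4 2 (suc j))
  D : ℕ → FPS
  D j = (x j ⊕ x j) ⊝ (x₋ j ⊕ x₋ j)
  plus : ∀ N → φ₊ ≋ one ⊕ ∑ N (λ j → x j ⊕ x j) mod N
  plus N = mod-trans (JacobiTripleProduct.jacobi (ℤ.- + 1) refl 1 1 N) (≋⇒mod (⊕-cong (≋-refl {one}) (∑-cong N (λ j →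
    ⊕-cong (mono-cong {k = exponent 4 2 (suc j)} (sign-1 (suc j)) refl) (mono-cong {k = exponent 4 2 (suc j)} (sign-1 (suc j)) refl)))))
  minus : ∀ N → φ₋ ≋ one ⊕ ∑ N (λ j → x₋ j ⊕ x₋ j) mod N
  minus N = mod-trans (JacobiTripleProduct.jacobi (+ 1) refl 1 1 N) (≋⇒mod (⊕-cong (≋-refl {one}) (∑-cong N (λ j →
    ⊕-cong (mono-cong {k = exponent 4 2 (suc j)} (sign--1 (suc j)) refl) (mono-cong {k = exponent 4 2 (suc j)} (sign--1 (suc j)) refl)))))
  collect : ∀ N → one ⊕ ∑ N (λ j → x j ⊕ x j) ≋ one ⊕ ∑ N (λ j → x₋ j ⊕ x₋ j) ⊕ ∑ N D
  collect N = ≋-trans (⊕-cong (≋-refl {one}) (≋-trans (∑-cong N (λ j →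
      solve 2 (λ a b → a := b :+ (a :- b)) ≋-refl (x j ⊕ x j) (x₋ j ⊕ x₋ j))) (∑-⊕ N (λ j → x₋ j ⊕ x₋ j) D)))
    (solve 2 (λ a b → con (+ 1) :+ (a :+ b) := con (+ 1) :+ a :+ b) ≋-refl (∑ N (λ j → x₋ j ⊕ x₋ j)) (∑ N D))
  exponent≡ : ∀ m → exponent 4 2 (suc (double m)) ≡ 2 + 16 * tri m
  exponent≡ m = trans (exponent-high 2 0 (suc (double m))) (trans (cong (λ k → 2 * (suc k * suc k) + 0) (double≡+ m)) (go m))
    where
    square : ∀ m → 2 * (suc (m + m) * suc (m + m)) + 0 ≡ 2 + 8 * (m * m + m)
    square = ℕ-Solver.solve-∀
    2tri : ∀ m → m * m + m ≡ 2 * tri m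
    2tri zero    = refl
    2tri (suc m) = trans (expand m) (trans (cong (λ e → e + 2 * suc m) (2tri m)) (sym (ℕₚ.*-distribˡ-+ 2 (tri m) (suc m))))
      where
      expand : ∀ m → suc m * suc m + suc m ≡ m * m + m + 2 * suc m
      expand = ℕ-Solver.solve-∀
    go : ∀ m → 2 * (suc (m + m) * suc (m + m)) + 0 ≡ 2 + 16 * tri m
    go m = trans (square m) (cong (λ e → 2 + e) (trans (cong (8 *_) (2tri m)) (sym (ℕₚ.*-assoc 8 2 (tri m)))))
  pair : ∀ m → D (double m) ⊕ D (suc (double m)) ≋ const (+ 4) ⊗ q^ 2 ⊗ q^ (16 * tri m)
  pair m = begin
    D (double m) ⊕ D (suc (double m))
      ≈⟨ ⊕-cong (⊕-cong (≋-refl {x₀ ⊕ x₀}) (⊖-cong (⊕-cong odd odd))) (⊕-cong (≋-refl {x₁ ⊕ x₁}) (⊖-cong (⊕-cong even even))) ⟩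
    ((x₀ ⊕ x₀) ⊝ (⊖ x₀ ⊕ ⊖ x₀)) ⊕ ((x₁ ⊕ x₁) ⊝ (x₁ ⊕ x₁))
      ≈⟨ solve 2 (λ a b → ((a :+ a) :- (:- a :+ :- a)) :+ ((b :+ b) :- (b :+ b)) := con (+ 4) :* a) ≋-refl x₀ x₁ ⟩
    const (+ 4) ⊗ x₀
      ≈⟨ ⊗-cong (≋-refl {const (+ 4)}) (≋-trans (q^-cong (exponent≡ m)) (≋-sym (q^-⊗ 2 (16 * tri m)))) ⟩
    const (+ 4) ⊗ (q^ 2 ⊗ q^ (16 * tri m))
      ≈⟨ ⊗-assoc (const (+ 4)) (q^ 2) (q^ (16 * tri m)) ⟨
    const (+ 4) ⊗ q^ 2 ⊗ q^ (16 * tri m) ∎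
    where
    open ≋-Reasoning
    x₀ = x (double m)
    x₁ = x (suc (double m))
    odd : x₋ (double m) ≋ ⊖ x₀
    odd = ≋-trans (mono-cong {k = exponent 4 2 (suc (double m))} (cong ℤ.-_ (ε-double m)) refl) (≋-sym (⊖-mono (+ 1) (exponent 4 2 (suc (double m)))))
    even : x₋ (suc (double m)) ≋ x₁
    even = mono-cong {k = exponent 4 2 (suc (suc (double m)))} (ε-double (suc m)) refl
  difference : ∀ N → φ₊ ⊝ φ₋ ≋ const (+ 4) ⊗ q^ 2 ⊗ ψ₁₆ mod N
  difference N = begin
    φ₊ ⊝ φ₋
      ≈⟨ ⊕-mod (mod-weaken (n≤double N) (mod-trans (plus (double N)) (≋⇒mod (collect (double N)))))
           (below λ m m<N → cong ℤ.-_ (coeff< (mod-weaken (n≤double N) (minus (double N))) m m<N)) ⟩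
    θ₋ ⊕ ∑ (double N) D ⊝ θ₋
      ≈⟨ ≋⇒mod (solve 2 (λ a b → a :+ b :- a := b) ≋-refl θ₋ (∑ (double N) D)) ⟩
    ∑ (double N) D
      ≈⟨ ≋⇒mod (≋-trans (∑-double N D) (≋-trans (∑-cong N pair) (≋-sym (∑-⊗ N (const (+ 4) ⊗ q^ 2) (λ m → q^ (16 * tri m)))))) ⟩
    const (+ 4) ⊗ q^ 2 ⊗ Psi 16 N
      ≈⟨ ⊗-mod (mod-refl {const (+ 4) ⊗ q^ 2}) (mod-sym (ψ₁₆≋Psi N)) ⟩
    const (+ 4) ⊗ q^ 2 ⊗ ψ₁₆ ∎
    where
    open mod-Reasoning N
    θ₋ = one ⊕ ∑ (double N) (λ j → x₋ j ⊕ x₋ j)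

-- The generating function of u and its dissection

E₁ E₂ E₄ E₈ E₁₆ E₃₂ E₆₄ O₁ O₂ O₁₆ O₃₂ M₁ M₂ M₁₆ : FPS
E₁ = qq 1
E₂ = qq 2
E₄ = qq 4
E₈ = qq 8
E₁₆ = qq 16
E₃₂ = qq 32
E₆₄ = qq 64
O₁ = poch (+ 1) 1 2
O₂ = poch (+ 1) 2 4
O₁₆ = poch (+ 1) 16 32
O₃₂ = poch (+ 1) 32 64
M₁ = poch (ℤ.- + 1) 1 2
M₂ = poch (ℤ.- + 1) 2 4
M₁₆ = poch (ℤ.- + 1) 16 32

-- It turns Euler's product P E_1 = 1 into P φ₋ = M_1, the exact counterpart of the signed formula F
-- φ₊ = M_1.
M₁⊗E₁ : M₁ ⊗ E₁ ≋ φ₋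
M₁⊗E₁ = begin
  M₁ ⊗ E₁                    ≈⟨ ⊗-cong (≋-refl {M₁}) (≋-trans (poch-split (+ 1) 1 0) (⊗-cong (≋-refl {O₁}) (poch-split (+ 1) 2 1))) ⟩
  M₁ ⊗ (O₁ ⊗ (O₂ ⊗ E₄))      ≈⟨ solve 4 (λ m a b e → m :* (a :* (b :* e)) := e :* b :* (a :* m)) ≋-refl M₁ O₁ O₂ E₄ ⟩
  E₄ ⊗ O₂ ⊗ (O₁ ⊗ M₁)        ≈⟨ ⊗-cong (≋-refl {E₄ ⊗ O₂}) (poch-± 1 1) ⟩
  E₄ ⊗ O₂ ⊗ O₂               ∎
  where
  open ≋-Reasoning
  open FPS-Solver

-- Gauss's product ψ(q) = E_2²/E_1, taken at q^16.
ψ₁₆⊗E₁₆ : ψ₁₆ ⊗ E₁₆ ≋ E₃₂ ⊗ E₃₂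
ψ₁₆⊗E₁₆ = begin
  E₆₄ ⊗ a ⊗ b ⊗ E₁₆            ≈⟨ ⊗-cong (≋-trans (⊗-assoc E₆₄ a b) (⊗-cong (≋-refl {E₆₄}) (≋-sym (poch-split (ℤ.- + 1) 16 31)))) (poch-split (+ 1) 16 15) ⟩
  E₆₄ ⊗ M₁₆ ⊗ (O₁₆ ⊗ E₃₂)      ≈⟨ solve 4 (λ e m a b → e :* m :* (a :* b) := (a :* m) :* e :* b) ≋-refl E₆₄ M₁₆ O₁₆ E₃₂ ⟩
  O₁₆ ⊗ M₁₆ ⊗ E₆₄ ⊗ E₃₂        ≈⟨ ⊗-cong (⊗-cong (poch-± 16 31) (≋-refl {E₆₄})) (≋-refl {E₃₂}) ⟩
  O₃₂ ⊗ E₆₄ ⊗ E₃₂              ≈⟨ ⊗-cong (≋-sym (poch-split (+ 1) 32 31)) (≋-refl {E₃₂}) ⟩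
  E₃₂ ⊗ E₃₂                    ∎
  where
  open ≋-Reasoning
  open FPS-Solver
  a = poch (ℤ.- + 1) 16 64
  b = poch (ℤ.- + 1) 48 64

ψ₁≋M₁⊗E₄ : ψ₁ ≋ M₁ ⊗ E₄
ψ₁≋M₁⊗E₄ = ≋-trans (⊗-assoc E₄ (poch (ℤ.- + 1) 1 4) (poch (ℤ.- + 1) 3 4))
  (≋-trans (⊗-cong (≋-refl {E₄}) (≋-sym (poch-split (ℤ.- + 1) 1 1))) (⊗-comm E₄ M₁))

const-cancel-2 : const (+ 2) ⊗ f ≋ const (+ 2) ⊗ g → f ≋ g
const-cancel-2 {f} {g} e = pointwise λ n → ℤₚ.*-cancelˡ-≡ (+ 2) (f n) (g n)
  (trans (sym (const-⊗ (+ 2) f n)) (trans (coeff e n) (const-⊗ (+ 2) g n)))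

-- Both enumerations are M_1 divided by a theta function. Over the common denominator their
-- difference is M_1 times a difference of theta functions; the 4 found there becomes 2 because P -
-- F is 2u.
u-φ : u ⊗ (φ₊ ⊗ φ₋) ≋ const (+ 2) ⊗ q^ 2 ⊗ M₁ ⊗ ψ₁₆
u-φ = const-cancel-2 (begin
  const (+ 2) ⊗ (u ⊗ (φ₊ ⊗ φ₋))
    ≈⟨ ⊗-assoc (const (+ 2)) u (φ₊ ⊗ φ₋) ⟨
  const (+ 2) ⊗ u ⊗ (φ₊ ⊗ φ₋)
    ≈⟨ ⊗-cong (pointwise λ n → trans (const-⊗ (+ 2) u n) (u-formula n)) (≋-refl {φ₊ ⊗ φ₋}) ⟩
  (P ⊝ F) ⊗ (φ₊ ⊗ φ₋)
    ≈⟨ solve 4 (λ P F a b → (P :- F) :* (a :* b) := P :* b :* a :- F :* a :* b) ≋-refl P F φ₊ φ₋ ⟩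
  P ⊗ φ₋ ⊗ φ₊ ⊝ F ⊗ φ₊ ⊗ φ₋
    ≈⟨ ⊕-cong (⊗-cong P⊗φ₋ (≋-refl {φ₊})) (⊖-cong (⊗-cong F⊗φ₊ (≋-refl {φ₋}))) ⟩
  M₁ ⊗ φ₊ ⊝ M₁ ⊗ φ₋
    ≈⟨ solve 3 (λ m a b → m :* a :- m :* b := m :* (a :- b)) ≋-refl M₁ φ₊ φ₋ ⟩
  M₁ ⊗ (φ₊ ⊝ φ₋)
    ≈⟨ ⊗-cong (≋-refl {M₁}) φ₊⊝φ₋ ⟩
  M₁ ⊗ (const (+ 4) ⊗ q^ 2 ⊗ ψ₁₆)
    ≈⟨ solve 3 (λ m x p → m :* (con (+ 4) :* x :* p) := con (+ 2) :* (con (+ 2) :* x :* m :* p)) ≋-refl M₁ (q^ 2) ψ₁₆ ⟩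
  const (+ 2) ⊗ (const (+ 2) ⊗ q^ 2 ⊗ M₁ ⊗ ψ₁₆) ∎)
  where
  open ≋-Reasoning
  open FPS-Solver
  P = Unsigned.all
  F = Signed.all
  F⊗φ₊ : F ⊗ φ₊ ≋ M₁
  F⊗φ₊ = ≋-trans (⊗-cong (≋-refl {F}) (solve 2 (λ e m → e :* m :* m := m :* m :* e) ≋-refl E₄ M₂)) Signed-product
  P⊗φ₋ : P ⊗ φ₋ ≋ M₁
  P⊗φ₋ = begin
    P ⊗ φ₋           ≈⟨ ⊗-cong (≋-refl {P}) M₁⊗E₁ ⟨
    P ⊗ (M₁ ⊗ E₁)    ≈⟨ solve 3 (λ p m e → p :* (m :* e) := p :* e :* m) ≋-refl P M₁ E₁ ⟩
    P ⊗ E₁ ⊗ M₁      ≈⟨ ⊗-cong Unsigned-⊗-qq (≋-refl {M₁}) ⟩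
    one ⊗ M₁         ≈⟨ ⊗-identityˡ M₁ ⟩
    M₁               ∎

-- The classical φ(q)φ(-q) = φ(-q²)² at q², in terms of Euler products.
φ₊⊗φ₋ : φ₊ ⊗ φ₋ ⊗ (E₈ ⊗ E₈) ≋ E₄ ⊗ E₄ ⊗ (E₄ ⊗ E₄)
φ₊⊗φ₋ = begin
  φ₊ ⊗ φ₋ ⊗ (E₈ ⊗ E₈)
    ≈⟨ solve 4 (λ e m o x → e :* m :* m :* (e :* o :* o) :* (x :* x) := e :* e :* (o :* m :* x :* (o :* m :* x))) ≋-refl E₄ M₂ O₂ E₈ ⟩
  E₄ ⊗ E₄ ⊗ (O₂ ⊗ M₂ ⊗ E₈ ⊗ (O₂ ⊗ M₂ ⊗ E₈))
    ≈⟨ ⊗-cong (≋-refl {E₄ ⊗ E₄}) (⊗-cong E₄≋ E₄≋) ⟩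
  E₄ ⊗ E₄ ⊗ (E₄ ⊗ E₄) ∎
  where
  open ≋-Reasoning
  open FPS-Solver
  E₄≋ : O₂ ⊗ M₂ ⊗ E₈ ≋ E₄
  E₄≋ = ≋-trans (⊗-cong (poch-± 2 3) (≋-refl {E₈})) (≋-sym (poch-split (+ 1) 4 3))

-- The denominator of V(q^4).
denominator : FPS
denominator = pow E₄ 5 ⊗ E₁₆

u-denominator : denominator ⊗ u ≋ const (+ 2) ⊗ q^ 2 ⊗ ψ₁ ⊗ (E₈ ⊗ E₈ ⊗ (E₃₂ ⊗ E₃₂))
u-denominator = begin
  pow E₄ 5 ⊗ E₁₆ ⊗ u
    ≈⟨ solve 3 (λ e x u → e :* (e :* (e :* (e :* (e :* con (+ 1))))) :* x :* u := e :* e :* (e :* e) :* u :* e :* x) ≋-refl E₄ E₁₆ u ⟩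
  E₄ ⊗ E₄ ⊗ (E₄ ⊗ E₄) ⊗ u ⊗ E₄ ⊗ E₁₆
    ≈⟨ ⊗-cong (⊗-cong (⊗-cong (≋-sym φ₊⊗φ₋) (≋-refl {u})) (≋-refl {E₄})) (≋-refl {E₁₆}) ⟩
  φ₊ ⊗ φ₋ ⊗ (E₈ ⊗ E₈) ⊗ u ⊗ E₄ ⊗ E₁₆
    ≈⟨ solve 5 (λ φ x u e y → φ :* x :* u :* e :* y := u :* φ :* x :* e :* y) ≋-refl (φ₊ ⊗ φ₋) (E₈ ⊗ E₈) u E₄ E₁₆ ⟩
  u ⊗ (φ₊ ⊗ φ₋) ⊗ (E₈ ⊗ E₈) ⊗ E₄ ⊗ E₁₆
    ≈⟨ ⊗-cong (⊗-cong (⊗-cong u-φ (≋-refl {E₈ ⊗ E₈})) (≋-refl {E₄})) (≋-refl {E₁₆}) ⟩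
  const (+ 2) ⊗ q^ 2 ⊗ M₁ ⊗ ψ₁₆ ⊗ (E₈ ⊗ E₈) ⊗ E₄ ⊗ E₁₆
    ≈⟨ solve 6 (λ q m p x e y → q :* m :* p :* x :* e :* y := q :* (m :* e) :* (x :* (p :* y))) ≋-refl (const (+ 2) ⊗ q^ 2) M₁ ψ₁₆ (E₈ ⊗ E₈) E₄ E₁₆ ⟩
  const (+ 2) ⊗ q^ 2 ⊗ (M₁ ⊗ E₄) ⊗ (E₈ ⊗ E₈ ⊗ (ψ₁₆ ⊗ E₁₆))
    ≈⟨ ⊗-cong (⊗-cong (≋-refl {const (+ 2) ⊗ q^ 2}) (≋-sym ψ₁≋M₁⊗E₄)) (⊗-cong (≋-refl {E₈ ⊗ E₈}) ψ₁₆⊗E₁₆) ⟩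
  const (+ 2) ⊗ q^ 2 ⊗ ψ₁ ⊗ (E₈ ⊗ E₈ ⊗ (E₃₂ ⊗ E₃₂)) ∎
  where
  open ≋-Reasoning
  open FPS-Solver

dil-V : denominator ⊗ dil V ≋ E₈ ⊗ E₈ ⊗ (E₃₂ ⊗ E₃₂)
dil-V = begin
  denominator ⊗ dil V
    ≈⟨ ⊗-cong (≋-sym dil-denominator) (≋-refl {dil V}) ⟩
  dil (pow E₁ 5 ⊗ E₄) ⊗ dil V
    ≈⟨ dil-⊗ (pow E₁ 5 ⊗ E₄) V ⟨
  dil ((pow E₁ 5 ⊗ E₄) ⊗ (pow E₂ 2 ⊗ pow E₈ 2 ⊗ inv (pow E₁ 5 ⊗ E₄)))
    ≈⟨ dil-cong (solve 3 (λ d n i → d :* (n :* i) := d :* i :* n) ≋-refl (pow E₁ 5 ⊗ E₄) (pow E₂ 2 ⊗ pow E₈ 2) (inv (pow E₁ 5 ⊗ E₄))) ⟩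
  dil ((pow E₁ 5 ⊗ E₄) ⊗ inv (pow E₁ 5 ⊗ E₄) ⊗ (pow E₂ 2 ⊗ pow E₈ 2))
    ≈⟨ dil-cong (≋-trans (⊗-cong (⊗-inv (pow E₁ 5 ⊗ E₄) refl) (≋-refl {pow E₂ 2 ⊗ pow E₈ 2})) (⊗-identityˡ (pow E₂ 2 ⊗ pow E₈ 2))) ⟩
  dil (pow E₂ 2 ⊗ pow E₈ 2)
    ≈⟨ ≋-trans (dil-⊗ (pow E₂ 2) (pow E₈ 2)) (⊗-cong (≋-trans (dil-pow E₂ 2) (pow-cong 2 (dil-poch (+ 1) 2 1)))
                                                     (≋-trans (dil-pow E₈ 2) (pow-cong 2 (dil-poch (+ 1) 8 7)))) ⟩
  pow E₈ 2 ⊗ pow E₃₂ 2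
    ≈⟨ solve 2 (λ a b → a :* (a :* con (+ 1)) :* (b :* (b :* con (+ 1))) := a :* a :* (b :* b)) ≋-refl E₈ E₃₂ ⟩
  E₈ ⊗ E₈ ⊗ (E₃₂ ⊗ E₃₂) ∎
  where
  open ≋-Reasoning
  open FPS-Solver
  dil-denominator : dil (pow E₁ 5 ⊗ E₄) ≋ denominator
  dil-denominator = ≋-trans (dil-⊗ (pow E₁ 5) E₄) (⊗-cong (≋-trans (dil-pow E₁ 5) (pow-cong 5 (dil-poch (+ 1) 1 0))) (dil-poch (+ 1) 4 3))

u-product : u ≋ dil V ⊗ (mono (+ 2) 2 ⊗ ψ₁)
u-product = ⊗-cancelˡ denominator refl (begin
  denominator ⊗ u
    ≈⟨ u-denominator ⟩
  const (+ 2) ⊗ q^ 2 ⊗ ψ₁ ⊗ (E₈ ⊗ E₈ ⊗ (E₃₂ ⊗ E₃₂))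
    ≈⟨ ⊗-cong (⊗-cong 2q² (≋-refl {ψ₁})) (≋-sym dil-V) ⟩
  mono (+ 2) 2 ⊗ ψ₁ ⊗ (denominator ⊗ dil V)
    ≈⟨ solve 3 (λ a b c → a :* (b :* c) := b :* (c :* a)) ≋-refl (mono (+ 2) 2 ⊗ ψ₁) denominator (dil V) ⟩
  denominator ⊗ (dil V ⊗ (mono (+ 2) 2 ⊗ ψ₁)) ∎)
  where
  open ≋-Reasoning
  open FPS-Solver
  2q² : const (+ 2) ⊗ q^ 2 ≋ mono (+ 2) 2
  2q² = ≋-trans (⊗-cong (≋-sym (mono-zero (+ 2))) (≋-refl {q^ 2})) (mono-⊗ (+ 2) 0 (+ 1) 2)

∑-octuple : ∀ N F → ∑ (N * 8) F ≋ ∑ N (λ m → F (m * 8) ⊕ F (1 + m * 8) ⊕ F (2 + m * 8) ⊕ F (3 + m * 8) ⊕ F (4 + m * 8) ⊕ F (5 + m * 8) ⊕ F (6 + m * 8) ⊕ F (7 + m * 8))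
∑-octuple zero    F = ≋-refl
∑-octuple (suc N) F = ≋-trans
  (⊕-cong (⊕-cong (⊕-cong (⊕-cong (⊕-cong (⊕-cong (⊕-cong (⊕-cong (∑-octuple N F) (≋-refl {F (N * 8)})) (≋-refl {F (1 + N * 8)})) (≋-refl {F (2 + N * 8)}))
    (≋-refl {F (3 + N * 8)})) (≋-refl {F (4 + N * 8)})) (≋-refl {F (5 + N * 8)})) (≋-refl {F (6 + N * 8)})) (≋-refl {F (7 + N * 8)}))
  (solve 9 (λ s a b c d e f g h → s :+ a :+ b :+ c :+ d :+ e :+ f :+ g :+ h := s :+ (a :+ b :+ c :+ d :+ e :+ f :+ g :+ h)) ≋-refl
    (∑ N (λ m → F (m * 8) ⊕ F (1 + m * 8) ⊕ F (2 + m * 8) ⊕ F (3 + m * 8) ⊕ F (4 + m * 8) ⊕ F (5 + m * 8) ⊕ F (6 + m * 8) ⊕ F (7 + m * 8)))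
    (F (N * 8)) (F (1 + N * 8)) (F (2 + N * 8)) (F (3 + N * 8)) (F (4 + N * 8)) (F (5 + N * 8)) (F (6 + N * 8)) (F (7 + N * 8)))
  where open FPS-Solver

sect-∑ : ∀ r N F → sect r (∑ N F) ≋ ∑ N (λ m → sect r (F m))
sect-∑ r zero    F = ≋-refl
sect-∑ r (suc N) F = ⊕-cong (sect-∑ r N F) (≋-refl {sect r (F N)})

tri-octuple : ∀ m → tri (m * 8) ≡ (8 * (m * m) + m) * 4
tri-octuple zero    = refl
tri-octuple (suc m) = trans (cong (λ x → x + (1 + m * 8) + (2 + m * 8) + (3 + m * 8) + (4 + m * 8) + (5 + m * 8) + (6 + m * 8) + (7 + m * 8) + (8 + m * 8)) (tri-octuple m)) (step m)
  where
  step : ∀ m → (8 * (m * m) + m) * 4 + (1 + m * 8) + (2 + m * 8) + (3 + m * 8) + (4 + m * 8) + (5 + m * 8) + (6 + m * 8) + (7 + m * 8) + (8 + m * 8)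
         ≡ (8 * (suc m * suc m) + suc m) * 4
  step = ℕ-Solver.solve-∀

private
  -- Since tri(-1-k) = tri(k), the classes i and 7-i of k modulo 8 yield the same residue modulo 4,
  -- one as the upper and one as the lower half of a theta series of period 16. The quotients are
  -- written so as to match `exponent-high` and `exponent-low`, with the power of q in front of the
  -- product split off.
  2+tri₀ : ∀ m → Division (2 + tri (m * 8)) (8 * (m * m) + 1 * m) 2
  2+tri₀ m = division (trans (cong (λ x → 2 + x) (tri-octuple m)) (go m))
    where
    go : ∀ m → 2 + (8 * (m * m) + m) * 4 ≡ (8 * (m * m) + 1 * m) * 4 + 2
    go = ℕ-Solver.solve-∀

  2+tri₁ : ∀ m → Division (2 + tri (1 + m * 8)) (8 * (m * m) + 3 * m) 3
  2+tri₁ m = division (trans (cong (λ x → x + (1 + m * 8)) (Division.equation (2+tri₀ m))) (go m))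
    where
    go : ∀ m → (8 * (m * m) + 1 * m) * 4 + 2 + (1 + m * 8) ≡ (8 * (m * m) + 3 * m) * 4 + 3
    go = ℕ-Solver.solve-∀

  2+tri₂ : ∀ m → Division (2 + tri (2 + m * 8)) (1 + (8 * (m * m) + 5 * m)) 1
  2+tri₂ m = division (trans (cong (λ x → x + (2 + m * 8)) (Division.equation (2+tri₁ m))) (go m))
    where
    go : ∀ m → (8 * (m * m) + 3 * m) * 4 + 3 + (2 + m * 8) ≡ (1 + (8 * (m * m) + 5 * m)) * 4 + 1
    go = ℕ-Solver.solve-∀

  2+tri₃ : ∀ m → Division (2 + tri (3 + m * 8)) (2 + (8 * (m * m) + 7 * m)) 0
  2+tri₃ m = division (trans (cong (λ x → x + (3 + m * 8)) (Division.equation (2+tri₂ m))) (go m))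
    where
    go : ∀ m → (1 + (8 * (m * m) + 5 * m)) * 4 + 1 + (3 + m * 8) ≡ (2 + (8 * (m * m) + 7 * m)) * 4 + 0
    go = ℕ-Solver.solve-∀

  2+tri₄ : ∀ m → Division (2 + tri (4 + m * 8)) (2 + (8 * (m * m) + 9 * m + 1)) 0
  2+tri₄ m = division (trans (cong (λ x → x + (4 + m * 8)) (Division.equation (2+tri₃ m))) (go m))
    where
    go : ∀ m → (2 + (8 * (m * m) + 7 * m)) * 4 + 0 + (4 + m * 8) ≡ (2 + (8 * (m * m) + 9 * m + 1)) * 4 + 0
    go = ℕ-Solver.solve-∀

  2+tri₅ : ∀ m → Division (2 + tri (5 + m * 8)) (1 + (8 * (m * m) + 11 * m + 3)) 1
  2+tri₅ m = division (trans (cong (λ x → x + (5 + m * 8)) (Division.equation (2+tri₄ m))) (go m))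
    where
    go : ∀ m → (2 + (8 * (m * m) + 9 * m + 1)) * 4 + 0 + (5 + m * 8) ≡ (1 + (8 * (m * m) + 11 * m + 3)) * 4 + 1
    go = ℕ-Solver.solve-∀

  2+tri₆ : ∀ m → Division (2 + tri (6 + m * 8)) (8 * (m * m) + 13 * m + 5) 3
  2+tri₆ m = division (trans (cong (λ x → x + (6 + m * 8)) (Division.equation (2+tri₅ m))) (go m))
    where
    go : ∀ m → (1 + (8 * (m * m) + 11 * m + 3)) * 4 + 1 + (6 + m * 8) ≡ (8 * (m * m) + 13 * m + 5) * 4 + 3
    go = ℕ-Solver.solve-∀

  2+tri₇ : ∀ m → Division (2 + tri (7 + m * 8)) (8 * (m * m) + 15 * m + 7) 2
  2+tri₇ m = division (trans (cong (λ x → x + (7 + m * 8)) (Division.equation (2+tri₆ m))) (go m))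
    where
    go : ∀ m → (8 * (m * m) + 13 * m + 5) * 4 + 3 + (7 + m * 8) ≡ (8 * (m * m) + 15 * m + 7) * 4 + 2
    go = ℕ-Solver.solve-∀

summand : ℕ → FPS
summand k = mono (+ 2) (2 + tri k)

octuple : ℕ → FPS
octuple m = summand (m * 8) ⊕ summand (1 + m * 8) ⊕ summand (2 + m * 8) ⊕ summand (3 + m * 8)
  ⊕ summand (4 + m * 8) ⊕ summand (5 + m * 8) ⊕ summand (6 + m * 8) ⊕ summand (7 + m * 8)

-- Precision 4N is what a section known modulo q^N costs; it is available from 8N terms because tri
-- k ≥ k.
2q²⊗ψ₁ : ∀ N → mono (+ 2) 2 ⊗ ψ₁ ≋ ∑ N octuple mod (N * 4)
2q²⊗ψ₁ N = begin
  mono (+ 2) 2 ⊗ ψ₁            ≈⟨ ⊗-mod (mod-refl {mono (+ 2) 2}) (ψ₁≋Psi (ℕₚ.*-monoʳ-≤ N {4} {8} (s≤s (s≤s (s≤s (s≤s z≤n)))))) ⟩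
  mono (+ 2) 2 ⊗ Psi 1 (N * 8) ≈⟨ ≋⇒mod (≋-trans (∑-⊗ (N * 8) (mono (+ 2) 2) (λ k → q^ (1 * tri k))) (∑-cong (N * 8) (λ k →
                                    ≋-trans (mono-⊗ (+ 2) 2 (+ 1) (1 * tri k)) (mono-cong refl (cong (λ x → 2 + x) (ℕₚ.*-identityˡ (tri k))))))) ⟩
  ∑ (N * 8) summand            ≈⟨ ≋⇒mod (∑-octuple N summand) ⟩
  ∑ N octuple                  ∎
  where open mod-Reasoning (N * 4)

-- All that depends on the residue is `block`: of eight consecutive terms two survive, and they are
-- the j-th terms of the two halves of a theta series shifted by q^e, which `theta` sums back into a
-- product.
dissect : ∀ {r} e r₁ r₂ → r < 4 → let d = suc r₁ + suc r₂ in
  (∀ m → sect r (octuple m) ≋ mono (+ 2) (e + exponent d (suc r₂) m) ⊕ mono (+ 2) (e + exponent d (suc r₁) (suc m))) →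
  sect r (mono (+ 2) 2 ⊗ ψ₁) ≋ mono (+ 2) e ⊗ (qq d ⊗ poch (ℤ.- + 1) (suc r₁) d ⊗ poch (ℤ.- + 1) (suc r₂) d)
dissect {r} e r₁ r₂ r<4 block = mod⇒≋ λ N → let open mod-Reasoning N in begin
  sect r (mono (+ 2) 2 ⊗ ψ₁)
    ≈⟨ sect-mod r<4 (2q²⊗ψ₁ N) ⟩
  sect r (∑ N octuple)
    ≈⟨ ≋⇒mod (≋-trans (sect-∑ r N octuple) (∑-cong N (λ m → ≋-trans (block m) (factor m)))) ⟩
  ∑ N (λ m → mono (+ 2) e ⊗ (high m ⊕ low m))
    ≈⟨ ≋⇒mod (∑-⊗ N (mono (+ 2) e) (λ m → high m ⊕ low m)) ⟨
  mono (+ 2) e ⊗ ∑ N (λ m → high m ⊕ low m)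
    ≈⟨ ⊗-mod (mod-refl {mono (+ 2) e}) (theta r₁ r₂ N) ⟨
  mono (+ 2) e ⊗ (qq d ⊗ poch (ℤ.- + 1) (suc r₁) d ⊗ poch (ℤ.- + 1) (suc r₂) d) ∎
  where
  open FPS-Solver
  d = suc r₁ + suc r₂
  high low : ℕ → FPS
  high j = q^ (exponent d (suc r₂) j)
  low j = q^ (exponent d (suc r₁) (suc j))
  factor : ∀ m → mono (+ 2) (e + exponent d (suc r₂) m) ⊕ mono (+ 2) (e + exponent d (suc r₁) (suc m)) ≋ mono (+ 2) e ⊗ (high m ⊕ low m)
  factor m = ≋-trans (⊕-cong (≋-sym (mono-⊗ (+ 2) e (+ 1) (exponent d (suc r₂) m))) (≋-sym (mono-⊗ (+ 2) e (+ 1) (exponent d (suc r₁) (suc m)))))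
    (solve 3 (λ a b c → a :* b :+ a :* c := a :* (b :+ c)) ≋-refl (mono (+ 2) e) (high m) (low m))

section-formula : ∀ {r} e r₁ r₂ → r < 4 → suc r₁ + suc r₂ ≡ 16 →
  (∀ m → sect r (octuple m) ≋ mono (+ 2) (e + exponent 16 (suc r₂) m) ⊕ mono (+ 2) (e + exponent 16 (suc r₁) (suc m))) →
  ∀ n → u (n * 4 + r) ≡ rhs e (suc r₁) (suc r₂) n
section-formula {r} e r₁ r₂ r<4 d≡16 block n = coeff (begin
  sect r u
    ≈⟨ sect-cong r u-product ⟩
  sect r (dil V ⊗ (mono (+ 2) 2 ⊗ ψ₁))
    ≈⟨ sect-dil-⊗ r<4 V (mono (+ 2) 2 ⊗ ψ₁) ⟩
  V ⊗ sect r (mono (+ 2) 2 ⊗ ψ₁)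
    ≈⟨ ⊗-cong (≋-refl {V}) dissection ⟩
  V ⊗ (mono (+ 2) e ⊗ (qq 16 ⊗ a ⊗ b))
    ≈⟨ solve 5 (λ v m e a b → v :* (m :* (e :* a :* b)) := m :* e :* a :* b :* v) ≋-refl V (mono (+ 2) e) (qq 16) a b ⟩
  mono (+ 2) e ⊗ qq 16 ⊗ a ⊗ b ⊗ V ∎) n
  where
  open ≋-Reasoning
  open FPS-Solver
  a = poch (ℤ.- + 1) (suc r₁) 16
  b = poch (ℤ.- + 1) (suc r₂) 16
  dissection : sect r (mono (+ 2) 2 ⊗ ψ₁) ≋ mono (+ 2) e ⊗ (qq 16 ⊗ a ⊗ b)
  dissection = subst (λ d → (∀ m → sect r (octuple m) ≋ mono (+ 2) (e + exponent d (suc r₂) m) ⊕ mono (+ 2) (e + exponent d (suc r₁) (suc m)))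
      → sect r (mono (+ 2) 2 ⊗ ψ₁) ≋ mono (+ 2) e ⊗ (qq d ⊗ poch (ℤ.- + 1) (suc r₁) d ⊗ poch (ℤ.- + 1) (suc r₂) d))
    d≡16 (dissect e r₁ r₂ r<4) block

private
  octuple-sections : ∀ r m {f₀ f₁ f₂ f₃ f₄ f₅ f₆ f₇} →
    sect r (summand (m * 8)) ≋ f₀ → sect r (summand (1 + m * 8)) ≋ f₁ → sect r (summand (2 + m * 8)) ≋ f₂ → sect r (summand (3 + m * 8)) ≋ f₃ →
    sect r (summand (4 + m * 8)) ≋ f₄ → sect r (summand (5 + m * 8)) ≋ f₅ → sect r (summand (6 + m * 8)) ≋ f₆ → sect r (summand (7 + m * 8)) ≋ f₇ →
    sect r (octuple m) ≋ f₀ ⊕ f₁ ⊕ f₂ ⊕ f₃ ⊕ f₄ ⊕ f₅ ⊕ f₆ ⊕ f₇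
  octuple-sections r m e₀ e₁ e₂ e₃ e₄ e₅ e₆ e₇ =
    ⊕-cong (⊕-cong (⊕-cong (⊕-cong (⊕-cong (⊕-cong (⊕-cong e₀ e₁) e₂) e₃) e₄) e₅) e₆) e₇

  sect-mono-≡ : ∀ {k e r e′} → Division k e r → e′ ≡ e → sect r (mono (+ 2) k) ≋ mono (+ 2) e′
  sect-mono-≡ k≡ refl = sect-mono (+ 2) k≡

octuple-0 : ∀ m → sect 0 (octuple m) ≋ mono (+ 2) (2 + exponent 16 15 m) ⊕ mono (+ 2) (2 + exponent 16 1 (suc m))
octuple-0 m = ≋-trans
  (octuple-sections 0 m
    (sect-mono-𝟎 (+ 2) 0 (2+tri₀ m) λ ()) (sect-mono-𝟎 (+ 2) 0 (2+tri₁ m) λ ()) (sect-mono-𝟎 (+ 2) 0 (2+tri₂ m) λ ())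
    (sect-mono-≡ (2+tri₃ m) (cong (λ x → 2 + x) (exponent-high 8 7 m))) (sect-mono-≡ (2+tri₄ m) (cong (λ x → 2 + x) (exponent-low 8 1 m)))
    (sect-mono-𝟎 (+ 2) 0 (2+tri₅ m) λ ()) (sect-mono-𝟎 (+ 2) 0 (2+tri₆ m) λ ()) (sect-mono-𝟎 (+ 2) 0 (2+tri₇ m) λ ()))
  (solve 2 (λ a b → o :+ o :+ o :+ a :+ b :+ o :+ o :+ o := a :+ b) ≋-refl (mono (+ 2) (2 + exponent 16 15 m)) (mono (+ 2) (2 + exponent 16 1 (suc m))))
  where
  open FPS-Solver
  o : Polynomial 2
  o = con (+ 0)

octuple-1 : ∀ m → sect 1 (octuple m) ≋ mono (+ 2) (1 + exponent 16 13 m) ⊕ mono (+ 2) (1 + exponent 16 3 (suc m))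
octuple-1 m = ≋-trans
  (octuple-sections 1 m
    (sect-mono-𝟎 (+ 2) 1 (2+tri₀ m) λ ()) (sect-mono-𝟎 (+ 2) 1 (2+tri₁ m) λ ())
    (sect-mono-≡ (2+tri₂ m) (cong suc (exponent-high 8 5 m)))
    (sect-mono-𝟎 (+ 2) 1 (2+tri₃ m) λ ()) (sect-mono-𝟎 (+ 2) 1 (2+tri₄ m) λ ())
    (sect-mono-≡ (2+tri₅ m) (cong suc (exponent-low 8 3 m)))
    (sect-mono-𝟎 (+ 2) 1 (2+tri₆ m) λ ()) (sect-mono-𝟎 (+ 2) 1 (2+tri₇ m) λ ()))
  (solve 2 (λ a b → o :+ o :+ a :+ o :+ o :+ b :+ o :+ o := a :+ b) ≋-refl (mono (+ 2) (1 + exponent 16 13 m)) (mono (+ 2) (1 + exponent 16 3 (suc m))))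
  where
  open FPS-Solver
  o : Polynomial 2
  o = con (+ 0)

octuple-2 : ∀ m → sect 2 (octuple m) ≋ mono (+ 2) (exponent 16 9 m) ⊕ mono (+ 2) (exponent 16 7 (suc m))
octuple-2 m = ≋-trans
  (octuple-sections 2 m
    (sect-mono-≡ (2+tri₀ m) (exponent-high 8 1 m))
    (sect-mono-𝟎 (+ 2) 2 (2+tri₁ m) λ ()) (sect-mono-𝟎 (+ 2) 2 (2+tri₂ m) λ ()) (sect-mono-𝟎 (+ 2) 2 (2+tri₃ m) λ ())
    (sect-mono-𝟎 (+ 2) 2 (2+tri₄ m) λ ()) (sect-mono-𝟎 (+ 2) 2 (2+tri₅ m) λ ()) (sect-mono-𝟎 (+ 2) 2 (2+tri₆ m) λ ())
    (sect-mono-≡ (2+tri₇ m) (exponent-low 8 7 m)))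
  (solve 2 (λ a b → a :+ o :+ o :+ o :+ o :+ o :+ o :+ b := a :+ b) ≋-refl (mono (+ 2) (exponent 16 9 m)) (mono (+ 2) (exponent 16 7 (suc m))))
  where
  open FPS-Solver
  o : Polynomial 2
  o = con (+ 0)

octuple-3 : ∀ m → sect 3 (octuple m) ≋ mono (+ 2) (exponent 16 11 m) ⊕ mono (+ 2) (exponent 16 5 (suc m))
octuple-3 m = ≋-trans
  (octuple-sections 3 m
    (sect-mono-𝟎 (+ 2) 3 (2+tri₀ m) λ ())
    (sect-mono-≡ (2+tri₁ m) (exponent-high 8 3 m))
    (sect-mono-𝟎 (+ 2) 3 (2+tri₂ m) λ ()) (sect-mono-𝟎 (+ 2) 3 (2+tri₃ m) λ ()) (sect-mono-𝟎 (+ 2) 3 (2+tri₄ m) λ ())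
    (sect-mono-𝟎 (+ 2) 3 (2+tri₅ m) λ ())
    (sect-mono-≡ (2+tri₆ m) (exponent-low 8 5 m))
    (sect-mono-𝟎 (+ 2) 3 (2+tri₇ m) λ ()))
  (solve 2 (λ a b → o :+ a :+ o :+ o :+ o :+ o :+ b :+ o := a :+ b) ≋-refl (mono (+ 2) (exponent 16 11 m)) (mono (+ 2) (exponent 16 5 (suc m))))
  where
  open FPS-Solver
  o : Polynomial 2
  o = con (+ 0)

theorem2p4 : ((n : ℕ) → u (4 * n) ≡ rhs 2 1 15 n)
    × ((n : ℕ) → u (4 * n + 1) ≡ rhs 1 3 13 n)
    × ((n : ℕ) → u (4 * n + 2) ≡ rhs 0 7 9 n)
    × ((n : ℕ) → u (4 * n + 3) ≡ rhs 0 5 11 n)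
theorem2p4 =
    (λ n → trans (cong u (trans (ℕₚ.*-comm 4 n) (sym (ℕₚ.+-identityʳ (n * 4))))) (section-formula 2 0 14 (s≤s z≤n) refl octuple-0 n))
  , (λ n → trans (cong (λ m → u (m + 1)) (ℕₚ.*-comm 4 n)) (section-formula 1 2 12 (s≤s (s≤s z≤n)) refl octuple-1 n))
  , (λ n → trans (cong (λ m → u (m + 2)) (ℕₚ.*-comm 4 n)) (section-formula 0 6 8 (s≤s (s≤s (s≤s z≤n))) refl octuple-2 n))
  , (λ n → trans (cong (λ m → u (m + 3)) (ℕₚ.*-comm 4 n)) (section-formula 0 4 10 (s≤s (s≤s (s≤s (s≤s z≤n)))) refl octuple-3 n))
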